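{- Let $G$ be a graph with maximum vertex degree at most $3$, and let $T_1,T_2\subseteq V(G)$ be two disjoint subsets of vertices with $|T_1|=k$ (where $k\geq 12000$ is an integral power of $2$) and $|T_2|=k'=k/64$, such that the degree of every vertex of $T_1\cup T_2$ in $G$ is $1$, the set $T_1$ is $1$-well-linked in $G$, and $(T_1,T_2)$ are $\frac12$-linked in $G$. Then there is a $2$-cluster chain in $G$ (with respect to $T_1,T_2$).
   Context: Graphs are finite, without loops; parallel edges are allowed. A flow from a vertex set $S$ to a vertex set $S'$ assigns non-negative values to paths from $S$ to $S'$; its edge-congestion is the maximum, over all edges, of the total flow on paths through that edge. A one-to-one flow from $S$ to $S'$ (with $|S|=|S'|$) is a flow in which every vertex of $S$ sends exactly one flow unit and every vertex of $S'$ receives exactly one flow unit. For $0<\alpha\le1$: a set $T\subseteq V(G)$ is $\alpha$-well-linked in $G$ iff for every pair of disjoint equal-sized subsets $T',T''\subseteq T$ there is a one-to-one flow from $T'$ to $T''$ in $G$ with edge-congestion at most $1/\alpha$. For an integer $\kappa$, $T$ is $(\kappa,\alpha)$-well-linked in $G$ iff this holds for all disjoint $T',T''\subseteq T$ with $|T'|=|T''|\leq \kappa$. Two disjoint vertex sets $(T_1,T_2)$ are $\alpha$-linked in $G$ iff for all $T_1'\subseteq T_1$, $T_2'\subseteq T_2$ with $|T_1'|=|T_2'|$ there is a one-to-one flow from $T_1'$ to $T_2'$ in $G$ with edge-congestion at most $1/\alpha$. 2-cluster chain: let $T_1,T_2$ be disjoint vertex sets of $G$ with $|T_1|=k$, $|T_2|=k'=k/64$,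 where $k\ge 12000$ is an integral power of $2$. A $2$-cluster chain $(X,Y,\tilde T_1,\tilde T_2,E')$ consists of: two disjoint sets $X,Y\subseteq V(G)$; a subset $\tilde T_1\subseteq T_1\cap X$ with $|\tilde T_1|=k'$ and a subset $\tilde T_2\subseteq T_2\cap Y$ with $|\tilde T_2|=k/512$; a set $E'$ of $k/512$ edges, each with one endpoint in $X$ and the other in $Y$, whose endpoints are all distinct; such that, denoting by $\Upsilon_X\subseteq X$ and $\Upsilon_Y\subseteq Y$ the sets of endpoints of the edges of $E'$ lying in $X$ and $Y$ respectively, $\tilde T_1\cup\Upsilon_X$ is $(k/512,\alpha^*)$-well-linked in $G[X]$ and $\tilde T_2\cup \Upsilon_Y$ is $(k/512,\alpha^*)$-well-linked in $G[Y]$, for $\alpha^*=1/64$.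
   Formalization: Flow values are rational instead of real, both in the well-linkedness and linkedness assumptions and in the conclusion; the two versions are equivalent, since a finite linear system with rational coefficients that has a real solution has a rational one. -}

module Defs where

open import Data.Bool using (true)
open import Data.Fin using (Fin)
open import Data.Fin.Properties using (any?) renaming (_≟_ to _≟ᶠ_)
open import Data.Fin.Subset using (Subset; _∈_; _⊆_; _∩_; _∪_; ∣_∣; Empty; ⊤)
open import Data.Fin.Subset.Properties using (_∈?_; ∈⊤)
open import Data.Integer using (+_)
open import Data.List using (List; []; _∷_; map; filter; foldr; allFin)
import Data.List.Membership.Propositional as List
import Data.List.Membership.DecPropositional as DecList
open import Data.List.Relation.Unary.Unique.Propositional using (Unique)
open import Data.Nat as ℕ using (ℕ)
open import Data.Product using (∃; _×_; _,_; proj₁; proj₂)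
open import Data.Rational as ℚ using (ℚ; 0ℚ; 1ℚ; 1/_; Positive)
open import Data.Rational.Properties using (pos⇒nonZero; ≤-decTotalOrder)
open import Relation.Binary.Bundles using (DecTotalOrder)
open import Data.List.Extrema (DecTotalOrder.totalOrder ≤-decTotalOrder) using (max)
open import Data.Sum using (_⊎_)
open import Data.Vec using (tabulate)
open import Data.Vec.Properties using (lookup∘tabulate; []=⇒lookup; lookup⇒[]=)
open import Relation.Binary.PropositionalEquality using (_≡_; _≢_; refl; sym; trans)
open import Relation.Nullary using (Dec; yes; does)
open import Relation.Nullary.Decidable using (_×-dec_; _⊎-dec_; dec-true)
open import Relation.Unary using (Pred; Decidable)

------------------------------------------------------------------------
-- Finite subsets

module _ {n ℓ} {P : Pred (Fin n) ℓ} where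

  -- The subset { i ∣ P i }.
  comprehension : Decidable P → Subset n
  comprehension P? = tabulate (λ i → does (P? i))

  ∈-comprehension⁺ : (P? : Decidable P) → ∀ {i} → P i → i ∈ comprehension P?
  ∈-comprehension⁺ P? {i} p =
    lookup⇒[]= i _ (trans (lookup∘tabulate _ i) (dec-true (P? i) p))

  ∈-comprehension⁻ : (P? : Decidable P) → ∀ {i} → i ∈ comprehension P? → P i
  ∈-comprehension⁻ P? {i} i∈ = witness (P? i) (trans (sym (lookup∘tabulate _ i)) ([]=⇒lookup i∈))
    where
    witness : (d : Dec (P i)) → does d ≡ true → P i
    witness (yes p) refl = p

Disjoint : ∀ {n} → Subset n → Subset n → Set
Disjoint p q = Empty (p ∩ q)

------------------------------------------------------------------------
-- Graphs

-- Loopless, with parallel edges allowed. Edges are undirected: the order of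
-- the two components of `ends e` is never used.
record Graph : Set where
  field
    order    : ℕ
    size     : ℕ
    ends     : Fin size → Fin order × Fin order
    loopless : ∀ e → proj₁ (ends e) ≢ proj₂ (ends e)

  Vertex : Set
  Vertex = Fin order

  Edge : Set
  Edge = Fin size

  _isEndOf_ : Vertex → Edge → Set
  v isEndOf e = v ≡ proj₁ (ends e) ⊎ v ≡ proj₂ (ends e)

  _isEndOf?_ : ∀ v e → Dec (v isEndOf e)
  v isEndOf? e = (v ≟ᶠ proj₁ (ends e)) ⊎-dec (v ≟ᶠ proj₂ (ends e))

  _joins_and_ : Edge → Vertex → Vertex → Set
  e joins u and v = ends e ≡ (u , v) ⊎ ends e ≡ (v , u)

  degree : Vertex → ℕ
  degree v = ∣ comprehension (v isEndOf?_) ∣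

open Graph

record Subgraph (G : Graph) : Set where
  field
    vertices : Subset (order G)
    edges    : Subset (size G)
    closed   : ∀ {e} → e ∈ edges →
               proj₁ (ends G e) ∈ vertices × proj₂ (ends G e) ∈ vertices

open Subgraph

whole : (G : Graph) → Subgraph G
whole G = record { vertices = ⊤ ; edges = ⊤ ; closed = λ _ → ∈⊤ , ∈⊤ }

_[_] : (G : Graph) → Subset (order G) → Subgraph G
G [ X ] = record
  { vertices = X
  ; edges    = comprehension inside?
  ; closed   = ∈-comprehension⁻ inside?
  }
  where
  inside? : ∀ e → Dec (proj₁ (ends G e) ∈ X × proj₂ (ends G e) ∈ X)
  inside? e = (proj₁ (ends G e) ∈? X) ×-dec (proj₂ (ends G e) ∈? X)

------------------------------------------------------------------------
-- Paths and flows

sum : List ℚ → ℚ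
sum = foldr ℚ._+_ 0ℚ

module _ {G : Graph} (H : Subgraph G) where

  data Walk : Vertex G → Vertex G → Set where
    stop : ∀ {v} → v ∈ vertices H → Walk v v
    step : ∀ {u v w} (e : Edge G) → e ∈ edges H → _joins_and_ G e u v →
           Walk v w → Walk u w

  walkVertices : ∀ {u v} → Walk u v → List (Vertex G)
  walkVertices {u} (stop _)       = u ∷ []
  walkVertices {u} (step _ _ _ w) = u ∷ walkVertices w

  walkEdges : ∀ {u v} → Walk u v → List (Edge G)
  walkEdges (stop _)       = []
  walkEdges (step e _ _ w) = e ∷ walkEdges w

  record Path (S S′ : Subset (order G)) : Set where
    field
      source    : Vertex G
      target    : Vertex G
      source∈S  : source ∈ S
      target∈S′ : target ∈ S′
      walk      : Walk source target
      simple    : Unique (walkVertices walk)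

  open Path

  _goesThrough_ : ∀ {S S′} → Path S S′ → Edge G → Set
  p goesThrough e = e List.∈ walkEdges (walk p)

  _goesThrough?_ : ∀ {S S′} (p : Path S S′) e → Dec (p goesThrough e)
  p goesThrough? e = e ∈ˡ? walkEdges (walk p)
    where open DecList (_≟ᶠ_ {n = size G}) renaming (_∈?_ to _∈ˡ?_)

  record WeightedPath (S S′ : Subset (order G)) : Set where
    field
      path    : Path S S′
      value   : ℚ
      value≥0 : 0ℚ ℚ.≤ value

  open WeightedPath

  -- An assignment of non-negative values to paths, given by a list of
  -- path–value pairs: a path receives the sum of the values listed with it,
  -- and unlisted paths receive 0. Values are rational; since all constraints
  -- imposed on flows below are linear with rational coefficients, a rational
  -- flow satisfying them exists iff a real one does.
  Flow : Subset (order G) → Subset (order G) → Set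
  Flow S S′ = List (WeightedPath S S′)

  module _ {S S′ : Subset (order G)} (f : Flow S S′) where

    sentBy : Vertex G → ℚ
    sentBy s = sum (map value (filter (λ p → source (path p) ≟ᶠ s) f))

    receivedBy : Vertex G → ℚ
    receivedBy t = sum (map value (filter (λ p → target (path p) ≟ᶠ t) f))

    load : Edge G → ℚ
    load e = sum (map value (filter (λ p → path p goesThrough? e) f))

    -- Loads are non-negative, so 0ℚ only matters if there are no edges.
    edgeCongestion : ℚ
    edgeCongestion = max 0ℚ (map load (filter (_∈? edges H) (allFin (size G))))

    OneToOne : Set
    OneToOne = (∀ {s} → s ∈ S → sentBy s ≡ 1ℚ) × (∀ {t} → t ∈ S′ → receivedBy t ≡ 1ℚ)

  ------------------------------------------------------------------------
  -- Well-linkedness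

  module _ (α : ℚ) .{{_ : Positive α}} where

    HasOneToOneFlow : Subset (order G) → Subset (order G) → Set
    HasOneToOneFlow S S′ = ∃ λ (f : Flow S S′) →
      OneToOne f × edgeCongestion f ℚ.≤ (1/ α) {{pos⇒nonZero α}}

    WellLinked : Subset (order G) → Set
    WellLinked T = T ⊆ vertices H ×
      (∀ T′ T″ → T′ ⊆ T → T″ ⊆ T → Disjoint T′ T″ → ∣ T′ ∣ ≡ ∣ T″ ∣ →
       HasOneToOneFlow T′ T″)

    BoundedWellLinked : ℕ → Subset (order G) → Set
    BoundedWellLinked κ T = T ⊆ vertices H ×
      (∀ T′ T″ → T′ ⊆ T → T″ ⊆ T → Disjoint T′ T″ → ∣ T′ ∣ ≡ ∣ T″ ∣ → ∣ T′ ∣ ℕ.≤ κ →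
       HasOneToOneFlow T′ T″)

    Linked : Subset (order G) → Subset (order G) → Set
    Linked T₁ T₂ = T₁ ⊆ vertices H × T₂ ⊆ vertices H × Disjoint T₁ T₂ ×
      (∀ T₁′ T₂′ → T₁′ ⊆ T₁ → T₂′ ⊆ T₂ → ∣ T₁′ ∣ ≡ ∣ T₂′ ∣ →
       HasOneToOneFlow T₁′ T₂′)

------------------------------------------------------------------------
-- 2-cluster chains

module _ (G : Graph) where

  -- The endpoints of the edges of E′ that lie in X.
  endpointsIn : Subset (size G) → Subset (order G) → Subset (order G)
  endpointsIn E′ X = comprehension λ v →
    (v ∈? X) ×-dec any? (λ e → (e ∈? E′) ×-dec _isEndOf?_ G v e)

  α* : ℚ
  α* = + 1 ℚ./ 64

  -- Meant for k a power of 2 with k ≥ 12000, so that the divisions are exact.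
  record TwoClusterChain (k : ℕ) (T₁ T₂ : Subset (order G)) : Set where
    field
      X Y          : Subset (order G)
      X∩Y=∅        : Disjoint X Y

      T̃₁           : Subset (order G)
      T̃₁⊆T₁∩X      : T̃₁ ⊆ T₁ ∩ X
      ∣T̃₁∣         : ∣ T̃₁ ∣ ≡ k ℕ./ 64

      T̃₂           : Subset (order G)
      T̃₂⊆T₂∩Y      : T̃₂ ⊆ T₂ ∩ Y
      ∣T̃₂∣         : ∣ T̃₂ ∣ ≡ k ℕ./ 512

      E′           : Subset (size G)
      ∣E′∣         : ∣ E′ ∣ ≡ k ℕ./ 512
      E′-crosses   : ∀ {e} → e ∈ E′ →
                     ∃ λ x → ∃ λ y → x ∈ X × y ∈ Y × _joins_and_ G e x y
      -- The two endpoints of a single edge differ because G is loopless.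
      E′-distinct  : ∀ {e e′ v} → e ∈ E′ → e′ ∈ E′ →
                     _isEndOf_ G v e → _isEndOf_ G v e′ → e ≡ e′

      X-wellLinked : BoundedWellLinked (G [ X ]) α* (k ℕ./ 512) (T̃₁ ∪ endpointsIn E′ X)
      Y-wellLinked : BoundedWellLinked (G [ Y ]) α* (k ℕ./ 512) (T̃₂ ∪ endpointsIn E′ Y)

-- Put k = 512κ and write t S, u S for the numbers of terminals of T₁, T₂ in S. By the easy half
-- of max-flow min-cut, every S with at most half of T₁ satisfies min (t S) (12κ) ≤ ∂ S and
-- u S ≤ 2 ∂ S. Take a minimal set F of edges for which these inequalities persist, and count
-- boundaries in F. By minimality every edge of F crosses a set for which one of them is tight,
-- and the bound ∂ ≤ t + u survives the union with such a set. If every admissible set could be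
-- split cheaply into parts with at most 12κ terminals, then, growing a set by tight sets up to
-- the whole graph, its cheapest splitting would at some point cost about 100κ; packing its
-- parts into at most seven bins of weight at most 256κ each and recombining these in pairs would
-- give a cheaper splitting. Hence some A and its complement are robust, that is, not cheaply
-- splittable. A boundary-minimal robust subset of A, and one of its complement, cannot be
-- divided evenly by few edges, and a minimum cut between these two cores is the boundary
-- between the two clusters. Each cluster inherits from its core that of the two sides of any
-- cut with fewer than κ / 16 edges, one is joined to the rest of the graph by few edges. The
-- sets saturated by a choice of edges or of terminals are closed under union, so maximal
-- independent choices are large enough for E′ and T̃₂. Max-flow min-cut with capacity 64 in
-- each cluster then yields well-linkedness.

module Submission where

open import Defs
open import Data.Fin.Subset using (Subset; _∈_; _∪_; ∣_∣)
open import Data.Nat using (ℕ; _≤_; _^_; _/_)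
open import Data.Product using (∃)
open import Data.Rational using (1ℚ; ½)
open import Relation.Binary.PropositionalEquality using (_≡_)

open import Algebra.Bundles using (CommutativeMonoid)
import Algebra.Properties.CommutativeSemigroup as CommutativeSemigroupProperties
open import Data.Bool using (Bool; true; false; T; not; _∧_; _∨_; _xor_; if_then_else_)
open import Data.Bool.Properties using (T?)
open import Data.Empty using (⊥; ⊥-elim)
open import Data.Fin using (Fin; zero; suc)
open import Data.Fin.Properties using (any?; all?) renaming (_≟_ to _≟ᶠ_)
open import Data.Fin.Subset using (_⊆_)
open import Data.Fin.Subset.Properties using (anySubset?; x∈p∩q⁺; x∈p∩q⁻; ∈⊤) renaming (_∈?_ to _∈ˢ?_)
open import Data.List as List using (List; []; _∷_; length; filter; allFin)
open import Relation.Binary.Bundles using (DecTotalOrder)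
import Data.Rational.Properties as ℚR
open import Data.List.Extrema (DecTotalOrder.totalOrder ℚR.≤-decTotalOrder) using (xs≤max; max≤v⁺)
open import Data.List.Membership.Propositional using () renaming (_∈_ to _∈ˡ_)
open import Data.List.Membership.Propositional.Properties using (∈-map⁺; ∈-filter⁺; ∈-allFin)
open import Data.List.Relation.Unary.All as All using (All; []; _∷_)
open import Data.List.Relation.Unary.AllPairs using ([]; _∷_)
open import Data.List.Relation.Unary.Any using (here; there)
open import Data.List.Relation.Unary.Unique.Propositional using (Unique)
open import Data.Nat using (zero; suc; _+_; _*_; _∸_; _<_; z≤n; s≤s; s≤s⁻¹; pred; _≤?_; _<?_; _≟_; _≤ᵇ_)
open import Data.Nat.DivMod using (m*n/n≡m)
open import Data.Nat.Properties
open import Data.Nat.Tactic.RingSolver using (solve-∀)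
open import Data.Product using (Σ; _×_; _,_; proj₁; proj₂)
open import Data.Rational as ℚ using (ℚ; 0ℚ)
open import Data.Sum using (_⊎_; inj₁; inj₂)
open import Data.Unit using (⊤; tt)
open import Data.Vec as Vec using (Vec; []; _∷_; lookup; tabulate)
open import Data.Vec.Properties using ([]=⇒lookup; lookup⇒[]=; lookup∘tabulate; lookup-zipWith)
open import Function using (_∘_; id; case_of_)
open import Relation.Binary.PropositionalEquality using (_≢_; refl; sym; trans; cong; cong₂; subst; subst₂)
open import Relation.Nullary using (¬_; Dec; yes; no; does)
open import Relation.Nullary.Decidable using (decidable-stable; dec-true; map′; _×-dec_; _⊎-dec_; _→-dec_; ¬?)

open CommutativeSemigroupProperties +-commutativeSemigroup using ()
  renaming (interchange to +-interchange; x∙yz≈y∙xz to +-swap)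
open CommutativeSemigroupProperties (CommutativeMonoid.commutativeSemigroup ℚR.+-0-commutativeMonoid) using ()
  renaming (interchange to ℚ-interchange)

-- Boundaries in the given graph are bounded only from below: nothing prevents a set with few
-- terminals from having many outgoing edges, and then a splitting that is cheap relative to its
-- boundary may still be expensive. Passing to a minimal `F` supplies the missing upper bound ∂ ≤ t
-- + u, at most 520κ, for the growing set, and the packing argument needs such a budget. The
-- constants fit together as follows. The threshold 12 comes from the choice of E′: fewer than κ
-- chosen edges touch at most 2·3 boundary edges each, the two saturated sets account for at most
-- 2·45/16 more per chosen edge, and 6 + 90/16 < 12. The ratio 43 of robustness becomes 44 for a
-- core, 45 for a side of the minimum cut, and 46 when the dividing edges are counted into a
-- boundary. Hence terminals of T₁ need capacity 46; 48 is reserved for terminals and 16 for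
-- endpoints of E′, together 64.

-- Linear inequalities over ℕ

data Linear (n : ℕ) : Set where
  var  : Fin n → Linear n
  con  : ℕ → Linear n
  _⊕_  : Linear n → Linear n → Linear n
  _⊗_  : Linear n → ℕ → Linear n

infixl 6 _⊕_
infixl 7 _⊗_
infix 5 _≼_

⟦_⟧ : ∀ {n} → Linear n → Vec ℕ n → ℕ
⟦ var i ⟧ ρ = Vec.lookup ρ i
⟦ con c ⟧ ρ = c
⟦ a ⊕ b ⟧ ρ = ⟦ a ⟧ ρ + ⟦ b ⟧ ρ
⟦ a ⊗ c ⟧ ρ = ⟦ a ⟧ ρ * c

-- A normal form is a constant together with one coefficient per variable, so that two forms can be
-- compared coefficientwise.
eval : ∀ {n} → ℕ × Vec ℕ n → Vec ℕ n → ℕ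
eval (c , [])     []      = c
eval (c , x ∷ xs) (y ∷ ρ) = x * y + eval (c , xs) ρ

_⊞_ : ∀ {n} → ℕ × Vec ℕ n → ℕ × Vec ℕ n → ℕ × Vec ℕ n
(c , xs) ⊞ (d , ys) = c + d , Vec.zipWith _+_ xs ys

_⊠_ : ∀ {n} → ℕ → ℕ × Vec ℕ n → ℕ × Vec ℕ n
m ⊠ (c , xs) = m * c , Vec.map (m *_) xs

normal : ∀ {n} → Linear n → ℕ × Vec ℕ n
normal (var i) = 0 , Vec.replicate _ 0 Vec.[ i ]≔ 1
normal (con c) = c , Vec.replicate _ 0
normal (a ⊕ b) = normal a ⊞ normal b
normal (a ⊗ c) = c ⊠ normal a

eval-⊞ : ∀ {n} (a b : ℕ × Vec ℕ n) ρ → eval (a ⊞ b) ρ ≡ eval a ρ + eval b ρ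
eval-⊞ (c , [])     (d , [])     []      = refl
eval-⊞ (c , x ∷ xs) (d , y ∷ ys) (z ∷ ρ) =
  trans (cong ((x + y) * z +_) (eval-⊞ (c , xs) (d , ys) ρ))
        (lemma x y z (eval (c , xs) ρ) (eval (d , ys) ρ))
  where
  lemma : ∀ x y z a b → (x + y) * z + (a + b) ≡ x * z + a + (y * z + b)
  lemma = solve-∀

eval-⊠ : ∀ {n} m (a : ℕ × Vec ℕ n) ρ → eval (m ⊠ a) ρ ≡ m * eval a ρ
eval-⊠ m (c , [])     []      = refl
eval-⊠ m (c , x ∷ xs) (z ∷ ρ) =
  trans (cong (m * x * z +_) (eval-⊠ m (c , xs) ρ)) (lemma m x z (eval (c , xs) ρ))
  where
  lemma : ∀ m x z a → m * x * z + m * a ≡ m * (x * z + a)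
  lemma = solve-∀

eval-con : ∀ n c (ρ : Vec ℕ n) → eval (c , Vec.replicate n 0) ρ ≡ c
eval-con zero    c []      = refl
eval-con (suc n) c (z ∷ ρ) = eval-con n c ρ

eval-var : ∀ {n} (i : Fin n) (ρ : Vec ℕ n) → eval (0 , Vec.replicate n 0 Vec.[ i ]≔ 1) ρ ≡ Vec.lookup ρ i
eval-var zero    (z ∷ ρ) = trans (cong (z + 0 +_) (eval-con _ 0 ρ)) (trans (+-identityʳ _) (+-identityʳ z))
eval-var (suc i) (z ∷ ρ) = eval-var i ρ

normal-correct : ∀ {n} (a : Linear n) ρ → eval (normal a) ρ ≡ ⟦ a ⟧ ρ
normal-correct (var i) ρ = eval-var i ρ
normal-correct (con c) ρ = eval-con _ c ρ
normal-correct (a ⊕ b) ρ = trans (eval-⊞ (normal a) (normal b) ρ) (cong₂ _+_ (normal-correct a ρ) (normal-correct b ρ))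
normal-correct (a ⊗ c) ρ = trans (eval-⊠ c (normal a) ρ) (trans (cong (c *_) (normal-correct a ρ)) (*-comm c _))

leqᵇ : ∀ {n} → ℕ × Vec ℕ n → ℕ × Vec ℕ n → Bool
leqᵇ (c , [])     (d , [])     = c ≤ᵇ d
leqᵇ (c , x ∷ xs) (d , y ∷ ys) = (x ≤ᵇ y) ∧ leqᵇ (c , xs) (d , ys)

T-∧⁻ : ∀ a {b} → T (a ∧ b) → T a × T b
T-∧⁻ true p = tt , p

-- Comparing coefficients is enough because the variables range over natural numbers.
leqᵇ-sound : ∀ {n} (a b : ℕ × Vec ℕ n) → T (leqᵇ a b) → ∀ ρ → eval a ρ ≤ eval b ρ
leqᵇ-sound (c , [])     (d , [])     p []      = ≤ᵇ⇒≤ c d p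
leqᵇ-sound (c , x ∷ xs) (d , y ∷ ys) p (z ∷ ρ) with T-∧⁻ (x ≤ᵇ y) p
... | p₁ , p₂ = +-mono-≤ (*-monoˡ-≤ z (≤ᵇ⇒≤ x y p₁)) (leqᵇ-sound (c , xs) (d , ys) p₂ ρ)

record Ineq (n : ℕ) : Set where
  constructor _≼_
  field
    lhs rhs : Linear n
open Ineq

Holds : ∀ {n} → Vec ℕ n → List (ℕ × Ineq n) → Set
Holds ρ []             = ⊤
Holds ρ ((_ , h) ∷ hs) = ⟦ lhs h ⟧ ρ ≤ ⟦ rhs h ⟧ ρ × Holds ρ hs

sumˡ sumʳ : ∀ {n} → List (ℕ × Ineq n) → Linear n
sumˡ []             = con 0
sumˡ ((c , h) ∷ hs) = lhs h ⊗ c ⊕ sumˡ hs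
sumʳ []             = con 0
sumʳ ((c , h) ∷ hs) = rhs h ⊗ c ⊕ sumʳ hs

sums : ∀ {n} (ρ : Vec ℕ n) hs → Holds ρ hs → ⟦ sumˡ hs ⟧ ρ ≤ ⟦ sumʳ hs ⟧ ρ
sums ρ []             _       = z≤n
sums ρ ((c , h) ∷ hs) (p , q) = +-mono-≤ (*-monoˡ-≤ c p) (sums ρ hs q)

-- Farkas certificates: the goal, taken suc m times, is the given combination
-- of the hypotheses, up to terms with non-negative coefficients.
abstract
  linear : ∀ {n} (m : ℕ) (ρ : Vec ℕ n) (hs : List (ℕ × Ineq n)) (g : Ineq n) →
           {_ : T (leqᵇ (normal (lhs g ⊗ suc m ⊕ sumʳ hs)) (normal (rhs g ⊗ suc m ⊕ sumˡ hs)))} →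
           Holds ρ hs → ⟦ lhs g ⟧ ρ ≤ ⟦ rhs g ⟧ ρ
  -- Right-hand sides of hypotheses are added on the left of the goal and conversely, which avoids
  -- subtraction; `sums` allows them to be cancelled.
  linear {n} m ρ hs g {ok} h = *-cancelʳ-≤ _ _ (suc m) (+-cancelʳ-≤ (⟦ sumʳ hs ⟧ ρ) _ _ (begin
    ⟦ a ⟧ ρ                               ≡⟨ normal-correct a ρ ⟨
    eval (normal a) ρ                      ≤⟨ leqᵇ-sound (normal a) (normal b) ok ρ ⟩
    eval (normal b) ρ                      ≡⟨ normal-correct b ρ ⟩
    ⟦ rhs g ⟧ ρ * suc m + ⟦ sumˡ hs ⟧ ρ   ≤⟨ +-monoʳ-≤ (⟦ rhs g ⟧ ρ * suc m) (sums ρ hs h) ⟩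
    ⟦ rhs g ⟧ ρ * suc m + ⟦ sumʳ hs ⟧ ρ   ∎))
    where
    open ≤-Reasoning
    a b : Linear n
    a = lhs g ⊗ suc m ⊕ sumʳ hs
    b = rhs g ⊗ suc m ⊕ sumˡ hs

refute : ∀ {n} (ρ : Vec ℕ n) (hs : List (ℕ × Ineq n)) →
         {_ : T (leqᵇ (normal (con 1 ⊗ 1 ⊕ sumʳ hs)) (normal (con 0 ⊗ 1 ⊕ sumˡ hs)))} → Holds ρ hs → ⊥
refute ρ hs {ok} h = 1+n≰n {0} (linear 0 ρ hs (con 1 ≼ con 0) {ok} h)

-- Counting

ind : Bool → ℕ
ind true  = 1
ind false = 0

# : ∀ {n} → (Fin n → Bool) → ℕ
# {zero}  p = 0
# {suc n} p = ind (p zero) + # (p ∘ suc)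

-- Curried, so that predicates can be written with named arguments and still be tested on all 2^r
-- argument vectors.
Pred : ℕ → Set
Pred zero    = Bool
Pred (suc r) = Bool → Pred r

_at_ : ∀ {r} → Pred r → Vec Bool r → Bool
p at []      = p
p at (b ∷ v) = p b at v

-- The one-element case is separate so that the inequalities obtained from `count-≤` carry no
-- trailing `+ 0`.
total : ∀ {r n} → List (Pred r) → (Fin n → Vec Bool r) → ℕ
total []           x = 0
total (p ∷ [])     x = # (λ i → p at x i)
total (p ∷ q ∷ ps) x = # (λ i → p at x i) + total (q ∷ ps) x

indsum : ∀ {r} → List (Pred r) → Vec Bool r → ℕ
indsum []           v = 0
indsum (p ∷ [])     v = ind (p at v)
indsum (p ∷ q ∷ ps) v = ind (p at v) + indsum (q ∷ ps) v

_⇒ᵇ_ : Bool → Bool → Bool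
true  ⇒ᵇ b = b
false ⇒ᵇ b = true

⇒ᵇ-elim : ∀ a {b} → T (a ⇒ᵇ b) → T a → T b
⇒ᵇ-elim true p _ = p

forallᵇ : ∀ {r} → (Vec Bool r → Bool) → Bool
forallᵇ {zero}  P = P []
forallᵇ {suc r} P = forallᵇ (λ v → P (true ∷ v)) ∧ forallᵇ (λ v → P (false ∷ v))

forallᵇ-sound : ∀ {r} (P : Vec Bool r → Bool) → T (forallᵇ P) → ∀ v → T (P v)
forallᵇ-sound P p []          = p
forallᵇ-sound P p (true ∷ v)  = forallᵇ-sound _ (proj₁ (T-∧⁻ (forallᵇ (λ v → P (true ∷ v))) p)) v
forallᵇ-sound P p (false ∷ v) = forallᵇ-sound _ (proj₂ (T-∧⁻ (forallᵇ (λ v → P (true ∷ v))) p)) v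

total-zero : ∀ {r} ps (x : Fin 0 → Vec Bool r) → total ps x ≡ 0
total-zero []           x = refl
total-zero (p ∷ [])     x = refl
total-zero (p ∷ q ∷ ps) x = total-zero (q ∷ ps) x

total-suc : ∀ {r n} ps (x : Fin (suc n) → Vec Bool r) → total ps x ≡ indsum ps (x zero) + total ps (x ∘ suc)
total-suc []           x = refl
total-suc (p ∷ [])     x = refl
total-suc (p ∷ q ∷ ps) x =
  trans (cong (# (λ i → p at x i) +_) (total-suc (q ∷ ps) x))
        (+-interchange (ind (p at x zero)) (# (λ i → p at x (suc i))) (indsum (q ∷ ps) (x zero)) (total (q ∷ ps) (x ∘ suc)))

-- `C` collects the relations known to hold at every point; the truth table is checked only where
-- `C` holds.
Dominates : ∀ {r} → Pred r → List (Pred r) → List (Pred r) → Bool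
Dominates C ps qs = forallᵇ (λ v → (C at v) ⇒ᵇ (indsum ps v ≤ᵇ indsum qs v))

-- An inequality between sums of cardinalities holds if it holds pointwise.
abstract
  count-≤ : ∀ {r} (C : Pred r) (ps qs : List (Pred r)) {_ : T (Dominates C ps qs)} →
            ∀ {n} (x : Fin n → Vec Bool r) → (∀ i → T (C at x i)) → total ps x ≤ total qs x
  count-≤ C ps qs {ok} {zero}  x c = ≤-reflexive (trans (total-zero ps x) (sym (total-zero qs x)))
  count-≤ C ps qs {ok} {suc n} x c = begin
    total ps x                                 ≡⟨ total-suc ps x ⟩
    indsum ps (x zero) + total ps (x ∘ suc)    ≤⟨ +-mono-≤ at-zero (count-≤ C ps qs {ok} (x ∘ suc) (c ∘ suc)) ⟩
    indsum qs (x zero) + total qs (x ∘ suc)    ≡⟨ total-suc qs x ⟨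
    total qs x                                 ∎
    where
    open ≤-Reasoning
    at-zero : indsum ps (x zero) ≤ indsum qs (x zero)
    at-zero = ≤ᵇ⇒≤ _ _ (⇒ᵇ-elim (C at x zero) (forallᵇ-sound _ ok (x zero)) (c zero))

abstract
  count-≡ : ∀ {r} (C : Pred r) (ps qs : List (Pred r)) {_ : T (Dominates C ps qs)} {_ : T (Dominates C qs ps)} →
            ∀ {n} (x : Fin n → Vec Bool r) → (∀ i → T (C at x i)) → total ps x ≡ total qs x
  count-≡ C ps qs {ok} {ok′} x c = ≤-antisym (count-≤ C ps qs {ok} x c) (count-≤ C qs ps {ok′} x c)

x₀ : ∀ {n} → Linear (1 + n)
x₀ = var zero

shift : ∀ {n} → Linear n → Linear (suc n)
shift (var i) = var (suc i)
shift (con c) = con c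
shift (a ⊕ b) = shift a ⊕ shift b
shift (a ⊗ c) = shift a ⊗ c

x₁ : ∀ {n} → Linear (2 + n)
x₁ = shift x₀
x₂ : ∀ {n} → Linear (3 + n)
x₂ = shift x₁
x₃ : ∀ {n} → Linear (4 + n)
x₃ = shift x₂
x₄ : ∀ {n} → Linear (5 + n)
x₄ = shift x₃
x₅ : ∀ {n} → Linear (6 + n)
x₅ = shift x₄
x₆ : ∀ {n} → Linear (7 + n)
x₆ = shift x₅
x₇ : ∀ {n} → Linear (8 + n)
x₇ = shift x₆
x₈ : ∀ {n} → Linear (9 + n)
x₈ = shift x₇
x₉ : ∀ {n} → Linear (10 + n)
x₉ = shift x₈
x₁₀ : ∀ {n} → Linear (11 + n)
x₁₀ = shift x₉
x₁₁ : ∀ {n} → Linear (12 + n)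
x₁₁ = shift x₁₀

-- Sets as Boolean functions

infix  4 _⊑_
infixl 7 _∧ˢ_ _∖_
infixl 6 _∨ˢ_

VSet : ℕ → Set
VSet n = Fin n → Bool

_∧ˢ_ _∨ˢ_ _∖_ : ∀ {n} → VSet n → VSet n → VSet n
(A ∧ˢ B) v = A v ∧ B v
(A ∨ˢ B) v = A v ∨ B v
(A ∖ B) v = A v ∧ not (B v)

∁ : ∀ {n} → VSet n → VSet n
∁ A v = not (A v)

∅ full : ∀ {n} → VSet n
∅ _ = false
full _ = true

_⊑_ : ∀ {n} → VSet n → VSet n → Set
A ⊑ B = ∀ v → T (A v ⇒ᵇ B v)

Disj : ∀ {n} → VSet n → VSet n → Set
Disj A B = ∀ v → T (not (A v ∧ B v))

T-∧⁺ : ∀ a b → T a → T b → T (a ∧ b)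
T-∧⁺ true true _ _ = tt

infixr 3 _&_
_&_ : ∀ {a b} → T a → T b → T (a ∧ b)
_&_ {a} {b} = T-∧⁺ a b

abstract
  tautology : ∀ {r} (P : Pred r) {_ : T (forallᵇ (λ v → P at v))} → ∀ v → T (P at v)
  tautology P {ok} = forallᵇ-sound _ ok

  entails : ∀ {r} (C P : Pred r) {_ : T (forallᵇ (λ v → (C at v) ⇒ᵇ (P at v)))} → ∀ v → T (C at v) → T (P at v)
  entails C P {ok} v c = ⇒ᵇ-elim (C at v) (forallᵇ-sound _ ok v) c

trivial : ∀ {r} → Pred r
trivial {zero}  = true
trivial {suc r} = λ _ → trivial

⊑-refl : ∀ {n} (A : VSet n) → A ⊑ A
⊑-refl A v = tautology {r = 1} (λ a → a ⇒ᵇ a) (A v ∷ [])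

⊑-full : ∀ {n} (A : VSet n) → A ⊑ full
⊑-full A v = tautology {r = 1} (λ a → a ⇒ᵇ true) (A v ∷ [])

⊑-∨ : ∀ {n} (A B : VSet n) → A ⊑ A ∨ˢ B
⊑-∨ A B v = tautology {r = 2} (λ a b → a ⇒ᵇ (a ∨ b)) (A v ∷ B v ∷ [])

∧-⊑ˡ : ∀ {n} (A B : VSet n) → A ∧ˢ B ⊑ A
∧-⊑ˡ A B v = tautology {r = 2} (λ a b → (a ∧ b) ⇒ᵇ a) (A v ∷ B v ∷ [])

∧-⊑ʳ : ∀ {n} (A B : VSet n) → A ∧ˢ B ⊑ B
∧-⊑ʳ A B v = tautology {r = 2} (λ a b → (a ∧ b) ⇒ᵇ b) (A v ∷ B v ∷ [])

∖-⊑ : ∀ {n} (A B : VSet n) → A ∖ B ⊑ A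
∖-⊑ A B v = tautology {r = 2} (λ a b → (a ∧ not b) ⇒ᵇ a) (A v ∷ B v ∷ [])

∨-introˡ : ∀ a b → T a → T (a ∨ b)
∨-introˡ true b _ = tt

∨-introʳ : ∀ a b → T b → T (a ∨ b)
∨-introʳ true  b _ = tt
∨-introʳ false b p = p

contradictory : ∀ b → T b → T (not b) → ⊥
contradictory true _ ()

¬T⇒T-not : ∀ b → ¬ T b → T (not b)
¬T⇒T-not true  k = k tt
¬T⇒T-not false k = tt

-- Extremal choices are only made up to double negation, which is removed at the end because
-- the existence of a chain is decidable.
argmin : ∀ {A : Set} (P : A → Set) (μ : A → ℕ) → (∀ a → P a → (∀ b → P b → μ a ≤ μ b) → ⊥) → ∀ a → P a → ⊥
argmin P μ k a p = go (suc (μ a)) a p ≤-refl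
  where
  go : ∀ N a → P a → μ a < N → ⊥
  go (suc N) a p (s≤s le) = k a p λ b q → decidable-stable (μ a ≤? μ b) λ neg →
    go N b q (≤-trans (≰⇒> neg) le)

argmax : ∀ {A : Set} (P : A → Set) (μ : A → ℕ) N → (∀ a → P a → μ a ≤ N) →
         (∀ a → P a → (∀ b → P b → μ b ≤ μ a) → ⊥) → ∀ a → P a → ⊥
argmax P μ N bound k = argmin P (λ a → N ∸ μ a) λ a p min →
  k a p λ b q → ∸-cancelʳ-≤ (bound b q) (min b q)

single : ∀ {n} → Fin n → VSet n
single i j = does (i ≟ᶠ j)

#-false : ∀ n → # {n} (λ _ → false) ≡ 0
#-false zero    = refl
#-false (suc n) = #-false n

#-single : ∀ {n} (i : Fin n) (p : VSet n) → # (λ j → single i j ∧ p j) ≡ ind (p i)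
#-single {suc n} zero    p = trans (cong (ind (p zero) +_) (#-false n)) (+-identityʳ _)
#-single (suc i) p = #-single i (p ∘ suc)

T⇒≡ : ∀ {b} → T b → b ≡ true
T⇒≡ {true} _ = refl

single-refl : ∀ {n} (i : Fin n) → T (single i i)
single-refl i = subst T (sym (dec-true (i ≟ᶠ i) refl)) tt

single⇒≡ : ∀ {n} (i j : Fin n) → T (single i j) → i ≡ j
single⇒≡ i j p with i ≟ᶠ j
... | yes eq = eq

#≤n : ∀ {n} (p : VSet n) → # p ≤ n
#≤n {zero}  p = z≤n
#≤n {suc n} p with p zero
... | true  = s≤s (#≤n (p ∘ suc))
... | false = m≤n⇒m≤1+n (#≤n (p ∘ suc))

#-∧-full : ∀ {n} (A : VSet n) → # (A ∧ˢ full) ≡ # A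
#-∧-full A = count-≡ {r = 1} trivial ((λ a → a ∧ true) ∷ []) ((λ a → a) ∷ []) (λ v → A v ∷ []) (λ _ → tt)

#-single≡1 : ∀ {n} (i : Fin n) → # (single i) ≡ 1
#-single≡1 i = trans (sym (#-∧-full (single i))) (#-single i full)

#-strict : ∀ {n} {A B : VSet n} → A ⊑ B → ∀ v → T (B v ∧ not (A v)) → # A < # B
#-strict {A = A} {B} h v q = begin
  1 + # A                                      ≡⟨ cong (_+ # A) (#-single≡1 v) ⟨
  # (single v) + # A                           ≤⟨ count-≤ {r = 3} (λ σ a b → (σ ⇒ᵇ (b ∧ not a)) ∧ (a ⇒ᵇ b))
                                                   ((λ σ a b → σ) ∷ (λ σ a b → a) ∷ [])
                                                   ((λ σ a b → b) ∷ []) (λ w → single v w ∷ A w ∷ B w ∷ [])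
                                                   (λ w → at w & h w) ⟩
  # B                                          ∎
  where
  open ≤-Reasoning
  at : ∀ w → T (single v w ⇒ᵇ (B w ∧ not (A w)))
  at w with v ≟ᶠ w
  ... | yes refl = q
  ... | no _     = tt

anyᵇ : ∀ {n} → VSet n → Bool
anyᵇ {zero}  p = false
anyᵇ {suc n} p = p zero ∨ anyᵇ (p ∘ suc)

anyᵇ⁺ : ∀ {n} (p : VSet n) i → T (p i) → T (anyᵇ p)
anyᵇ⁺ p zero    h with p zero
... | true = tt
anyᵇ⁺ p (suc i) h with p zero
... | true  = tt
... | false = anyᵇ⁺ (p ∘ suc) i h

anyᵇ⁻ : ∀ {n} (p : VSet n) → T (anyᵇ p) → ∃ λ i → T (p i)
anyᵇ⁻ {suc n} p h with p zero in eq
... | true  = zero , subst T (sym eq) tt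
... | false with anyᵇ⁻ (p ∘ suc) h
...   | i , q = suc i , q

#-∨ : ∀ {n} (A B : VSet n) → # (A ∨ˢ B) ≤ # A + # B
#-∨ A B = count-≤ {r = 2} trivial ((λ a b → a ∨ b) ∷ [])
  ((λ a b → a) ∷ (λ a b → b) ∷ []) (λ i → A i ∷ B i ∷ []) (λ _ → tt)

#-any : ∀ {n m} (p : VSet n) (r : Fin n → VSet m) k → (∀ i → # (r i) ≤ k) →
        # (λ j → anyᵇ (λ i → p i ∧ r i j)) ≤ # p * k
#-any {zero}  {m} p r k h = ≤-reflexive (#-false m)
#-any {suc n} {m} p r k h = begin
  # (λ j → (p zero ∧ r zero j) ∨ anyᵇ (λ i → p (suc i) ∧ r (suc i) j))
    ≤⟨ #-∨ (λ j → p zero ∧ r zero j) (λ j → anyᵇ (λ i → p (suc i) ∧ r (suc i) j)) ⟩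
  # (λ j → p zero ∧ r zero j) + # (λ j → anyᵇ (λ i → p (suc i) ∧ r (suc i) j))
    ≤⟨ +-mono-≤ (first (p zero)) (#-any (p ∘ suc) (r ∘ suc) k (h ∘ suc)) ⟩
  ind (p zero) * k + # (p ∘ suc) * k
    ≡⟨ *-distribʳ-+ k (ind (p zero)) (# (p ∘ suc)) ⟨
  # p * k ∎
  where
  open ≤-Reasoning
  first : ∀ b → # (λ j → b ∧ r zero j) ≤ ind b * k
  first true  = ≤-trans (h zero) (≤-reflexive (sym (+-identityʳ k)))
  first false = ≤-reflexive (#-false m)

take : ∀ {n} (p : VSet n) k → k ≤ # p → ∃ λ q → q ⊑ p × # q ≡ k
take {n} p zero h = ∅ , (λ _ → tt) , #-false n
take {suc n} p (suc k) h with p zero in eq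
... | true with take (p ∘ suc) k (s≤s⁻¹ h)
...   | q , q⊑p , c = q′ , q′⊑p , cong suc c
  where
  q′ : VSet (suc n)
  q′ zero    = true
  q′ (suc i) = q i
  q′⊑p : q′ ⊑ p
  q′⊑p zero    = subst T (sym eq) tt
  q′⊑p (suc i) = q⊑p i
take {suc n} p (suc k) h | false with take (p ∘ suc) (suc k) h
...   | q , q⊑p , c = q′ , q′⊑p , c
  where
  q′ : VSet (suc n)
  q′ zero    = false
  q′ (suc i) = q i
  q′⊑p : q′ ⊑ p
  q′⊑p zero    = tt
  q′⊑p (suc i) = q⊑p i

-- Cuts

-- The arguments are membership of an edge in `F` and of its two ends in each of two sets. With edge
-- counts expressed through such profiles, the cut inequalities below reduce to truth tables.
link : Bool → Bool → Bool → Bool → Bool → Bool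
link f as ad bs bd = f ∧ (as ∧ bd ∨ ad ∧ bs)

leaves : Bool → Bool → Bool → Bool
leaves f as ad = f ∧ (as xor ad)

count-mono : ∀ {n} {A B : VSet n} → A ⊑ B → # A ≤ # B
count-mono {A = A} {B} = count-≤ {r = 2} (λ a b → a ⇒ᵇ b)
  ((λ a b → a) ∷ []) ((λ a b → b) ∷ []) (λ v → A v ∷ B v ∷ [])

module Cuts {n m : ℕ} (s d : Fin m → Fin n) (F : Fin m → Bool) where

  cut : VSet n → VSet n → ℕ
  cut A B = # λ e → link (F e) (A (s e)) (A (d e)) (B (s e)) (B (d e))

  ∂ : VSet n → ℕ
  ∂ A = # λ e → leaves (F e) (A (s e)) (A (d e))

  ∂-∅ : ∂ ∅ ≤ 0
  ∂-∅ = count-≤ {r = 1} trivial ((λ f → leaves f false false) ∷ []) [] (λ e → F e ∷ []) (λ _ → tt)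

  module One (A : VSet n) where
    prof : Fin m → Vec Bool 3
    prof e = F e ∷ A (s e) ∷ A (d e) ∷ []

    cut-∅ : cut A ∅ ≤ 0
    cut-∅ = count-≤ {r = 3} trivial
      ((λ f as ad → link f as ad false false) ∷ []) [] prof (λ _ → tt)

  module Two (A B : VSet n) where
    prof : Fin m → Vec Bool 5
    prof e = F e ∷ A (s e) ∷ A (d e) ∷ B (s e) ∷ B (d e) ∷ []

    cut-sym : cut A B ≡ cut B A
    cut-sym = count-≡ trivial
      ((λ f as ad bs bd → link f as ad bs bd) ∷ [])
      ((λ f as ad bs bd → link f bs bd as ad) ∷ []) prof (λ _ → tt)

    -- An edge between the two pieces lies in both of their boundaries but not in that of the whole.
    ∂-split : ∂ (A ∧ˢ B) + ∂ (A ∖ B) ≡ ∂ A + (cut (A ∧ˢ B) (A ∖ B) + cut (A ∧ˢ B) (A ∖ B))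
    ∂-split = count-≡ trivial
      ((λ f as ad bs bd → leaves f (as ∧ bs) (ad ∧ bd))
        ∷ (λ f as ad bs bd → leaves f (as ∧ not bs) (ad ∧ not bd)) ∷ [])
      ((λ f as ad bs bd → leaves f as ad)
        ∷ (λ f as ad bs bd → link f (as ∧ bs) (ad ∧ bd) (as ∧ not bs) (ad ∧ not bd))
        ∷ (λ f as ad bs bd → link f (as ∧ bs) (ad ∧ bd) (as ∧ not bs) (ad ∧ not bd)) ∷ [])
      prof (λ _ → tt)

    ∂-union : Disj A B → ∂ (A ∨ˢ B) + (cut A B + cut A B) ≡ ∂ A + ∂ B
    ∂-union dj = count-≡ (λ f as ad bs bd → not (as ∧ bs) ∧ not (ad ∧ bd))
      ((λ f as ad bs bd → leaves f (as ∨ bs) (ad ∨ bd))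
        ∷ (λ f as ad bs bd → link f as ad bs bd)
        ∷ (λ f as ad bs bd → link f as ad bs bd) ∷ [])
      ((λ f as ad bs bd → leaves f as ad)
        ∷ (λ f as ad bs bd → leaves f bs bd) ∷ [])
      prof (λ e → dj (s e) & dj (d e))

    cut-union-split : cut ((A ∨ˢ B) ∧ˢ A) ((A ∨ˢ B) ∖ A) ≤ cut A B
    cut-union-split = count-≤ trivial
      ((λ f as ad bs bd → link f ((as ∨ bs) ∧ as) ((ad ∨ bd) ∧ ad) ((as ∨ bs) ∧ not as) ((ad ∨ bd) ∧ not ad)) ∷ [])
      ((λ f as ad bs bd → link f as ad bs bd) ∷ []) prof (λ _ → tt)

    submodular : ∂ (A ∨ˢ B) + ∂ (A ∧ˢ B) ≤ ∂ A + ∂ B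
    submodular = count-≤ trivial
      ((λ f as ad bs bd → leaves f (as ∨ bs) (ad ∨ bd))
        ∷ (λ f as ad bs bd → leaves f (as ∧ bs) (ad ∧ bd)) ∷ [])
      ((λ f as ad bs bd → leaves f as ad)
        ∷ (λ f as ad bs bd → leaves f bs bd) ∷ [])
      prof (λ _ → tt)

    cut≤∂ : cut A (B ∖ A) ≤ ∂ A
    cut≤∂ = count-≤ trivial
      ((λ f as ad bs bd → link f as ad (bs ∧ not as) (bd ∧ not ad)) ∷ [])
      ((λ f as ad bs bd → leaves f as ad) ∷ []) prof (λ _ → tt)

  module Three (A B C : VSet n) where
    prof : Fin m → Vec Bool 7
    prof e = F e ∷ A (s e) ∷ A (d e) ∷ B (s e) ∷ B (d e) ∷ C (s e) ∷ C (d e) ∷ []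

    cut-∨ : cut A (B ∨ˢ C) ≤ cut A B + cut A C
    cut-∨ = count-≤ trivial
      ((λ f as ad bs bd cs cd → link f as ad (bs ∨ cs) (bd ∨ cd)) ∷ [])
      ((λ f as ad bs bd cs cd → link f as ad bs bd)
        ∷ (λ f as ad bs bd cs cd → link f as ad cs cd) ∷ []) prof (λ _ → tt)

    cut-mono : B ⊑ C → cut A B ≤ cut A C
    cut-mono h = count-≤ (λ f as ad bs bd cs cd → (bs ⇒ᵇ cs) ∧ (bd ⇒ᵇ cd))
      ((λ f as ad bs bd cs cd → link f as ad bs bd) ∷ [])
      ((λ f as ad bs bd cs cd → link f as ad cs cd) ∷ []) prof (λ e → h (s e) & h (d e))

    cut-∨-disjoint : Disj A B → Disj A C → Disj B C → cut A B + cut A C ≤ cut A (B ∨ˢ C)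
    cut-∨-disjoint h₁ h₂ h₃ = count-≤
      (λ f as ad bs bd cs cd → (not (as ∧ bs) ∧ not (as ∧ cs) ∧ not (bs ∧ cs)) ∧ not (ad ∧ bd) ∧ not (ad ∧ cd) ∧ not (bd ∧ cd))
      ((λ f as ad bs bd cs cd → link f as ad bs bd)
        ∷ (λ f as ad bs bd cs cd → link f as ad cs cd) ∷ [])
      ((λ f as ad bs bd cs cd → link f as ad (bs ∨ cs) (bd ∨ cd)) ∷ [])
      prof (λ e → (h₁ (s e) & h₂ (s e) & h₃ (s e)) & h₁ (d e) & h₂ (d e) & h₃ (d e))

    cut-split-mono : B ⊑ A → cut (B ∧ˢ C) (B ∖ C) ≤ cut (A ∧ˢ C) (A ∖ C)
    cut-split-mono h = count-≤ (λ f as ad bs bd cs cd → (bs ⇒ᵇ as) ∧ (bd ⇒ᵇ ad))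
      ((λ f as ad bs bd cs cd → link f (bs ∧ cs) (bd ∧ cd) (bs ∧ not cs) (bd ∧ not cd)) ∷ [])
      ((λ f as ad bs bd cs cd → link f (as ∧ cs) (ad ∧ cd) (as ∧ not cs) (ad ∧ not cd)) ∷ [])
      prof (λ e → h (s e) & h (d e))

    cut-split-disjoint : Disj A B → cut (A ∧ˢ C) B + cut (A ∖ C) B ≤ cut A B
    cut-split-disjoint h = count-≤
      (λ f as ad bs bd cs cd → not (as ∧ bs) ∧ not (ad ∧ bd))
      ((λ f as ad bs bd cs cd → link f (as ∧ cs) (ad ∧ cd) bs bd)
        ∷ (λ f as ad bs bd cs cd → link f (as ∧ not cs) (ad ∧ not cd) bs bd) ∷ [])
      ((λ f as ad bs bd cs cd → link f as ad bs bd) ∷ [])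
      prof (λ e → h (s e) & h (d e))

module Weight {n : ℕ} (W : VSet n) where

  wt : VSet n → ℕ
  wt A = # λ v → W v ∧ A v

  wt-∅ : wt ∅ ≤ 0
  wt-∅ = count-≤ {r = 1} trivial ((λ w → w ∧ false) ∷ []) [] (λ v → W v ∷ []) (λ _ → tt)

  wt-mono : ∀ {A B} → A ⊑ B → wt A ≤ wt B
  wt-mono {A} {B} h = count-≤ {r = 3} (λ w a b → a ⇒ᵇ b)
    ((λ w a b → w ∧ a) ∷ []) ((λ w a b → w ∧ b) ∷ []) (λ v → W v ∷ A v ∷ B v ∷ []) h

  wt-split : ∀ A B → wt (A ∧ˢ B) + wt (A ∖ B) ≡ wt A
  wt-split A B = count-≡ {r = 3} trivial
    ((λ w a b → w ∧ (a ∧ b)) ∷ (λ w a b → w ∧ (a ∧ not b)) ∷ [])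
    ((λ w a b → w ∧ a) ∷ []) (λ v → W v ∷ A v ∷ B v ∷ []) (λ _ → tt)

  wt-union : ∀ A B → Disj A B → wt (A ∨ˢ B) ≡ wt A + wt B
  wt-union A B h = count-≡ {r = 3} (λ w a b → not (a ∧ b))
    ((λ w a b → w ∧ (a ∨ b)) ∷ [])
    ((λ w a b → w ∧ a) ∷ (λ w a b → w ∧ b) ∷ []) (λ v → W v ∷ A v ∷ B v ∷ []) h

  wt-∨ : ∀ A B → wt (A ∨ˢ B) ≡ wt A + wt (B ∖ A)
  wt-∨ A B = count-≡ {r = 3} trivial
    ((λ w a b → w ∧ (a ∨ b)) ∷ [])
    ((λ w a b → w ∧ a) ∷ (λ w a b → w ∧ (b ∧ not a)) ∷ []) (λ v → W v ∷ A v ∷ B v ∷ []) (λ _ → tt)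

  wt-∁ : ∀ A → wt A + wt (∁ A) ≡ wt full
  wt-∁ A = wt-split full A

  wt-modular : ∀ A B → wt (A ∨ˢ B) + wt (A ∧ˢ B) ≡ wt A + wt B
  wt-modular A B = count-≡ {r = 3} trivial
    ((λ w a b → w ∧ (a ∨ b)) ∷ (λ w a b → w ∧ (a ∧ b)) ∷ [])
    ((λ w a b → w ∧ a) ∷ (λ w a b → w ∧ b) ∷ []) (λ v → W v ∷ A v ∷ B v ∷ []) (λ _ → tt)

-- Splittings into parts with few terminals

module Splitting {n m : ℕ} (s d : Fin m → Fin n) (F : Fin m → Bool) (T₁ : VSet n) (κ : ℕ) where
  open Cuts s d F public
  open Weight T₁ public renaming (wt to t; wt-∅ to t-∅; wt-mono to t-mono; wt-split to t-split; wt-union to t-union; wt-∨ to t-∨; wt-∁ to t-∁)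

  -- A can be cut into parts with at most 12κ terminals each by removing at most c edges.
  data Split (A : VSet n) (c : ℕ) : Set where
    leaf : t A ≤ κ * 12 → Split A c
    node : ∀ S {c₁ c₂} → Split (A ∧ˢ S) c₁ → Split (A ∖ S) c₂ →
           c₁ + c₂ + cut (A ∧ˢ S) (A ∖ S) ≤ c → Split A c

  -- The same dividing sets are used again; restriction to a subset only lowers the cuts and the
  -- terminal counts.
  Split-mono : ∀ {A B c} → B ⊑ A → Split A c → Split B c
  Split-mono B⊑A (leaf p) = leaf (≤-trans (t-mono B⊑A) p)
  Split-mono {A} {B} B⊑A (node S p q r) =
    node S (Split-mono (λ v → entails {r = 3} (λ a b σ → b ⇒ᵇ a)
                                (λ a b σ → (b ∧ σ) ⇒ᵇ (a ∧ σ)) (A v ∷ B v ∷ S v ∷ []) (B⊑A v)) p)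
           (Split-mono (λ v → entails {r = 3} (λ a b σ → b ⇒ᵇ a)
                                (λ a b σ → (b ∧ not σ) ⇒ᵇ (a ∧ not σ)) (A v ∷ B v ∷ S v ∷ []) (B⊑A v)) q)
           (≤-trans (+-monoʳ-≤ _ (Three.cut-split-mono A B S B⊑A)) r)

  Split-union : ∀ {A B a b} → Split A a → Split B b → Split (A ∨ˢ B) (a + b + cut A B)
  Split-union {A} {B} {a} {b} p q =
    node A (Split-mono (λ v → tautology {r = 2} (λ a b → ((a ∨ b) ∧ a) ⇒ᵇ a) (A v ∷ B v ∷ [])) p)
           (Split-mono (λ v → tautology {r = 2} (λ a b → ((a ∨ b) ∧ not a) ⇒ᵇ b) (A v ∷ B v ∷ [])) q)
           (+-monoʳ-≤ (a + b) (Two.cut-union-split A B))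

  Split-weaken : ∀ {A c c′} → c ≤ c′ → Split A c → Split A c′
  Split-weaken c≤ (leaf p)       = leaf p
  Split-weaken c≤ (node S p q r) = node S p q (≤-trans r c≤)

  module Bounded (t≤∂ : ∀ A → t A ≤ κ * 12 → t A ≤ ∂ A) where

    -- Each part satisfies t ≤ ∂, and every removed edge adds two to the sum of the boundaries of
    -- the parts.
    t≤∂+2c : ∀ {A c} → Split A c → t A ≤ ∂ A + c * 2
    t≤∂+2c {A} {c} (leaf p) = m≤n⇒m≤n+o (c * 2) (t≤∂ A p)
    t≤∂+2c {A} {c} (node S {c₁} {c₂} p q r) =
      linear 0 (t A ∷ t (A ∧ˢ S) ∷ t (A ∖ S) ∷ ∂ A ∷ ∂ (A ∧ˢ S) ∷ ∂ (A ∖ S) ∷ c ∷ c₁ ∷ c₂ ∷ e ∷ [])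
        ((1 , x₁ ≼ x₄ ⊕ x₇ ⊗ 2) ∷ (1 , x₂ ≼ x₅ ⊕ x₈ ⊗ 2) ∷ (1 , x₀ ≼ x₁ ⊕ x₂)
          ∷ (1 , x₄ ⊕ x₅ ≼ x₃ ⊕ (x₉ ⊕ x₉)) ∷ (2 , x₇ ⊕ x₈ ⊕ x₉ ≼ x₆) ∷ [])
        (x₀ ≼ x₃ ⊕ x₆ ⊗ 2)
        (t≤∂+2c p , t≤∂+2c q , ≤-reflexive (sym (t-split A S)) , ≤-reflexive (Two.∂-split A S) , r , tt)
      where
      e = cut (A ∧ˢ S) (A ∖ S)

    -- Only a lower bound on splitting costs; where it has to be attained, a `Split A e` is passed
    -- alongside.
    Opt : VSet n → ℕ → Set
    Opt A e = ∀ c → Split A c → e ≤ c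

    -- The second condition is 43 times t + ∂ + 2(∂/43) ≤ 512κ, the budget of `optimum-bound` for a
    -- splitting of cost ∂/43.
    Cheap : Set
    Cheap = ∀ A → t A * 2 ≤ κ * 512 → ∂ A * 45 + t A * 43 ≤ κ * 22016 →
            ¬ (∀ c → Split A c → ¬ (c * 43 ≤ ∂ A))

    module _ (cheap : Cheap) where

      -- The conclusion is 43e ≤ ∂ with 2e added on both sides, since ∂ + 2e is the quantity that
      -- adds up over bins. If it failed, ∂ < 43e would put `A` under the conditions of `Cheap`, and
      -- a splitting of cost at most ∂/43 would beat the optimum.
      optimum-bound : ∀ A e → Split A e → Opt A e → t A + (∂ A + e * 2) ≤ κ * 512 → e * 45 ≤ ∂ A + e * 2
      optimum-bound A e p opt h = decidable-stable (e * 45 ≤? ∂ A + e * 2) λ neg →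
        let gt : 1 + (∂ A + e * 2) ≤ e * 45
            gt = ≰⇒> neg
            ρ = t A ∷ ∂ A ∷ e ∷ κ ∷ []
        in cheap A
          (linear 0 ρ ((1 , x₀ ≼ x₁ ⊕ x₂ ⊗ 2) ∷ (1 , x₀ ⊕ (x₁ ⊕ x₂ ⊗ 2) ≼ x₃ ⊗ 512) ∷ []) (x₀ ⊗ 2 ≼ x₃ ⊗ 512)
            (t≤∂+2c p , h , tt))
          (linear 0 ρ ((2 , con 1 ⊕ (x₁ ⊕ x₂ ⊗ 2) ≼ x₂ ⊗ 45) ∷ (43 , x₀ ⊕ (x₁ ⊕ x₂ ⊗ 2) ≼ x₃ ⊗ 512) ∷ [])
            (x₁ ⊗ 45 ⊕ x₀ ⊗ 43 ≼ x₃ ⊗ 22016) (gt , h , tt))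
          λ c q le → neg (linear 0 (∂ A ∷ e ∷ c ∷ []) ((43 , x₁ ≼ x₂) ∷ (1 , x₂ ⊗ 43 ≼ x₀) ∷ [])
            (x₁ ⊗ 45 ≼ x₀ ⊕ x₁ ⊗ 2) (opt c q , le , tt))

      -- Packing parts into bins

      Bin : Set
      Bin = Σ (VSet n) λ U → Σ ℕ λ c → Split U c

      ⋃ : List Bin → VSet n
      ⋃ []                 = ∅
      ⋃ ((U , _) ∷ bs)     = U ∨ˢ ⋃ bs

      -- `φ` bounds the sum of the boundaries of the parts in a bin; `ω` adds the terminals and is
      -- the weight that the packing limits.
      φ ω : Bin → ℕ
      φ (U , c , _) = ∂ U + c * 2
      ω (U , c , _) = t U + (∂ U + c * 2)

      parts crossing Φ : List Bin → ℕ
      parts []                     = 0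
      parts ((U , c , _) ∷ bs)     = c + parts bs
      crossing []                  = 0
      crossing ((U , _) ∷ bs)      = cut U (⋃ bs) + crossing bs
      Φ []                         = 0
      Φ (b ∷ bs)                   = φ b + Φ bs

      cost : List Bin → ℕ
      cost bs = parts bs + crossing bs

      Separated : List Bin → Set
      Separated []             = ⊤
      Separated ((U , _) ∷ bs) = Disj U (⋃ bs) × Separated bs

      Small : Bin → Set
      Small b = ω b ≤ κ * 256

      AllSmall : List Bin → Set
      AllSmall []       = ⊤
      AllSmall (b ∷ bs) = Small b × AllSmall bs

      -- An edge between two bins is counted in both boundaries, exactly as an edge removed inside a
      -- bin is counted twice.
      Φ≡ : ∀ bs → Separated bs → Φ bs ≡ ∂ (⋃ bs) + cost bs * 2
      Φ≡ [] _ = sym (trans (+-identityʳ _) (≤-antisym ∂-∅ z≤n))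
      Φ≡ ((U , c , _) ∷ bs) (dj , sep) = ≤-antisym
        (linear 0 ρ ((1 , x₀ ≼ x₁ ⊕ (x₂ ⊕ x₃) ⊗ 2) ∷ (1 , x₄ ⊕ x₁ ≼ x₅ ⊕ (x₆ ⊕ x₆)) ∷ [])
          (x₄ ⊕ x₇ ⊗ 2 ⊕ x₀ ≼ x₅ ⊕ (x₇ ⊕ x₂ ⊕ (x₆ ⊕ x₃)) ⊗ 2)
          (≤-reflexive (Φ≡ bs sep) , ≤-reflexive (sym (Two.∂-union U (⋃ bs) dj)) , tt))
        (linear 0 ρ ((1 , x₁ ⊕ (x₂ ⊕ x₃) ⊗ 2 ≼ x₀) ∷ (1 , x₅ ⊕ (x₆ ⊕ x₆) ≼ x₄ ⊕ x₁) ∷ [])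
          (x₅ ⊕ (x₇ ⊕ x₂ ⊕ (x₆ ⊕ x₃)) ⊗ 2 ≼ x₄ ⊕ x₇ ⊗ 2 ⊕ x₀)
          (≤-reflexive (sym (Φ≡ bs sep)) , ≤-reflexive (Two.∂-union U (⋃ bs) dj) , tt))
        where
        ρ = Φ bs ∷ ∂ (⋃ bs) ∷ parts bs ∷ crossing bs ∷ ∂ U ∷ ∂ (U ∨ˢ ⋃ bs) ∷ cut U (⋃ bs) ∷ c ∷ []

      Split-⋃ : ∀ bs → Split (⋃ bs) (cost bs)
      Split-⋃ [] = leaf (≤-trans t-∅ z≤n)
      Split-⋃ ((U , c , p) ∷ bs) = Split-weaken
        (≤-reflexive (lemma c (parts bs) (crossing bs) (cut U (⋃ bs)))) (Split-union p (Split-⋃ bs))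
        where
        lemma : ∀ a b c d → a + (b + c) + d ≡ a + b + (d + c)
        lemma = solve-∀

      -- Sum of `optimum-bound` over the pairs formed by b and an element of bs.
      pairs-with : ∀ b bs → Separated (b ∷ bs) → Small b → AllSmall bs → Opt (⋃ (b ∷ bs)) (cost (b ∷ bs)) →
                   (length bs * proj₁ (proj₂ b) + (parts bs + cut (proj₁ b) (⋃ bs))) * 45 ≤ length bs * φ b + Φ bs
      pairs-with (U , c , p) [] _ _ _ _ = linear 0 (cut U ∅ ∷ []) ((45 , x₀ ≼ con 0) ∷ []) (x₀ ⊗ 45 ≼ con 0) (One.cut-∅ U , tt)
      pairs-with b@(U , c , p) (b′@(W , c′ , p′) ∷ bs) (dj , djW , sep) sb (sb′ , sbs) opt =
        linear 0 (l * c ∷ parts bs ∷ cut U (⋃ bs) ∷ c ∷ c′ ∷ cut U W ∷ cut U (W ∨ˢ ⋃ bs) ∷ l * φ b ∷ Φ bs ∷ φ b ∷ φ b′ ∷ [])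
          ((1 , (x₀ ⊕ (x₁ ⊕ x₂)) ⊗ 45 ≼ x₇ ⊕ x₈) ∷ (1 , (x₃ ⊕ x₄ ⊕ x₅) ⊗ 45 ≼ x₉ ⊕ x₁₀) ∷ (45 , x₆ ≼ x₅ ⊕ x₂) ∷ [])
          ((x₃ ⊕ x₀ ⊕ (x₄ ⊕ x₁ ⊕ x₆)) ⊗ 45 ≼ x₉ ⊕ x₇ ⊕ (x₁₀ ⊕ x₈))
          (pairs-with b bs (djUB , sep) sb sbs opt-rest , pair , Three.cut-∨ U W (⋃ bs) , tt)
        where
        l = length bs
        B = ⋃ bs
        djUW : Disj U W
        djUW v = entails {r = 3} (λ u w x → not (u ∧ (w ∨ x))) (λ u w x → not (u ∧ w)) (U v ∷ W v ∷ B v ∷ []) (dj v)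
        djUB : Disj U B
        djUB v = entails {r = 3} (λ u w x → not (u ∧ (w ∨ x))) (λ u w x → not (u ∧ x)) (U v ∷ W v ∷ B v ∷ []) (dj v)
        cuts : cut U W + cut U B ≤ cut U (W ∨ˢ B)
        cuts = Three.cut-∨-disjoint U W B djUW djUB djW
        -- A cheaper splitting of the two bins, joined with the splittings of the others, would be a
        -- cheaper splitting of the whole.
        opt-pair : Opt (U ∨ˢ W) (c + c′ + cut U W)
        opt-pair e q = linear 0 (c ∷ c′ ∷ cut U W ∷ cut U B ∷ cut U (W ∨ˢ B) ∷ e ∷ cut W B ∷ cut (U ∨ˢ W) B ∷ parts bs ∷ crossing bs ∷ [])
          ((1 , x₂ ⊕ x₃ ≼ x₄) ∷ (1 , (x₀ ⊕ (x₁ ⊕ x₈)) ⊕ (x₄ ⊕ (x₆ ⊕ x₉)) ≼ x₅ ⊕ (x₈ ⊕ x₉) ⊕ x₇) ∷ (1 , x₇ ≼ x₃ ⊕ x₆) ∷ [])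
          (x₀ ⊕ x₁ ⊕ x₂ ≼ x₅)
          (cuts
          , opt _ (Split-mono (λ v → tautology {r = 3} (λ u w x → (u ∨ (w ∨ x)) ⇒ᵇ ((u ∨ w) ∨ x)) (U v ∷ W v ∷ B v ∷ []))
                  (Split-union q (Split-⋃ bs)))
          , ≤-trans (≤-reflexive (Two.cut-sym (U ∨ˢ W) B)) (≤-trans (Three.cut-∨ B U W)
              (≤-reflexive (cong₂ _+_ (Two.cut-sym B U) (Two.cut-sym B W)))) , tt)
        opt-rest : Opt (U ∨ˢ B) (c + parts bs + (cut U B + crossing bs))
        opt-rest e q = linear 0 (c ∷ c′ ∷ cut U W ∷ cut U B ∷ cut U (W ∨ˢ B) ∷ e ∷ cut W B ∷ cut (U ∨ˢ B) W ∷ parts bs ∷ crossing bs ∷ [])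
          ((1 , x₂ ⊕ x₃ ≼ x₄) ∷ (1 , (x₀ ⊕ (x₁ ⊕ x₈)) ⊕ (x₄ ⊕ (x₆ ⊕ x₉)) ≼ x₅ ⊕ x₁ ⊕ x₇) ∷ (1 , x₇ ≼ x₂ ⊕ x₆) ∷ [])
          (x₀ ⊕ x₈ ⊕ (x₃ ⊕ x₉) ≼ x₅)
          (cuts
          , opt _ (Split-mono (λ v → tautology {r = 3} (λ u w x → (u ∨ (w ∨ x)) ⇒ᵇ ((u ∨ x) ∨ w)) (U v ∷ W v ∷ B v ∷ []))
                  (Split-union q p′))
          , ≤-trans (≤-reflexive (Two.cut-sym (U ∨ˢ B) W)) (≤-trans (Three.cut-∨ W U B)
              (≤-reflexive (cong (_+ cut W B) (Two.cut-sym W U)))) , tt)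
        ∂-pair : ∂ (U ∨ˢ W) + (cut U W + cut U W) ≡ ∂ U + ∂ W
        ∂-pair = Two.∂-union U W djUW
        pair : (c + c′ + cut U W) * 45 ≤ φ b + φ b′
        pair = linear 0 ρ
          ((1 , (x₃ ⊕ x₄ ⊕ x₅) ⊗ 45 ≼ x₂ ⊕ (x₃ ⊕ x₄ ⊕ x₅) ⊗ 2) ∷ (1 , x₂ ⊕ (x₅ ⊕ x₅) ≼ x₀ ⊕ x₁) ∷ [])
          ((x₃ ⊕ x₄ ⊕ x₅) ⊗ 45 ≼ x₀ ⊕ x₃ ⊗ 2 ⊕ (x₁ ⊕ x₄ ⊗ 2))
          (optimum-bound (U ∨ˢ W) (c + c′ + cut U W) (Split-union p p′) opt-pair
            (linear 0 ρ
              ((1 , x₆ ⊕ (x₀ ⊕ x₃ ⊗ 2) ≼ x₉ ⊗ 256) ∷ (1 , x₇ ⊕ (x₁ ⊕ x₄ ⊗ 2) ≼ x₉ ⊗ 256) ∷ (1 , x₈ ≼ x₆ ⊕ x₇)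
                ∷ (1 , x₂ ⊕ (x₅ ⊕ x₅) ≼ x₀ ⊕ x₁) ∷ [])
              (x₈ ⊕ (x₂ ⊕ (x₃ ⊕ x₄ ⊕ x₅) ⊗ 2) ≼ x₉ ⊗ 512)
              (sb , sb′ , ≤-reflexive (t-union U W djUW) , ≤-reflexive ∂-pair , tt))
          , ≤-reflexive ∂-pair , tt)
          where
          ρ = ∂ U ∷ ∂ W ∷ ∂ (U ∨ˢ W) ∷ c ∷ c′ ∷ cut U W ∷ t U ∷ t W ∷ t (U ∨ˢ W) ∷ κ ∷ []

      -- Every bin lies in `length bs` pairs while an edge between two bins is seen by only one
      -- pair, hence the different factors of `parts` and `crossing`.
      all-pairs : ∀ b bs → Separated (b ∷ bs) → AllSmall (b ∷ bs) → Opt (⋃ (b ∷ bs)) (cost (b ∷ bs)) →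
                  (length bs * parts (b ∷ bs) + crossing (b ∷ bs)) * 45 ≤ length bs * Φ (b ∷ bs)
      all-pairs (U , c , p) [] _ _ _ = linear 0 (cut U ∅ ∷ []) ((45 , x₀ ≼ con 0) ∷ []) ((x₀ ⊕ con 0) ⊗ 45 ≼ con 0) (One.cut-∅ U , tt)
      all-pairs b@(U , c , p) bs@(b′ ∷ bs′) sep@(_ , sep′) (sb , sbs) opt = begin
        (length bs * (c + parts bs) + (cut U (⋃ bs) + crossing bs)) * 45
          ≡⟨ lemma₁ (length bs′) c (parts bs) (cut U (⋃ bs)) (crossing bs) ⟩
        (length bs * c + (parts bs + cut U (⋃ bs))) * 45 + (length bs′ * parts bs + crossing bs) * 45
          ≤⟨ +-mono-≤ (pairs-with b bs sep sb sbs opt) (all-pairs b′ bs′ sep′ sbs opt′) ⟩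
        length bs * φ b + Φ bs + length bs′ * Φ bs
          ≡⟨ lemma₂ (length bs′) (φ b) (Φ bs) ⟩
        length bs * (φ b + Φ bs) ∎
        where
        open ≤-Reasoning
        lemma₁ : ∀ l c p u x → (suc l * (c + p) + (u + x)) * 45 ≡ (suc l * c + (p + u)) * 45 + (l * p + x) * 45
        lemma₁ = solve-∀
        lemma₂ : ∀ l a b → suc l * a + b + l * b ≡ suc l * (a + b)
        lemma₂ = solve-∀
        opt′ : Opt (⋃ bs) (cost bs)
        opt′ e q = linear 0 (c ∷ parts bs ∷ cut U (⋃ bs) ∷ crossing bs ∷ e ∷ [])
          ((1 , (x₀ ⊕ x₁) ⊕ (x₂ ⊕ x₃) ≼ x₀ ⊕ x₄ ⊕ x₂) ∷ []) (x₁ ⊕ x₃ ≼ x₄)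
          (opt _ (Split-union p q) , tt)

      -- The head is the open bin. Since t ≤ ∂ for every part, the total weight is paid for by twice
      -- the boundaries, and each closed bin is charged 232κ of it.
      Packed : List Bin → Set
      Packed []       = ⊥
      Packed (b ∷ bs) = Separated (b ∷ bs) × AllSmall (b ∷ bs) × length bs * (κ * 232) + ω b ≤ Φ (b ∷ bs) * 2

      record Packing (A : VSet n) (c : ℕ) (old : List Bin) : Set where
        field
          bins   : List Bin
          packed : Packed bins
          inside : ⋃ bins ⊑ ⋃ old ∨ˢ A
          covers : ⋃ old ∨ˢ A ⊑ ⋃ bins
          costs  : cost bins ≤ c + cost old + cut A (⋃ old)

      -- Next-fit: a part that does not fit into the current bin opens a new one, so that
      -- every closed bin has weight above 232κ together with the excess of that part.
      pack : ∀ {D} → D ≤ κ * 232 → ∀ {A c} → Split A c → ∂ A + c * 2 ≤ t A + D →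
             ∀ old → Packed old → Disj A (⋃ old) → Packing A c old
      pack D≤ {A} {c} (leaf p) h old@((U , cᵤ , q) ∷ bs) (sep@(djU , sepbs) , (sb , sbs) , inv) dj
        with ω (U , cᵤ , q) + (t A + ∂ A) ≤? κ * 256
      ... | yes fits = record
        { bins = new ∷ bs
        ; packed = (djnew , sepbs) , (≤-trans (≤-reflexive ωnew) fits , sbs)
            , linear 0 (length bs * (κ * 232) ∷ ω (U , cᵤ , q) ∷ φ (U , cᵤ , q) ∷ Φ bs ∷ ω new ∷ φ new ∷ t A ∷ ∂ A ∷ [])
                ((1 , x₀ ⊕ x₁ ≼ (x₂ ⊕ x₃) ⊗ 2) ∷ (1 , x₄ ≼ x₁ ⊕ (x₆ ⊕ x₇)) ∷ (2 , x₂ ⊕ x₇ ≼ x₅) ∷ (1 , x₆ ≼ x₇) ∷ [])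
                (x₀ ⊕ x₄ ≼ (x₅ ⊕ x₃) ⊗ 2)
                (inv , ≤-reflexive ωnew , ≤-reflexive (sym φnew) , t≤∂ A p , tt)
        ; inside = λ v → tautology {r = 3} (λ u x a → ((u ∨ a) ∨ x) ⇒ᵇ ((u ∨ x) ∨ a)) (U v ∷ ⋃ bs v ∷ A v ∷ [])
        ; covers = λ v → tautology {r = 3} (λ u x a → ((u ∨ x) ∨ a) ⇒ᵇ ((u ∨ a) ∨ x)) (U v ∷ ⋃ bs v ∷ A v ∷ [])
        ; costs = linear 0 (cᵤ ∷ cut U A ∷ parts bs ∷ cut (U ∨ˢ A) (⋃ bs) ∷ crossing bs ∷ c ∷ cut U (⋃ bs) ∷ cut A (U ∨ˢ ⋃ bs) ∷ cut A (⋃ bs) ∷ [])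
            ((1 , x₃ ≼ x₆ ⊕ x₈) ∷ (1 , x₁ ⊕ x₈ ≼ x₇) ∷ [])
            (x₀ ⊕ x₁ ⊕ x₂ ⊕ (x₃ ⊕ x₄) ≼ x₅ ⊕ (x₀ ⊕ x₂ ⊕ (x₆ ⊕ x₄)) ⊕ x₇)
            ( ≤-trans (≤-reflexive (Two.cut-sym (U ∨ˢ A) (⋃ bs))) (≤-trans (Three.cut-∨ (⋃ bs) U A)
                (≤-reflexive (cong₂ _+_ (Two.cut-sym (⋃ bs) U) (Two.cut-sym (⋃ bs) A))))
            , ≤-trans (≤-reflexive (cong (_+ cut A (⋃ bs)) (Two.cut-sym U A))) (Three.cut-∨-disjoint A U (⋃ bs) djAU djAB djU) , tt)
        }
        where
        djAU : Disj A U
        djAU v = entails {r = 3} (λ a u x → not (a ∧ (u ∨ x))) (λ a u x → not (a ∧ u)) (A v ∷ U v ∷ ⋃ bs v ∷ []) (dj v)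
        djAB : Disj A (⋃ bs)
        djAB v = entails {r = 3} (λ a u x → not (a ∧ (u ∨ x))) (λ a u x → not (a ∧ x)) (A v ∷ U v ∷ ⋃ bs v ∷ []) (dj v)
        djUA : Disj U A
        djUA v = entails {r = 2} (λ a u → not (a ∧ u)) (λ a u → not (u ∧ a)) (A v ∷ U v ∷ []) (djAU v)
        djnew : Disj (U ∨ˢ A) (⋃ bs)
        djnew v = entails {r = 3} (λ u x a → not (u ∧ x) ∧ not (a ∧ x)) (λ u x a → not ((u ∨ a) ∧ x))
                    (U v ∷ ⋃ bs v ∷ A v ∷ []) (djU v & djAB v)
        new : Bin
        new = U ∨ˢ A , cᵤ + cut U A , Split-weaken (≤-reflexive (cong (_+ cut U A) (+-identityʳ cᵤ))) (Split-union q (leaf {c = 0} p))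
        φnew : φ new ≡ φ (U , cᵤ , q) + ∂ A
        φnew = ≤-antisym
          (linear 0 ρ ((1 , x₀ ⊕ (x₁ ⊕ x₁) ≼ x₂ ⊕ x₃) ∷ []) (x₀ ⊕ (x₄ ⊕ x₁) ⊗ 2 ≼ x₂ ⊕ x₄ ⊗ 2 ⊕ x₃) (≤-reflexive (Two.∂-union U A djUA) , tt))
          (linear 0 ρ ((1 , x₂ ⊕ x₃ ≼ x₀ ⊕ (x₁ ⊕ x₁)) ∷ []) (x₂ ⊕ x₄ ⊗ 2 ⊕ x₃ ≼ x₀ ⊕ (x₄ ⊕ x₁) ⊗ 2) (≤-reflexive (sym (Two.∂-union U A djUA)) , tt))
          where ρ = ∂ (U ∨ˢ A) ∷ cut U A ∷ ∂ U ∷ ∂ A ∷ cᵤ ∷ []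
        ωnew : ω new ≡ ω (U , cᵤ , q) + (t A + ∂ A)
        ωnew = trans (cong₂ _+_ (t-union U A djUA) φnew) (+-interchange (t U) (t A) (φ (U , cᵤ , q)) (∂ A))
      -- Overflow means that the weight of the open bin plus t + ∂ of the part exceeds 256κ. Giving
      -- up 2t ≤ 24κ of this leaves the 232κ charged to the closing bin and keeps t + ∂ for the new
      -- one.
      ... | no full = record
        { bins = new ∷ old
        ; packed = (dj , sep)
            -- A single part fits into an empty bin: t + ∂ ≤ 2t + D ≤ 24κ + 232κ.
            , (linear 0 (t A ∷ ∂ A ∷ c ∷ κ ∷ _ ∷ []) ((2 , x₀ ≼ x₃ ⊗ 12) ∷ (1 , x₁ ⊕ x₂ ⊗ 2 ≼ x₀ ⊕ x₄) ∷ (1 , x₄ ≼ x₃ ⊗ 232) ∷ [])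
                (x₀ ⊕ (x₁ ⊕ con 0) ≼ x₃ ⊗ 256) (p , h , D≤ , tt) , sb , sbs)
            , linear 0 (length bs * (κ * 232) ∷ κ ∷ ω (U , cᵤ , q) ∷ Φ old ∷ t A ∷ ∂ A ∷ [])
                ((1 , x₀ ⊕ x₂ ≼ x₃ ⊗ 2) ∷ (1 , con 1 ⊕ x₁ ⊗ 256 ≼ x₂ ⊕ (x₄ ⊕ x₅)) ∷ (2 , x₄ ≼ x₁ ⊗ 12) ∷ [])
                (x₁ ⊗ 232 ⊕ x₀ ⊕ (x₄ ⊕ (x₅ ⊕ con 0)) ≼ (x₅ ⊕ con 0 ⊕ x₃) ⊗ 2)
                (inv , ≰⇒> full , p , tt)
        ; inside = λ v → tautology {r = 2} (λ x a → (a ∨ x) ⇒ᵇ (x ∨ a)) (⋃ old v ∷ A v ∷ [])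
        ; covers = λ v → tautology {r = 2} (λ x a → (x ∨ a) ⇒ᵇ (a ∨ x)) (⋃ old v ∷ A v ∷ [])
        ; costs = linear 0 (parts old ∷ crossing old ∷ cut A (⋃ old) ∷ c ∷ []) []
            (x₀ ⊕ (x₂ ⊕ x₁) ≼ x₃ ⊕ (x₀ ⊕ x₁) ⊕ x₂) tt
        }
        where
        new : Bin
        new = A , 0 , leaf p
      pack {D} D≤ {A} {c} (node S {c₁} {c₂} p q r) h old packed-old dj = record
        { bins = bins P₂
        ; packed = packed P₂
        ; inside = λ v → entails {r = 5}
            (λ a σ o b₁ b₂ → (b₁ ⇒ᵇ (o ∨ (a ∧ σ))) ∧ (b₂ ⇒ᵇ (b₁ ∨ (a ∧ not σ))))
            (λ a σ o b₁ b₂ → b₂ ⇒ᵇ (o ∨ a))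
            (A v ∷ S v ∷ ⋃ old v ∷ ⋃ (bins P₁) v ∷ ⋃ (bins P₂) v ∷ []) (inside P₁ v & inside P₂ v)
        ; covers = λ v → entails {r = 5}
            (λ a σ o b₁ b₂ → ((o ∨ (a ∧ σ)) ⇒ᵇ b₁) ∧ ((b₁ ∨ (a ∧ not σ)) ⇒ᵇ b₂))
            (λ a σ o b₁ b₂ → (o ∨ a) ⇒ᵇ b₂)
            (A v ∷ S v ∷ ⋃ old v ∷ ⋃ (bins P₁) v ∷ ⋃ (bins P₂) v ∷ []) (covers P₁ v & covers P₂ v)
        ; costs = linear 0 (cost (bins P₂) ∷ cost (bins P₁) ∷ cost old ∷ cut A₂ (⋃ (bins P₁)) ∷ cut A₁ (⋃ old) ∷ cut A₂ (⋃ old) ∷ cut A (⋃ old)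
              ∷ cut A₁ A₂ ∷ c₁ ∷ c₂ ∷ c ∷ [])
            ((1 , x₀ ≼ x₉ ⊕ x₁ ⊕ x₃) ∷ (1 , x₁ ≼ x₈ ⊕ x₂ ⊕ x₄) ∷ (1 , x₃ ≼ x₅ ⊕ x₇) ∷ (1 , x₄ ⊕ x₅ ≼ x₆) ∷ (1 , x₈ ⊕ x₉ ⊕ x₇ ≼ x₁₀) ∷ [])
            (x₀ ≼ x₁₀ ⊕ x₂ ⊕ x₆)
            ( costs P₂ , costs P₁
            , ≤-trans (Three.cut-mono A₂ (⋃ (bins P₁)) (⋃ old ∨ˢ A₁) (inside P₁))
                (≤-trans (Three.cut-∨ A₂ (⋃ old) A₁) (≤-reflexive (cong (cut A₂ (⋃ old) +_) (Two.cut-sym A₂ A₁))))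
            , Three.cut-split-disjoint A (⋃ old) S dj , r , tt)
        }
        where
        open Packing
        A₁ A₂ : VSet n
        A₁ = A ∧ˢ S
        A₂ = A ∖ S
        ρ = ∂ A ∷ ∂ A₁ ∷ ∂ A₂ ∷ cut A₁ A₂ ∷ t A ∷ t A₁ ∷ t A₂ ∷ c ∷ c₁ ∷ c₂ ∷ D ∷ []
        hyps : List (ℕ × Ineq 11)
        hyps = (1 , x₁ ⊕ x₂ ≼ x₀ ⊕ (x₃ ⊕ x₃)) ∷ (1 , x₀ ⊕ x₇ ⊗ 2 ≼ x₄ ⊕ x₁₀) ∷ (2 , x₈ ⊕ x₉ ⊕ x₃ ≼ x₇) ∷ (1 , x₄ ≼ x₅ ⊕ x₆) ∷ []
        common : Holds ρ hyps
        common = ≤-reflexive (Two.∂-split A S) , h , r , ≤-reflexive (sym (t-split A S)) , tt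
        -- The excesses ∂ + 2c - t of the two pieces add up to at most that of `A`, and neither is
        -- negative by `t≤∂+2c`; so each piece inherits the bound D.
        h₁ : ∂ A₁ + c₁ * 2 ≤ t A₁ + D
        h₁ = linear 0 ρ ((1 , x₆ ≼ x₂ ⊕ x₉ ⊗ 2) ∷ hyps) (x₁ ⊕ x₈ ⊗ 2 ≼ x₅ ⊕ x₁₀) (t≤∂+2c q , common)
        h₂ : ∂ A₂ + c₂ * 2 ≤ t A₂ + D
        h₂ = linear 0 ρ ((1 , x₅ ≼ x₁ ⊕ x₈ ⊗ 2) ∷ hyps) (x₂ ⊕ x₉ ⊗ 2 ≼ x₆ ⊕ x₁₀) (t≤∂+2c p , common)
        P₁ : Packing A₁ c₁ old
        P₁ = pack D≤ p h₁ old packed-old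
          (λ v → entails {r = 3} (λ a σ o → not (a ∧ o)) (λ a σ o → not ((a ∧ σ) ∧ o)) (A v ∷ S v ∷ ⋃ old v ∷ []) (dj v))
        P₂ : Packing A₂ c₂ (bins P₁)
        P₂ = pack D≤ q h₂ (bins P₁) (packed P₁)
          (λ v → entails {r = 4} (λ a σ o b → not (a ∧ o) ∧ (b ⇒ᵇ (o ∨ (a ∧ σ))))
                   (λ a σ o b → not ((a ∧ not σ) ∧ b)) (A v ∷ S v ∷ ⋃ old v ∷ ⋃ (bins P₁) v ∷ []) (dj v & inside P₁ v))

      -- As 2(520 + 2·110) < 7·232, the packing uses at most seven bins. Summing `optimum-bound`
      -- over their pairs gives 45g ≤ 6(520κ + 2g), so g ≤ 3120κ/33, which is below 97κ.
      no-costly-optimum : 1 ≤ κ → ∀ R g → Split R g → Opt R g → ∂ R ≤ t R + κ * 8 → t R ≤ κ * 512 →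
                          κ * 97 ≤ g → g ≤ κ * 110 → ⊥
      no-costly-optimum κ≥1 R g p opt ∂≤ t≤ g≥ g≤ = go bins packed inside covers cheap′
        where
        empty : Bin
        empty = ∅ , 0 , leaf (≤-trans t-∅ z≤n)
        P : Packing R g (empty ∷ [])
        -- The excess ∂ + 2g - t of `R`, at most 228κ because g ≤ 110κ.
        P = pack {D = κ * 8 + g * 2}
          (linear 0 (κ ∷ g ∷ []) ((2 , x₁ ≼ x₀ ⊗ 110) ∷ []) (x₀ ⊗ 8 ⊕ x₁ ⊗ 2 ≼ x₀ ⊗ 232) (g≤ , tt))
          p (linear 0 (κ ∷ g ∷ ∂ R ∷ t R ∷ []) ((1 , x₂ ≼ x₃ ⊕ x₀ ⊗ 8) ∷ []) (x₂ ⊕ x₁ ⊗ 2 ≼ x₃ ⊕ (x₀ ⊗ 8 ⊕ x₁ ⊗ 2)) (∂≤ , tt))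
          (empty ∷ [])
          (((λ _ → tt) , tt)
          , (linear 0 (t ∅ ∷ ∂ ∅ ∷ κ ∷ []) ((1 , x₀ ≼ con 0) ∷ (1 , x₁ ≼ con 0) ∷ []) (x₀ ⊕ (x₁ ⊕ con 0) ≼ x₂ ⊗ 256) (t-∅ , ∂-∅ , tt) , tt)
          , linear 0 (t ∅ ∷ ∂ ∅ ∷ []) ((1 , x₀ ≼ con 0) ∷ (1 , x₁ ≼ con 0) ∷ []) (x₀ ⊕ (x₁ ⊕ con 0) ≼ (x₁ ⊕ con 0 ⊕ con 0) ⊗ 2) (t-∅ , ∂-∅ , tt))
          (λ v → tautology {r = 1} (λ a → not (a ∧ false)) (R v ∷ []))
        open Packing P
        cheap′ : cost bins ≤ g
        cheap′ = linear 0 (cost bins ∷ g ∷ cut ∅ ∅ ∷ cut R (∅ ∨ˢ ∅) ∷ [])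
          ((1 , x₀ ≼ x₁ ⊕ (x₂ ⊕ con 0) ⊕ x₃) ∷ (1 , x₂ ≼ con 0) ∷ (1 , x₃ ≼ con 0) ∷ []) (x₀ ≼ x₁)
          (costs , One.cut-∅ ∅ , One.cut-∅ R , tt)
        go : ∀ bins → Packed bins → ⋃ bins ⊑ ⋃ (empty ∷ []) ∨ˢ R → ⋃ (empty ∷ []) ∨ˢ R ⊑ ⋃ bins → cost bins ≤ g → ⊥
        go (b ∷ bs) (sep , small , inv) in⊑ cov cst = result bs refl
          where
          R⊑ : R ⊑ ⋃ (b ∷ bs)
          R⊑ = cov
          ⊑R : ⋃ (b ∷ bs) ⊑ R
          ⊑R = in⊑
          all : List Bin
          all = b ∷ bs
          opt′ : Opt (⋃ all) (cost all)
          opt′ e q = ≤-trans cst (opt e (Split-mono R⊑ q))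
          cost≥ : g ≤ cost all
          cost≥ = opt _ (Split-mono R⊑ (Split-⋃ all))
          ∂≤∂ : ∂ (⋃ all) ≤ ∂ R
          ∂≤∂ = count-≤ {r = 5} (λ f as ad bs bd → ((as ⇒ᵇ bs) ∧ (bs ⇒ᵇ as)) ∧ (ad ⇒ᵇ bd) ∧ (bd ⇒ᵇ ad))
            ((λ f as ad bs bd → leaves f as ad) ∷ []) ((λ f as ad bs bd → leaves f bs bd) ∷ [])
            (λ e → F e ∷ ⋃ all (s e) ∷ ⋃ all (d e) ∷ R (s e) ∷ R (d e) ∷ [])
            (λ e → (⊑R (s e) & R⊑ (s e)) & ⊑R (d e) & R⊑ (d e))
          Φ≤ : Φ all ≤ κ * 520 + g * 2
          Φ≤ = linear 0 (Φ all ∷ ∂ (⋃ all) ∷ cost all ∷ ∂ R ∷ t R ∷ κ ∷ g ∷ [])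
            ((1 , x₀ ≼ x₁ ⊕ x₂ ⊗ 2) ∷ (1 , x₁ ≼ x₃) ∷ (2 , x₂ ≼ x₆) ∷ (1 , x₃ ≼ x₄ ⊕ x₅ ⊗ 8) ∷ (1 , x₄ ≼ x₅ ⊗ 512) ∷ [])
            (x₀ ≼ x₅ ⊗ 520 ⊕ x₆ ⊗ 2) (≤-reflexive (Φ≡ all sep) , ∂≤∂ , cst , ∂≤ , t≤ , tt)
          count : length bs ≤ 6
          count = ≮⇒≥ λ 7≤ → refute (length bs * (κ * 232) ∷ ω b ∷ Φ all ∷ κ ∷ g ∷ [])
            ((1 , x₀ ⊕ x₁ ≼ x₂ ⊗ 2) ∷ (2 , x₂ ≼ x₃ ⊗ 520 ⊕ x₄ ⊗ 2) ∷ (4 , x₄ ≼ x₃ ⊗ 110) ∷ (1 , x₃ ⊗ 1624 ≼ x₀) ∷ (144 , con 1 ≼ x₃) ∷ [])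
            (inv , Φ≤ , g≤ , ≤-trans (≤-reflexive (lemma κ)) (*-monoˡ-≤ (κ * 232) 7≤) , κ≥1 , tt)
            where
            lemma : ∀ κ → κ * 1624 ≡ 7 * (κ * 232)
            lemma κ = trans (sym (*-assoc κ 232 7)) (*-comm (κ * 232) 7)
          result : ∀ bs′ → bs ≡ bs′ → ⊥
          result [] refl = refute (c ∷ ∂ U ∷ t U ∷ κ ∷ g ∷ cut U ∅ ∷ [])
            ((1 , x₀ ⊗ 45 ≼ x₁ ⊕ x₀ ⊗ 2) ∷ (1 , x₂ ⊕ (x₁ ⊕ x₀ ⊗ 2) ≼ x₃ ⊗ 256) ∷ (45 , x₄ ≼ x₀ ⊕ con 0 ⊕ (x₅ ⊕ con 0)) ∷ (45 , x₅ ≼ con 0)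
              ∷ (45 , x₃ ⊗ 97 ≼ x₄) ∷ (4109 , con 1 ≼ x₃) ∷ [])
            (optimum-bound U c q optU (≤-trans small₀ (*-monoʳ-≤ κ (≤ᵇ⇒≤ 256 512 tt))) , small₀ , cost≥ , One.cut-∅ U , g≥ , κ≥1 , tt)
            where
            U = proj₁ b
            c = proj₁ (proj₂ b)
            q = proj₂ (proj₂ b)
            small₀ = proj₁ small
            optU : Opt U c
            optU e q′ = linear 0 (c ∷ e ∷ g ∷ cut U ∅ ∷ []) ((1 , x₀ ⊕ con 0 ⊕ (x₃ ⊕ con 0) ≼ x₁) ∷ []) (x₀ ≼ x₁)
              (opt′ e (Split-mono (λ v → tautology {r = 1} (λ u → (u ∨ false) ⇒ᵇ u) (U v ∷ [])) q′) , tt)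
          -- With a second bin the factor of `parts` in `all-pairs` is at least 1, so the left side
          -- is at least 45 times the cost.
          result (b′ ∷ bs′) refl = refute (parts all ∷ crossing all ∷ length bs′ * parts all ∷ (1 + length bs′) * Φ all ∷ Φ all ∷ κ ∷ g ∷ [])
            ((1 , (x₀ ⊕ x₂ ⊕ x₁) ⊗ 45 ≼ x₃) ∷ (1 , x₃ ≼ x₄ ⊗ 6) ∷ (6 , x₄ ≼ x₅ ⊗ 520 ⊕ x₆ ⊗ 2) ∷ (45 , x₆ ≼ x₀ ⊕ x₁)
              ∷ (33 , x₅ ⊗ 97 ≼ x₆) ∷ (81 , con 1 ≼ x₅) ∷ [])
            (all-pairs b bs sep small opt′ , ≤-trans (*-monoˡ-≤ (Φ all) count) (≤-reflexive (*-comm 6 (Φ all)))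
            , Φ≤ , cost≥ , g≥ , κ≥1 , tt)

-- Edge-minimal networks

module Terminals {n m : ℕ} (s d : Fin m → Fin n) (T₁ T₂ : VSet n) (κ : ℕ) where

  open Weight T₁ public using () renaming (wt to t; wt-mono to t-mono; wt-modular to t-modular; wt-∁ to t-∁)
  open Weight T₂ public using () renaming (wt to u; wt-mono to u-mono; wt-modular to u-modular; wt-∁ to u-∁)

  incident : Fin n → Fin m → Bool
  incident v e = single v (s e) ∨ single v (d e)

  WellCut : (Fin m → Bool) → Set
  WellCut F = (∀ S → t S * 2 ≤ κ * 512 → t S ≤ ∂ S ⊎ κ * 12 ≤ ∂ S)
            × (∀ S → t S * 2 ≤ κ * 512 → u S ≤ ∂ S * 2)
    where open Cuts s d F

  Υ : (Fin m → Bool) → VSet n → VSet n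
  Υ E′ W v = W v ∧ anyᵇ (λ i → E′ i ∧ incident v i)

  internal : VSet n → VSet n → ℕ
  internal W S = # λ i → (W (s i) ∧ W (d i)) ∧ (S (s i) xor S (d i))

  -- The first alternative suffices for a cut because at most κ units are ever routed, and capacity
  -- 64 exceeds 16.
  RoutableAt : VSet n → VSet n → VSet n → Set
  RoutableAt W T′ S = κ ≤ internal W S * 16 ⊎ # (T′ ∧ˢ S) ≤ internal W S * 64 ⊎ # (T′ ∖ S) ≤ internal W S * 64

  -- The cuts of W are large enough for (κ, 1/64)-well-linkedness of T′.
  Routable : VSet n → VSet n → Set
  Routable W T′ = ∀ S → RoutableAt W T′ S

  record Chain (X Y T̃₁ T̃₂ : VSet n) (E′ : Fin m → Bool) : Set where
    field
      X∩Y=∅      : Disj X Y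
      T̃₁⊑        : T̃₁ ⊑ T₁ ∧ˢ X
      T̃₂⊑        : T̃₂ ⊑ T₂ ∧ˢ Y
      #T̃₁        : # T̃₁ ≡ κ * 8
      #T̃₂        : # T̃₂ ≡ κ
      #E′        : # E′ ≡ κ
      E′-crosses : ∀ i → T (E′ i ⇒ᵇ (X (s i) ∧ Y (d i) ∨ X (d i) ∧ Y (s i)))
      E′-match   : ∀ i j v → T (E′ i) → T (E′ j) → T (incident v i) → T (incident v j) → i ≡ j
      X-routable : Routable X (T̃₁ ∨ˢ Υ E′ X)
      Y-routable : Routable Y (T̃₂ ∨ˢ Υ E′ Y)

  module Minimal (κ≥1 : 1 ≤ κ) (t-full : t full ≡ κ * 512) (u-full : u full ≡ κ * 8)
                 (degree≤3 : ∀ v → # (incident v) ≤ 3)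
                 (F : Fin m → Bool) (wellcut : WellCut F) (minimal : ∀ F′ → WellCut F′ → # F ≤ # F′) where

    open Splitting s d F T₁ κ hiding (t; t-mono; t-∁)

    t-cap : ∀ S → t S * 2 ≤ κ * 512 → t S ≤ ∂ S ⊎ κ * 12 ≤ ∂ S
    t-cap = proj₁ wellcut

    u-cap : ∀ S → t S * 2 ≤ κ * 512 → u S ≤ ∂ S * 2
    u-cap = proj₂ wellcut

    t≤512κ : ∀ S → t S ≤ κ * 512
    t≤512κ S = ≤-trans (t-mono {S} {full} (⊑-full S)) (≤-reflexive t-full)

    u≤8κ : ∀ S → u S ≤ κ * 8
    u≤8κ S = ≤-trans (u-mono {S} {full} (⊑-full S)) (≤-reflexive u-full)

    t≤∂ : ∀ A → t A ≤ κ * 12 → t A ≤ ∂ A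
    t≤∂ A h with t-cap A (linear 0 (t A ∷ κ ∷ []) ((2 , x₀ ≼ x₁ ⊗ 12) ∷ []) (x₀ ⊗ 2 ≼ x₁ ⊗ 512) (h , tt))
    ... | inj₁ p = p
    ... | inj₂ p = ≤-trans h p

    open Bounded t≤∂

    -- These are the sets whose inequality fails once a boundary edge is lost. For u ≤ 2∂ this means
    -- u > 2(∂ - 1), hence the slack of one.
    Tight : VSet n → Set
    Tight S = (∂ S ≤ t S × ∂ S ≤ κ * 12) ⊎ ∂ S * 2 ≤ 1 + u S

    crosses : VSet n → Fin m → Bool
    crosses S e = S (s e) xor S (d e)

    -- By minimality `F` without `e` violates some inequality. The violating set must have lost `e`
    -- from its boundary, and a violation after the loss of one edge is tightness before it.
    tight-cut : ∀ e → T (F e) → (∀ S → t S * 2 ≤ κ * 512 → Tight S → T (crosses S e) → ⊥) → ⊥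
    tight-cut e Fe none = 1+n≰n (≤-trans smaller (minimal F′ (t′ , u′)))
      where
      F′ : Fin m → Bool
      F′ = F ∖ single e
      module C′ = Cuts s d F′
      smaller : # F′ < # F
      smaller = #-strict {A = F′} {F} (∖-⊑ F (single e))
        e (entails {r = 2} (λ f σ → f ∧ σ) (λ f σ → f ∧ not (f ∧ not σ)) (F e ∷ single e e ∷ []) (Fe & single-refl e))
      ∂≤ : ∀ S → ∂ S ≤ C′.∂ S + ind (crosses S e)
      ∂≤ S = ≤-trans
        (count-≤ {r = 4} trivial ((λ f σ a b → leaves f a b) ∷ [])
          ((λ f σ a b → leaves (f ∧ not σ) a b) ∷ (λ f σ a b → σ ∧ (a xor b)) ∷ [])
          (λ i → F i ∷ single e i ∷ S (s i) ∷ S (d i) ∷ []) (λ _ → tt))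
        (≤-reflexive (cong (C′.∂ S +_) (#-single e (crosses S))))
      loses : ∀ S → ∂ S ≤ C′.∂ S ⊎ (T (crosses S e) × ∂ S ≤ 1 + C′.∂ S)
      loses S with crosses S e | ∂≤ S
      ... | true  | le = inj₂ (tt , ≤-trans le (≤-reflexive (+-comm (C′.∂ S) 1)))
      ... | false | le = inj₁ (≤-trans le (≤-reflexive (+-identityʳ _)))
      t′ : ∀ S → t S * 2 ≤ κ * 512 → t S ≤ C′.∂ S ⊎ κ * 12 ≤ C′.∂ S
      t′ S h with t S ≤? C′.∂ S | κ * 12 ≤? C′.∂ S
      ... | yes p | _     = inj₁ p
      ... | no _  | yes p = inj₂ p
      ... | no p  | no q with loses S
      ...   | inj₂ (cr , le) = ⊥-elim (none S h (inj₁ (≤-trans le (≰⇒> p) , ≤-trans le (≰⇒> q))) cr)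
      ...   | inj₁ le with t-cap S h
      ...     | inj₁ g = inj₁ (≤-trans g le)
      ...     | inj₂ g = inj₂ (≤-trans g le)
      u′ : ∀ S → t S * 2 ≤ κ * 512 → u S ≤ C′.∂ S * 2
      u′ S h with u S ≤? C′.∂ S * 2 | loses S
      ... | yes p | _ = p
      ... | no p | inj₁ le = ≤-trans (u-cap S h) (*-monoˡ-≤ 2 le)
      ... | no p | inj₂ (cr , le) = ⊥-elim (none S h
              (inj₂ (linear 0 (∂ S ∷ C′.∂ S ∷ u S ∷ []) ((2 , x₀ ≼ con 1 ⊕ x₁) ∷ (1 , con 1 ⊕ x₁ ⊗ 2 ≼ x₂) ∷ []) (x₀ ⊗ 2 ≼ con 1 ⊕ x₂) (le , ≰⇒> p , tt))) cr)

    -- The intersection is contained in S and so has at most half of T₁; the cut inequalities hold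
    -- for it. Submodularity then gains on the intersection what the tight set S costs, and
    -- modularity of the terminal counts balances the rest.
    uncross : ∀ R S → t S * 2 ≤ κ * 512 → Tight S → ∂ R ≤ t R + u R → ∂ (R ∨ˢ S) ≤ t (R ∨ˢ S) + u (R ∨ˢ S)
    uncross R S h tight hR = go tight
      where
      I = R ∧ˢ S
      U = R ∨ˢ S
      tI : t I * 2 ≤ κ * 512
      tI = ≤-trans (*-monoˡ-≤ 2 (t-mono {I} {S} (∧-⊑ʳ R S))) h
      R⊑U : R ⊑ U
      R⊑U = ⊑-∨ R S
      sub : ∂ U + ∂ I ≤ ∂ R + ∂ S
      sub = Two.submodular R S
      tm : t R + t S ≤ t U + t I
      tm = ≤-reflexive (sym (t-modular R S))
      um : u R + u S ≤ u U + u I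
      um = ≤-reflexive (sym (u-modular R S))
      ρ = ∂ U ∷ ∂ I ∷ ∂ R ∷ ∂ S ∷ t U ∷ t I ∷ t R ∷ t S ∷ u U ∷ u I ∷ u R ∷ u S ∷ []
      go : Tight S → ∂ U ≤ t U + u U
      go (inj₁ (∂≤t , ∂≤12κ)) with t-cap I tI
      ... | inj₁ g = linear 0 ρ ((1 , x₀ ⊕ x₁ ≼ x₂ ⊕ x₃) ∷ (1 , x₆ ⊕ x₇ ≼ x₄ ⊕ x₅) ∷ (1 , x₂ ≼ x₆ ⊕ x₁₀) ∷ (1 , x₃ ≼ x₇) ∷ (1 , x₅ ≼ x₁) ∷ (1 , x₁₀ ≼ x₈) ∷ [])
              (x₀ ≼ x₄ ⊕ x₈) (sub , tm , hR , ∂≤t , g , u-mono R⊑U , tt)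
      ... | inj₂ g = linear 0 ρ ((1 , x₀ ⊕ x₁ ≼ x₂ ⊕ x₃) ∷ (1 , x₃ ≼ x₁) ∷ (1 , x₂ ≼ x₆ ⊕ x₁₀) ∷ (1 , x₆ ≼ x₄) ∷ (1 , x₁₀ ≼ x₈) ∷ [])
              (x₀ ≼ x₄ ⊕ x₈) (sub , ≤-trans ∂≤12κ g , hR , t-mono R⊑U , u-mono R⊑U , tt)
      go (inj₂ 2∂≤) with ≤-<-connex (∂ S) (∂ I)
      ... | inj₁ le = linear 0 ρ ((1 , x₀ ⊕ x₁ ≼ x₂ ⊕ x₃) ∷ (1 , x₃ ≼ x₁) ∷ (1 , x₂ ≼ x₆ ⊕ x₁₀) ∷ (1 , x₆ ≼ x₄) ∷ (1 , x₁₀ ≼ x₈) ∷ [])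
              (x₀ ≼ x₄ ⊕ x₈) (sub , le , hR , t-mono R⊑U , u-mono R⊑U , tt)
      -- With δ = u U − u R: 2 ≤ 2 (∂ S − ∂ I) ≤ δ + 1, so ∂ S − ∂ I ≤ δ.
      ... | inj₂ gt = linear 0 ρ ((1 , x₀ ⊕ x₁ ≼ x₂ ⊕ x₃) ∷ (1 , con 1 ⊕ x₁ ≼ x₃) ∷ (1 , x₃ ⊗ 2 ≼ con 1 ⊕ x₁₁) ∷ (1 , x₉ ≼ x₁ ⊗ 2)
                ∷ (1 , x₁₀ ⊕ x₁₁ ≼ x₈ ⊕ x₉) ∷ (1 , x₂ ≼ x₆ ⊕ x₁₀) ∷ (1 , x₆ ≼ x₄) ∷ [])
              (x₀ ≼ x₄ ⊕ x₈) (sub , gt , 2∂≤ , u-cap I tI , um , hR , t-mono R⊑U , tt)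

    -- The slack 3κ pays for the 45e edges that arise when a core is divided by e < κ/16 edges, as
    -- 45/16 < 3.
    Robust : VSet n → Set
    Robust A = κ * 12 < t A × (∀ c → Split A c → ∂ A < c * 43 + κ * 3)

    -- The inequalities serve twice: they are the hypotheses of `Cheap`, and they force the
    -- complement to be robust.
    Admissible : VSet n → Set
    Admissible A = t A * 2 ≤ κ * 512 × ∂ A * 45 + t A * 43 ≤ κ * 22016

    module _ (none : ∀ A → Admissible A → ¬ Robust A) where

      cheap : Cheap
      cheap A h₁ h₂ k with κ * 12 <? t A
      ... | no p  = k 0 (leaf (≮⇒≥ p)) z≤n
      ... | yes p = none A (h₁ , h₂) (p , λ c q → ≤-trans (≰⇒> (k c q)) (m≤m+n (c * 43) (κ * 3)))

      Growing : VSet n → Set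
      Growing R = ∂ R ≤ t R + u R × Σ ℕ λ c → c < κ * 97 × Split R c

      module _ (R : VSet n) (growing : Growing R) (maximal : ∀ R′ → Growing R′ → # R′ ≤ # R) where

        -- The least cost up to 110κ at which `R′` splits is either below 97κ, against the
        -- maximality of `R`, or in the range excluded by `no-costly-optimum`.
        too-large : ∀ R′ c → # R < # R′ → ∂ R′ ≤ t R′ + u R′ → Split R′ c → c ≤ κ * 110 → ⊥
        too-large R′ c gt ∂≤ p c≤ = argmin (λ c → Split R′ c × c ≤ κ * 110) id
          (λ g (q , g≤) opt → no-costly-optimum cheap κ≥1 R′ g q
            (λ e r → case≤ g e r g≤ opt) (≤-trans ∂≤ (+-monoʳ-≤ (t R′) (u≤8κ R′))) (t≤512κ R′)
            (≮⇒≥ λ lt → 1+n≰n (≤-trans gt (maximal R′ (∂≤ , g , lt , q)))) g≤)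
          c (p , c≤)
          where
          case≤ : ∀ g e → Split R′ e → g ≤ κ * 110 → (∀ b → Split R′ b × b ≤ κ * 110 → g ≤ b) → g ≤ e
          case≤ g e r g≤ opt with ≤-total e (κ * 110)
          ... | inj₁ le = opt e (r , le)
          ... | inj₂ le = ≤-trans g≤ le

        c₀ : ℕ
        c₀ = proj₁ (proj₂ growing)
        c₀< : c₀ < κ * 97
        c₀< = proj₁ (proj₂ (proj₂ growing))
        split₀ : Split R c₀
        split₀ = proj₂ (proj₂ (proj₂ growing))

        -- A tight set S across `e` has ∂ S ≤ 12κ, so it splits at cost at most 12κ/43, and
        -- attaching it to `R` cuts at most ∂ S edges. The limit 110κ leaves room for this: 97 + 12
        -- + 12/43 < 110.
        add-tight : ∀ e → T (F e) → T (not (R (s e)) ∧ not (R (d e))) → ⊥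
        add-tight e Fe out = tight-cut e Fe λ S tS tight cr →
          let ∂S≤ : ∂ S ≤ κ * 12
              ∂S≤ = small S tight
          in cheap S tS
            (linear 0 (t S ∷ ∂ S ∷ κ ∷ []) ((22 , x₀ ⊗ 2 ≼ x₂ ⊗ 512) ∷ (45 , x₁ ≼ x₂ ⊗ 12) ∷ []) (x₁ ⊗ 45 ⊕ x₀ ⊗ 43 ≼ x₂ ⊗ 22016) (tS , ∂S≤ , tt))
            λ c q 43c≤ → too-large (R ∨ˢ S) (c + c₀ + cut S (R ∖ S)) (grows S cr)
              (uncross R S tS tight (proj₁ growing))
              (Split-mono (λ v → tautology {r = 2} (λ a b → (a ∨ b) ⇒ᵇ (b ∨ (a ∧ not b))) (R v ∷ S v ∷ []))
                (Split-union q (Split-mono (∖-⊑ R S) split₀)))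
              (linear 42 (c ∷ c₀ ∷ cut S (R ∖ S) ∷ ∂ S ∷ κ ∷ [])
                ((1 , x₀ ⊗ 43 ≼ x₃) ∷ (43 , con 1 ⊕ x₁ ≼ x₄ ⊗ 97) ∷ (43 , x₂ ≼ x₃) ∷ (44 , x₃ ≼ x₄ ⊗ 12) ∷ [])
                (x₀ ⊕ x₁ ⊕ x₂ ≼ x₄ ⊗ 110) (43c≤ , c₀< , Two.cut≤∂ S R , ∂S≤ , tt))
          where
          small : ∀ S → Tight S → ∂ S ≤ κ * 12
          small S (inj₁ (_ , le)) = le
          small S (inj₂ le) = linear 1 (∂ S ∷ u S ∷ κ ∷ []) ((1 , x₀ ⊗ 2 ≼ con 1 ⊕ x₁) ∷ (1 , x₁ ≼ x₂ ⊗ 8) ∷ (1 , con 1 ≼ x₂) ∷ [])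
            (x₀ ≼ x₂ ⊗ 12) (le , u≤8κ S , κ≥1 , tt)
          grows : ∀ S → T (crosses S e) → # R < # (R ∨ˢ S)
          grows S cr with T? (S (s e))
          ... | yes p = #-strict {A = R} {R ∨ˢ S} (⊑-∨ R S) (s e)
                  (entails {r = 3} (λ a a′ b → (not a ∧ not a′) ∧ b) (λ a a′ b → (a ∨ b) ∧ not a) (R (s e) ∷ R (d e) ∷ S (s e) ∷ []) (out & p))
          ... | no p = #-strict {A = R} {R ∨ˢ S} (⊑-∨ R S) (d e)
                  (entails {r = 4} (λ a a′ b b′ → (not a ∧ not a′) ∧ (b xor b′) ∧ not b) (λ a a′ b b′ → (a′ ∨ b′) ∧ not a′)
                    (R (s e) ∷ R (d e) ∷ S (s e) ∷ S (d e) ∷ []) (out & cr & ¬T⇒T-not _ p))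

        -- All edges of `F` at `v` lead into `R`, so the boundary does not grow, and by the degree
        -- bound at most three edges are cut.
        add-vertex : (∀ e → T (F e) → T (not (R (s e)) ∧ not (R (d e))) → ⊥) → ∀ v → T (not (R v)) → ⊥
        add-vertex noedge v out = too-large (R ∨ˢ single v) (c₀ + 0 + cut R (single v))
          (#-strict {A = R} {R ∨ˢ single v} R⊑ v
            (entails {r = 2} (λ a b → not a ∧ b) (λ a b → (a ∨ b) ∧ not a) (R v ∷ single v v ∷ []) (out & single-refl v)))
          (≤-trans ∂≤ (≤-trans (proj₁ growing) (+-mono-≤ (t-mono R⊑) (u-mono R⊑))))
          (Split-union split₀ (leaf t≤))
          (linear 0 (c₀ ∷ cut R (single v) ∷ κ ∷ []) ((1 , con 1 ⊕ x₀ ≼ x₂ ⊗ 97) ∷ (1 , x₁ ≼ con 3) ∷ (3 , con 1 ≼ x₂) ∷ [])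
            (x₀ ⊕ con 0 ⊕ x₁ ≼ x₂ ⊗ 110) (c₀< , cut≤3 , κ≥1 , tt))
          where
          R⊑ : R ⊑ R ∨ˢ single v
          R⊑ = ⊑-∨ R (single v)
          touched : ∀ e → T (F e ⇒ᵇ not (not (R (s e)) ∧ not (R (d e))))
          touched e with F e in eqF | not (R (s e)) ∧ not (R (d e)) in eqR
          ... | false | _ = tt
          ... | true | false = tt
          ... | true | true = noedge e (subst T (sym eqF) tt) (subst T (sym eqR) tt)
          ∂≤ : ∂ (R ∨ˢ single v) ≤ ∂ R
          ∂≤ = count-≤ {r = 5} (λ f a a′ b b′ → f ⇒ᵇ not (not a ∧ not a′))
            ((λ f a a′ b b′ → leaves f (a ∨ b) (a′ ∨ b′)) ∷ []) ((λ f a a′ b b′ → leaves f a a′) ∷ [])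
            (λ e → F e ∷ R (s e) ∷ R (d e) ∷ single v (s e) ∷ single v (d e) ∷ []) touched
          cut≤3 : cut R (single v) ≤ 3
          cut≤3 = ≤-trans (count-≤ {r = 5} trivial
            ((λ f a a′ b b′ → link f a a′ b b′) ∷ []) ((λ f a a′ b b′ → b ∨ b′) ∷ [])
            (λ e → F e ∷ R (s e) ∷ R (d e) ∷ single v (s e) ∷ single v (d e) ∷ []) (λ _ → tt)) (degree≤3 v)
          t≤ : t (single v) ≤ κ * 12
          t≤ = ≤-trans (count-mono (∧-⊑ʳ T₁ (single v)))
            (≤-trans (≤-reflexive (#-single≡1 v)) (linear 0 (κ ∷ []) ((1 , con 1 ≼ x₀) ∷ []) (con 1 ≼ x₀ ⊗ 12) (κ≥1 , tt)))

        -- Once `R` is the whole vertex set its boundary is empty, and `t≤∂+2c` would give 512κ ≤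
        -- 2c₀ < 194κ.
        finish : ⊥
        finish with any? (λ e → T? (F e ∧ (not (R (s e)) ∧ not (R (d e)))))
        ... | yes (e , p) = add-tight e (proj₁ (T-∧⁻ (F e) p)) (proj₂ (T-∧⁻ (F e) p))
        ... | no noedge with any? (λ v → T? (not (R v)))
        ...   | yes (v , p) = add-vertex (λ e f o → noedge (e , (f & o))) v p
        ...   | no nov = refute (t R ∷ ∂ R ∷ c₀ ∷ κ ∷ [])
                  ((1 , x₀ ≼ x₁ ⊕ x₂ ⊗ 2) ∷ (1 , x₁ ≼ con 0) ∷ (2 , con 1 ⊕ x₂ ≼ x₃ ⊗ 97) ∷ (1 , x₃ ⊗ 512 ≼ x₀) ∷ [])
                  (t≤∂+2c split₀ , ∂R≤0 , c₀< , ≤-trans (≤-reflexive (sym t-full)) (t-mono {full} {R} all) , tt)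
          where
          all : full ⊑ R
          all v with R v in eq
          ... | true = tt
          ... | false = nov (v , subst (T ∘ not) (sym eq) tt)
          ∂R≤0 : ∂ R ≤ 0
          ∂R≤0 = count-≤ {r = 3} (λ f a b → a ∧ b) ((λ f a b → leaves f a b) ∷ []) []
            (λ e → F e ∷ R (s e) ∷ R (d e) ∷ []) (λ e → all (s e) & all (d e))

      robust-exists : ⊥
      robust-exists = argmax Growing # n (λ R _ → #≤n R) finish ∅
        ( ≤-trans ∂-∅ z≤n
        , 0 , linear 0 (κ ∷ []) ((1 , con 1 ≼ x₀) ∷ []) (con 1 ≼ x₀ ⊗ 97) (κ≥1 , tt)
        , leaf (≤-trans t-∅ z≤n))

-- The two clusters

module Clusters {n m : ℕ} (s d : Fin m → Fin n) (T₁ T₂ : VSet n) (κ : ℕ)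
                (κ≥1 : 1 ≤ κ) (t-full : # (λ v → T₁ v ∧ true) ≡ κ * 512) (u-full : # (λ v → T₂ v ∧ true) ≡ κ * 8)
                (degree≤3 : ∀ v → # (Terminals.incident s d T₁ T₂ κ v) ≤ 3)
                (F : Fin m → Bool) (wellcut : Terminals.WellCut s d T₁ T₂ κ F)
                (minimal : ∀ F′ → Terminals.WellCut s d T₁ T₂ κ F′ → # F ≤ # F′) where

  open Terminals s d T₁ T₂ κ
  open Minimal κ≥1 t-full u-full degree≤3 F wellcut minimal
  open Splitting s d F T₁ κ hiding (t; t-mono; t-∁)
  open Bounded t≤∂ using (t≤∂+2c)

  ∂-∁ : ∀ A → ∂ (∁ A) ≡ ∂ A
  ∂-∁ A = count-≡ {r = 3} trivial ((λ f a b → leaves f (not a) (not b)) ∷ [])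
    ((λ f a b → leaves f a b) ∷ []) (λ e → F e ∷ A (s e) ∷ A (d e) ∷ []) (λ _ → tt)

  -- Suppose the complement splits at cost c. Its terminals number at most ∂ + 2c, while
  -- admissibility says 45∂ ≤ 43 t (∁ A); together 45∂ ≤ 43∂ + 86c, that is, ∂ ≤ 43c.
  robust-∁ : ∀ A → Admissible A → Robust A → Robust (∁ A)
  robust-∁ A (h₁ , h₂) _ =
    linear 1 (t A ∷ t (∁ A) ∷ κ ∷ []) ((1 , x₀ ⊗ 2 ≼ x₂ ⊗ 512) ∷ (2 , x₂ ⊗ 512 ≼ x₀ ⊕ x₁) ∷ (2 , con 1 ≼ x₂) ∷ [])
      (con 1 ⊕ x₂ ⊗ 12 ≼ x₁) (h₁ , t+t , κ≥1 , tt)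
    , λ c p → linear 1 (t A ∷ t (∁ A) ∷ κ ∷ ∂ A ∷ ∂ (∁ A) ∷ c ∷ [])
        ((1 , x₃ ⊗ 45 ⊕ x₀ ⊗ 43 ≼ x₂ ⊗ 22016) ∷ (43 , x₂ ⊗ 512 ≼ x₀ ⊕ x₁) ∷ (43 , x₁ ≼ x₄ ⊕ x₅ ⊗ 2) ∷ (45 , x₄ ≼ x₃) ∷ (2 , con 1 ≼ x₂) ∷ [])
        (con 1 ⊕ x₄ ≼ x₅ ⊗ 43 ⊕ x₂ ⊗ 3)
        (h₂ , t+t , t≤∂+2c p , ≤-reflexive (∂-∁ A) , κ≥1 , tt)
    where
    t+t : κ * 512 ≤ t A + t (∁ A)
    t+t = ≤-reflexive (sym (trans (t-∁ A) t-full))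

  -- The cut inequality is applied to whichever of the two sides has at most half of T₁.
  boundary≥12κ : ∀ A → κ * 12 < t A → κ * 12 < t (∁ A) → κ * 12 ≤ ∂ A
  boundary≥12κ A h h′ with t A * 2 ≤? κ * 512
  ... | yes p with t-cap A p
  ...   | inj₁ g = ≤-trans (<⇒≤ h) g
  ...   | inj₂ g = g
  boundary≥12κ A h h′ | no p = ≤-trans via (≤-reflexive (∂-∁ A))
    where
    half : t (∁ A) * 2 ≤ κ * 512
    half = linear 0 (t A ∷ t (∁ A) ∷ κ ∷ []) ((1 , con 1 ⊕ x₂ ⊗ 512 ≼ x₀ ⊗ 2) ∷ (2 , x₀ ⊕ x₁ ≼ x₂ ⊗ 512) ∷ [])
      (x₁ ⊗ 2 ≼ x₂ ⊗ 512) (≰⇒> p , ≤-reflexive (trans (t-∁ A) t-full) , tt)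
    via : κ * 12 ≤ ∂ (∁ A)
    via with t-cap (∁ A) half
    ... | inj₁ g = ≤-trans (<⇒≤ h′) g
    ... | inj₂ g = g

  -- Cores that few edges cannot divide evenly

  Unbreakable : VSet n → Set
  Unbreakable X = ∀ S → cut (X ∧ˢ S) (X ∖ S) * 16 < κ →
    cut (X ∧ˢ S) (∁ X) ≤ cut (X ∧ˢ S) (X ∖ S) * 44 ⊎ cut (X ∖ S) (∁ X) ≤ cut (X ∧ˢ S) (X ∖ S) * 44

  profile : VSet n → VSet n → Fin m → Vec Bool 5
  profile Z S i = F i ∷ Z (s i) ∷ Z (d i) ∷ S (s i) ∷ S (d i) ∷ []

  ∂-∧ : ∀ Z S → ∂ (Z ∧ˢ S) ≡ cut (Z ∧ˢ S) (Z ∖ S) + cut (Z ∧ˢ S) (∁ Z)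
  ∂-∧ Z S = count-≡ trivial ((λ f z z′ σ σ′ → leaves f (z ∧ σ) (z′ ∧ σ′)) ∷ [])
    ((λ f z z′ σ σ′ → link f (z ∧ σ) (z′ ∧ σ′) (z ∧ not σ) (z′ ∧ not σ′))
      ∷ (λ f z z′ σ σ′ → link f (z ∧ σ) (z′ ∧ σ′) (not z) (not z′)) ∷ []) (profile Z S) (λ _ → tt)

  ∂-∖ : ∀ Z S → ∂ (Z ∖ S) ≡ cut (Z ∧ˢ S) (Z ∖ S) + cut (Z ∖ S) (∁ Z)
  ∂-∖ Z S = count-≡ trivial ((λ f z z′ σ σ′ → leaves f (z ∧ not σ) (z′ ∧ not σ′)) ∷ [])
    ((λ f z z′ σ σ′ → link f (z ∧ σ) (z′ ∧ σ′) (z ∧ not σ) (z′ ∧ not σ′))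
      ∷ (λ f z z′ σ σ′ → link f (z ∧ not σ) (z′ ∧ not σ′) (not z) (not z′)) ∷ []) (profile Z S) (λ _ → tt)

  ∂-parts : ∀ Z S → ∂ Z ≡ cut (Z ∧ˢ S) (∁ Z) + cut (Z ∖ S) (∁ Z)
  ∂-parts Z S = count-≡ trivial ((λ f z z′ σ σ′ → leaves f z z′) ∷ [])
    ((λ f z z′ σ σ′ → link f (z ∧ σ) (z′ ∧ σ′) (not z) (not z′))
      ∷ (λ f z z′ σ σ′ → link f (z ∧ not σ) (z′ ∧ not σ′) (not z) (not z′)) ∷ []) (profile Z S) (λ _ → tt)

  -- Take X of least boundary and suppose that both pieces of a division by e edges have more than
  -- 44e edges leaving X. Each piece then has a smaller boundary than X and is not robust: it has at
  -- most 12κ terminals or splits at some cost c with 43c + 3κ ≤ ∂. Combining the two pieces splits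
  -- X more cheaply than its robustness permits.
  core : ∀ A → κ * 12 < t (∁ A) → Robust A →
         (∀ X → X ⊑ A → κ * 12 < t X → Unbreakable X → ⊥) → ⊥
  core A out robust k = argmin (λ X → X ⊑ A × Robust X) ∂ at-maximum A
    ((⊑-refl A) , robust)
    where
    at-maximum : ∀ X → X ⊑ A × Robust X → (∀ Y → Y ⊑ A × Robust Y → ∂ X ≤ ∂ Y) → ⊥
    at-maximum X (X⊑A , t> , rob) min = k X X⊑A t> unbreakable
      where
      ∂X≥ : κ * 12 ≤ ∂ X
      ∂X≥ = boundary≥12κ X t> (≤-trans out (t-mono {∁ A} {∁ X}
        (λ v → entails {r = 2} (λ x a → x ⇒ᵇ a) (λ x a → not a ⇒ᵇ not x) (X v ∷ A v ∷ []) (X⊑A v))))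
      unbreakable : Unbreakable X
      unbreakable S small with cut (X ∧ˢ S) (∁ X) ≤? cut (X ∧ˢ S) (X ∖ S) * 44 | cut (X ∖ S) (∁ X) ≤? cut (X ∧ˢ S) (X ∖ S) * 44
      ... | yes p | _     = inj₁ p
      ... | no _  | yes q = inj₂ q
      ... | no p  | no q  = ⊥-elim (cases (t S₁ ≤? κ * 12) (t S₂ ≤? κ * 12))
        where
        S₁ S₂ : VSet n
        S₁ = X ∧ˢ S
        S₂ = X ∖ S
        ρ : ℕ → ℕ → Vec ℕ 9
        ρ c₁ c₂ = cut S₁ S₂ ∷ cut S₁ (∁ X) ∷ cut S₂ (∁ X) ∷ ∂ S₁ ∷ ∂ S₂ ∷ ∂ X ∷ κ ∷ c₁ ∷ c₂ ∷ []
        S₁⊑ : S₁ ⊑ A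
        S₁⊑ v = entails {r = 3} (λ x σ a → x ⇒ᵇ a) (λ x σ a → (x ∧ σ) ⇒ᵇ a) (X v ∷ S v ∷ A v ∷ []) (X⊑A v)
        S₂⊑ : S₂ ⊑ A
        S₂⊑ v = entails {r = 3} (λ x σ a → x ⇒ᵇ a) (λ x σ a → (x ∧ not σ) ⇒ᵇ a) (X v ∷ S v ∷ A v ∷ []) (X⊑A v)
        weak₁ : ¬ Robust S₁
        weak₁ r = refute (ρ 0 0)
          ((1 , x₅ ≼ x₃) ∷ (1 , x₃ ≼ x₀ ⊕ x₁) ∷ (1 , x₁ ⊕ x₂ ≼ x₅) ∷ (1 , con 1 ⊕ x₀ ⊗ 44 ≼ x₂) ∷ []) (min S₁ (S₁⊑ , r) , ≤-reflexive (∂-∧ X S) , ≤-reflexive (sym (∂-parts X S)) , ≰⇒> q , tt)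
        weak₂ : ¬ Robust S₂
        weak₂ r = refute (ρ 0 0)
          ((1 , x₅ ≼ x₄) ∷ (1 , x₄ ≼ x₀ ⊕ x₂) ∷ (1 , x₁ ⊕ x₂ ≼ x₅) ∷ (1 , con 1 ⊕ x₀ ⊗ 44 ≼ x₁) ∷ []) (min S₂ (S₂⊑ , r) , ≤-reflexive (∂-∖ X S) , ≤-reflexive (sym (∂-parts X S)) , ≰⇒> p , tt)
        cases : Dec (t S₁ ≤ κ * 12) → Dec (t S₂ ≤ κ * 12) → ⊥
        -- Removing the e dividing edges already splits X, so 12κ ≤ ∂ X < 43e + 3κ, although 16e <
        -- κ.
        cases (yes g₁) (yes g₂) = refute (ρ 0 0)
          ((16 , con 1 ⊕ x₅ ≼ (x₀ ⊗ 43) ⊕ x₆ ⊗ 3) ∷ (16 , x₆ ⊗ 12 ≼ x₅) ∷ (43 , con 1 ⊕ x₀ ⊗ 16 ≼ x₆) ∷ [])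
          (rob (cut S₁ S₂) (node S {0} {0} (leaf g₁) (leaf g₂) ≤-refl) , ∂X≥ , small , tt)
        -- Here ∂ X < 43(c₂ + e) + 3κ ≤ ∂ S₂ + 43e, and ∂ S₂ counts e once more; this is where 44
        -- comes from.
        cases (yes g₁) (no g₂) = weak₂ (≰⇒> g₂ , λ c₂ w → ≮⇒≥ λ lt → refute (ρ 0 c₂)
          ((1 , con 1 ⊕ x₅ ≼ (x₈ ⊕ x₀) ⊗ 43 ⊕ x₆ ⊗ 3) ∷ (1 , x₈ ⊗ 43 ⊕ x₆ ⊗ 3 ≼ x₄) ∷ (1 , x₄ ≼ x₀ ⊕ x₂) ∷ (1 , x₁ ⊕ x₂ ≼ x₅)
            ∷ (1 , con 1 ⊕ x₀ ⊗ 44 ≼ x₁) ∷ [])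
          (rob (c₂ + cut S₁ S₂) (node S {0} (leaf g₁) w ≤-refl) , s≤s⁻¹ lt , ≤-reflexive (∂-∖ X S) , ≤-reflexive (sym (∂-parts X S)) , ≰⇒> p , tt))
        cases (no g₁) (yes g₂) = weak₁ (≰⇒> g₁ , λ c₁ w → ≮⇒≥ λ lt → refute (ρ c₁ 0)
          ((1 , con 1 ⊕ x₅ ≼ (x₇ ⊕ con 0 ⊕ x₀) ⊗ 43 ⊕ x₆ ⊗ 3) ∷ (1 , x₇ ⊗ 43 ⊕ x₆ ⊗ 3 ≼ x₃) ∷ (1 , x₃ ≼ x₀ ⊕ x₁) ∷ (1 , x₁ ⊕ x₂ ≼ x₅)
            ∷ (1 , con 1 ⊕ x₀ ⊗ 44 ≼ x₂) ∷ [])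
          (rob (c₁ + 0 + cut S₁ S₂) (node S {c₁} {0} w (leaf g₂) ≤-refl) , s≤s⁻¹ lt , ≤-reflexive (∂-∧ X S) , ≤-reflexive (sym (∂-parts X S)) , ≰⇒> q , tt))
        -- Two slacks of 3κ stand against one: ∂ X < ∂ S₁ + ∂ S₂ + 43e - 3κ = ∂ X + 45e - 3κ,
        -- impossible for 16e < κ.
        cases (no g₁) (no g₂) = weak₁ (≰⇒> g₁ , λ c₁ w₁ → ≮⇒≥ λ lt₁ →
          weak₂ (≰⇒> g₂ , λ c₂ w₂ → ≮⇒≥ λ lt₂ → refute (ρ c₁ c₂)
            ((16 , con 1 ⊕ x₅ ≼ (x₇ ⊕ x₈ ⊕ x₀) ⊗ 43 ⊕ x₆ ⊗ 3) ∷ (16 , x₇ ⊗ 43 ⊕ x₆ ⊗ 3 ≼ x₃) ∷ (16 , x₈ ⊗ 43 ⊕ x₆ ⊗ 3 ≼ x₄)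
              ∷ (16 , x₃ ≼ x₀ ⊕ x₁) ∷ (16 , x₄ ≼ x₀ ⊕ x₂) ∷ (16 , x₁ ⊕ x₂ ≼ x₅) ∷ (45 , con 1 ⊕ x₀ ⊗ 16 ≼ x₆) ∷ [])
            (rob (c₁ + c₂ + cut S₁ S₂) (node S w₁ w₂ ≤-refl) , s≤s⁻¹ lt₁ , s≤s⁻¹ lt₂ , ≤-reflexive (∂-∧ X S) , ≤-reflexive (∂-∖ X S) , ≤-reflexive (sym (∂-parts X S)) , small , tt)))

  -- One side of a minimum cut between the cores

  module Side (X Y Z : VSet n) (X⊑Z : X ⊑ Z) (Y⊑∁Z : Y ⊑ ∁ Z) (tX : κ * 12 < t X) (tY : κ * 12 < t Y)
              (unbreakable : Unbreakable X) (minimum : ∀ Z′ → X ⊑ Z′ → Y ⊑ ∁ Z′ → ∂ Z ≤ ∂ Z′) where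

    e out : VSet n → ℕ
    e S   = cut (Z ∧ˢ S) (Z ∖ S)
    out S = cut (Z ∧ˢ S) (∁ Z)

    e-∁ : ∀ S → e (∁ S) ≡ e S
    e-∁ S = count-≡ trivial
      ((λ f z z′ σ σ′ → link f (z ∧ not σ) (z′ ∧ not σ′) (z ∧ not (not σ)) (z′ ∧ not (not σ′))) ∷ [])
      ((λ f z z′ σ σ′ → link f (z ∧ σ) (z′ ∧ σ′) (z ∧ not σ) (z′ ∧ not σ′)) ∷ []) (profile Z S) (λ _ → tt)

    Good : VSet n → Set
    Good S = out S ≤ e S * 45

    eˣ≤e : ∀ S → cut (X ∧ˢ S) (X ∖ S) ≤ e S
    eˣ≤e S = Three.cut-split-mono Z X S X⊑Z

    -- Otherwise moving S ∖ X across the cut would make it smaller.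
    good-if : ∀ S → cut (X ∧ˢ S) (∁ X) ≤ e S * 44 → Good S
    good-if S h = linear 0 (out S ∷ ∂ Z′ ∷ ∂ Z ∷ cut (X ∧ˢ S) (∁ X) ∷ e S ∷ [])
      ((1 , x₀ ⊕ x₁ ≼ x₂ ⊕ (x₃ ⊕ x₄)) ∷ (1 , x₂ ≼ x₁) ∷ (1 , x₃ ≼ x₄ ⊗ 44) ∷ []) (x₀ ≼ x₄ ⊗ 45)
      (count-≤ {r = 7} (λ f z z′ σ σ′ x x′ → (x ⇒ᵇ z) ∧ (x′ ⇒ᵇ z′))
        ((λ f z z′ σ σ′ x x′ → link f (z ∧ σ) (z′ ∧ σ′) (not z) (not z′))
          ∷ (λ f z z′ σ σ′ x x′ → leaves f (z ∧ not (σ ∧ not x)) (z′ ∧ not (σ′ ∧ not x′))) ∷ [])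
        ((λ f z z′ σ σ′ x x′ → leaves f z z′)
          ∷ (λ f z z′ σ σ′ x x′ → link f (x ∧ σ) (x′ ∧ σ′) (not x) (not x′))
          ∷ (λ f z z′ σ σ′ x x′ → link f (z ∧ σ) (z′ ∧ σ′) (z ∧ not σ) (z′ ∧ not σ′)) ∷ [])
        (λ i → F i ∷ Z (s i) ∷ Z (d i) ∷ S (s i) ∷ S (d i) ∷ X (s i) ∷ X (d i) ∷ []) (λ i → X⊑Z (s i) & X⊑Z (d i))
      , minimum Z′
          (λ v → entails {r = 3} (λ x z σ → x ⇒ᵇ z) (λ x z σ → x ⇒ᵇ (z ∧ not (σ ∧ not x))) (X v ∷ Z v ∷ S v ∷ []) (X⊑Z v))
          (λ v → entails {r = 4} (λ x z σ y → y ⇒ᵇ not z) (λ x z σ y → y ⇒ᵇ not (z ∧ not (σ ∧ not x))) (X v ∷ Z v ∷ S v ∷ Y v ∷ []) (Y⊑∁Z v))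
      , h , tt)
      where
      Z′ : VSet n
      Z′ = Z ∖ (S ∖ X)

    dichotomy : ∀ S → e S * 16 < κ → Good S ⊎ Good (∁ S)
    dichotomy S small with unbreakable S (≤-trans (s≤s (*-monoˡ-≤ 16 (eˣ≤e S))) small)
    ... | inj₁ p = inj₁ (good-if S (≤-trans p (*-monoˡ-≤ 44 (eˣ≤e S))))
    ... | inj₂ p = inj₂ (good-if (∁ S) (≤-trans p (*-monoˡ-≤ 44 (≤-trans (eˣ≤e S) (≤-reflexive (sym (e-∁ S)))))))

    ∂Z≥12κ : κ * 12 ≤ ∂ Z
    ∂Z≥12κ = boundary≥12κ Z (≤-trans tX (t-mono X⊑Z)) (≤-trans tY (t-mono Y⊑∁Z))

    module _ (S : VSet n) (small : e S * 16 < κ) (good : Good S) where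

      ∂≤46e : ∂ (Z ∧ˢ S) ≤ e S * 46
      ∂≤46e = linear 0 (∂ (Z ∧ˢ S) ∷ e S ∷ out S ∷ []) ((1 , x₀ ≼ x₁ ⊕ x₂) ∷ (1 , x₂ ≼ x₁ ⊗ 45) ∷ []) (x₀ ≼ x₁ ⊗ 46) (≤-reflexive (∂-∧ Z S) , good , tt)

      -- Since 46/16 < 12, a good set behind a small cut cannot reach a boundary of 12κ; only the
      -- alternative t ≤ ∂ of the cut inequality remains for it.
      below : κ * 12 ≤ ∂ (Z ∧ˢ S) → ⊥
      below g = refute (e S ∷ κ ∷ ∂ (Z ∧ˢ S) ∷ [])
        ((16 , x₂ ≼ x₀ ⊗ 46) ∷ (46 , con 1 ⊕ x₀ ⊗ 16 ≼ x₁) ∷ (16 , x₁ ⊗ 12 ≼ x₂) ∷ []) (∂≤46e , small , g , tt)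

      -- Otherwise more than 12κ terminals lie on either side, the complement containing Y, and the
      -- boundary would be at least 12κ.
      half : t (Z ∧ˢ S) * 2 ≤ κ * 512
      half with t (Z ∧ˢ S) * 2 ≤? κ * 512
      ... | yes p = p
      ... | no p = ⊥-elim (below (boundary≥12κ (Z ∧ˢ S)
              (linear 1 (t (Z ∧ˢ S) ∷ κ ∷ []) ((1 , con 1 ⊕ x₁ ⊗ 512 ≼ x₀ ⊗ 2) ∷ (1 , con 1 ≼ x₁) ∷ []) (con 1 ⊕ x₁ ⊗ 12 ≼ x₀) (≰⇒> p , κ≥1 , tt))
              (≤-trans tY (t-mono {Y} {∁ (Z ∧ˢ S)} (λ v → entails {r = 3} (λ y z σ → y ⇒ᵇ not z) (λ y z σ → y ⇒ᵇ not (z ∧ σ)) (Y v ∷ Z v ∷ S v ∷ []) (Y⊑∁Z v))))))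

      t≤46e : t (Z ∧ˢ S) ≤ e S * 46
      t≤46e with t-cap (Z ∧ˢ S) half
      ... | inj₁ g = ≤-trans g ∂≤46e
      ... | inj₂ g = ⊥-elim (below g)

      u≤92e : u (Z ∧ˢ S) ≤ e S * 92
      u≤92e = linear 0 (u (Z ∧ˢ S) ∷ ∂ (Z ∧ˢ S) ∷ e S ∷ []) ((1 , x₀ ≼ x₁ ⊗ 2) ∷ (2 , x₁ ≼ x₂ ⊗ 46) ∷ []) (x₀ ≼ x₂ ⊗ 92) (u-cap (Z ∧ˢ S) half , ∂≤46e , tt)

    -- T can be routed to X with capacity a.
    Independent : ℕ → VSet n → Set
    Independent a T = ∀ S → e S * 16 < κ → Good S → # (T ∧ˢ S) ≤ e S * a

    Independent-mono : ∀ {a T T′} → T′ ⊑ T → Independent a T → Independent a T′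
    Independent-mono {T = T} {T′} h ind S sm g = ≤-trans
      (count-mono (λ v → entails {r = 3} (λ a b c → a ⇒ᵇ b) (λ a b c → (a ∧ c) ⇒ᵇ (b ∧ c)) (T′ v ∷ T v ∷ S v ∷ []) (h v)))
      (ind S sm g)

    below-T₁ : ∀ T′ → T′ ⊑ T₁ ∧ˢ Z → Independent 48 T′
    below-T₁ T′ T′⊑ S sm g = ≤-trans
      (count-mono (λ v → entails {r = 4} (λ a w z σ → a ⇒ᵇ (w ∧ z)) (λ a w z σ → (a ∧ σ) ⇒ᵇ (w ∧ (z ∧ σ))) (T′ v ∷ T₁ v ∷ Z v ∷ S v ∷ []) (T′⊑ v)))
      (≤-trans (t≤46e S sm g) (*-monoʳ-≤ (e S) (≤ᵇ⇒≤ 46 48 tt)))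

    combined : ∀ T′ T″ → Independent 48 T′ → Independent 16 T″ → ∀ S → e S * 16 < κ →
               # ((T′ ∨ˢ T″) ∧ˢ S) ≤ e S * 64 ⊎ # ((T′ ∨ˢ T″) ∖ S) ≤ e S * 64
    combined T′ T″ ind₁ ind₂ S sm with dichotomy S sm
    ... | inj₁ g = inj₁ (linear 0 (# ((T′ ∨ˢ T″) ∧ˢ S) ∷ # (T′ ∧ˢ S) ∷ # (T″ ∧ˢ S) ∷ e S ∷ [])
        ((1 , x₀ ≼ x₁ ⊕ x₂) ∷ (1 , x₁ ≼ x₃ ⊗ 48) ∷ (1 , x₂ ≼ x₃ ⊗ 16) ∷ []) (x₀ ≼ x₃ ⊗ 64)
        ( count-≤ {r = 3} trivial ((λ a b σ → (a ∨ b) ∧ σ) ∷ [])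
            ((λ a b σ → a ∧ σ) ∷ (λ a b σ → b ∧ σ) ∷ []) (λ v → T′ v ∷ T″ v ∷ S v ∷ []) (λ _ → tt)
        , ind₁ S sm g , ind₂ S sm g , tt))
    ... | inj₂ g = inj₂ (linear 0 (# ((T′ ∨ˢ T″) ∖ S) ∷ # (T′ ∖ S) ∷ # (T″ ∖ S) ∷ e (∁ S) ∷ e S ∷ [])
        ((1 , x₀ ≼ x₁ ⊕ x₂) ∷ (1 , x₁ ≼ x₃ ⊗ 48) ∷ (1 , x₂ ≼ x₃ ⊗ 16) ∷ (64 , x₃ ≼ x₄) ∷ []) (x₀ ≼ x₄ ⊗ 64)
        ( count-≤ {r = 3} trivial ((λ a b σ → (a ∨ b) ∧ not σ) ∷ [])
            ((λ a b σ → a ∧ not σ) ∷ (λ a b σ → b ∧ not σ) ∷ []) (λ v → T′ v ∷ T″ v ∷ S v ∷ []) (λ _ → tt)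
        , ind₁ (∁ S) sm′ g , ind₂ (∁ S) sm′ g , ≤-reflexive (e-∁ S) , tt))
      where
      sm′ : e (∁ S) * 16 < κ
      sm′ = ≤-trans (s≤s (≤-reflexive (cong (_* 16) (e-∁ S)))) sm

    module Blocking (a : ℕ) (a≥16 : 16 ≤ a) (T′ : VSet n) (size : # T′ < κ) (indep : Independent a T′) where

      -- A vertex of such a set outside `T′` cannot be added to `T′` without losing independence.
      Saturated : VSet n → Set
      Saturated U = e U * 16 < κ × Good U × e U * a ≤ # (T′ ∧ˢ U)

      inter≤ : ∀ S → # (T′ ∧ˢ S) ≤ # T′
      inter≤ S = count-mono (∧-⊑ˡ T′ S)

      inter-modular : ∀ U S → # (T′ ∧ˢ (U ∨ˢ S)) + # (T′ ∧ˢ (U ∧ˢ S)) ≡ # (T′ ∧ˢ U) + # (T′ ∧ˢ S)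
      inter-modular = Weight.wt-modular T′

      -- The cut size `e` is submodular and the terminal count modular, so saturation passes to the
      -- union as soon as the intersection obeys its bound.
      union : ∀ U S → Saturated U → Saturated S → Saturated (U ∨ˢ S)
      union U S (smU , gU , satU) (smS , gS , satS) = sm , good , sat
        where
        prof₂ : Fin m → Vec Bool 7
        prof₂ i = F i ∷ Z (s i) ∷ Z (d i) ∷ U (s i) ∷ U (d i) ∷ S (s i) ∷ S (d i) ∷ []
        e-sub : e (U ∨ˢ S) + e (U ∧ˢ S) ≤ e U + e S
        e-sub = count-≤ trivial
          ((λ f z z′ υ υ′ σ σ′ → link f (z ∧ (υ ∨ σ)) (z′ ∧ (υ′ ∨ σ′)) (z ∧ not (υ ∨ σ)) (z′ ∧ not (υ′ ∨ σ′)))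
            ∷ (λ f z z′ υ υ′ σ σ′ → link f (z ∧ (υ ∧ σ)) (z′ ∧ (υ′ ∧ σ′)) (z ∧ not (υ ∧ σ)) (z′ ∧ not (υ′ ∧ σ′))) ∷ [])
          ((λ f z z′ υ υ′ σ σ′ → link f (z ∧ υ) (z′ ∧ υ′) (z ∧ not υ) (z′ ∧ not υ′))
            ∷ (λ f z z′ υ υ′ σ σ′ → link f (z ∧ σ) (z′ ∧ σ′) (z ∧ not σ) (z′ ∧ not σ′)) ∷ []) prof₂ (λ _ → tt)
        out-union : out (U ∨ˢ S) ≤ out U + out S
        out-union = count-≤ trivial
          ((λ f z z′ υ υ′ σ σ′ → link f (z ∧ (υ ∨ σ)) (z′ ∧ (υ′ ∨ σ′)) (not z) (not z′)) ∷ [])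
          ((λ f z z′ υ υ′ σ σ′ → link f (z ∧ υ) (z′ ∧ υ′) (not z) (not z′))
            ∷ (λ f z z′ υ υ′ σ σ′ → link f (z ∧ σ) (z′ ∧ σ′) (not z) (not z′)) ∷ []) prof₂ (λ _ → tt)
        out-inter : out (U ∧ˢ S) ≤ out S
        out-inter = count-≤ trivial
          ((λ f z z′ υ υ′ σ σ′ → link f (z ∧ (υ ∧ σ)) (z′ ∧ (υ′ ∧ σ′)) (not z) (not z′)) ∷ [])
          ((λ f z z′ υ υ′ σ σ′ → link f (z ∧ σ) (z′ ∧ σ′) (not z) (not z′)) ∷ []) prof₂ (λ _ → tt)
        -- A large cut satisfies 16e ≥ κ > # T′. For a small one the intersection is the good side:
        -- were its complement good, ∂ Z would be below 2·45κ/16, contrary to ∂ Z ≥ 12κ.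
        inter-sat : # (T′ ∧ˢ (U ∧ˢ S)) ≤ e (U ∧ˢ S) * a
        inter-sat with e (U ∧ˢ S) * 16 <? κ
        ... | no p = ≤-trans (inter≤ (U ∧ˢ S)) (≤-trans (<⇒≤ size) (≤-trans (≮⇒≥ p) (*-monoʳ-≤ (e (U ∧ˢ S)) a≥16)))
        ... | yes p with dichotomy (U ∧ˢ S) p
        ...   | inj₁ g = indep (U ∧ˢ S) p g
        ...   | inj₂ g = ⊥-elim (refute (out (U ∧ˢ S) ∷ out (∁ (U ∧ˢ S)) ∷ ∂ Z ∷ κ ∷ e S ∷ e (U ∧ˢ S) ∷ out S ∷ e (∁ (U ∧ˢ S)) ∷ [])
                  ((16 , x₃ ⊗ 12 ≼ x₂) ∷ (16 , x₂ ≼ x₀ ⊕ x₁) ∷ (16 , x₀ ≼ x₆) ∷ (16 , x₆ ≼ x₄ ⊗ 45) ∷ (16 , x₁ ≼ x₇ ⊗ 45) ∷ (720 , x₇ ≼ x₅)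
                    ∷ (45 , con 1 ⊕ x₄ ⊗ 16 ≼ x₃) ∷ (45 , con 1 ⊕ x₅ ⊗ 16 ≼ x₃) ∷ [])
                  (∂Z≥12κ , ≤-reflexive (∂-parts Z (U ∧ˢ S)) , out-inter , gS , g , ≤-reflexive (e-∁ (U ∧ˢ S)) , smS , p , tt))
        scaled : e (U ∨ˢ S) * a + e (U ∧ˢ S) * a ≤ e U * a + e S * a
        scaled = ≤-trans (≤-reflexive (sym (*-distribʳ-+ a (e (U ∨ˢ S)) (e (U ∧ˢ S)))))
          (≤-trans (*-monoˡ-≤ a e-sub) (≤-reflexive (*-distribʳ-+ a (e U) (e S))))
        sat : e (U ∨ˢ S) * a ≤ # (T′ ∧ˢ (U ∨ˢ S))
        sat = linear 0 (e (U ∨ˢ S) * a ∷ e (U ∧ˢ S) * a ∷ e U * a ∷ e S * a ∷ # (T′ ∧ˢ (U ∨ˢ S)) ∷ # (T′ ∧ˢ (U ∧ˢ S)) ∷ # (T′ ∧ˢ U) ∷ # (T′ ∧ˢ S) ∷ [])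
          ((1 , x₀ ⊕ x₁ ≼ x₂ ⊕ x₃) ∷ (1 , x₂ ≼ x₆) ∷ (1 , x₃ ≼ x₇) ∷ (1 , x₅ ≼ x₁) ∷ (1 , x₆ ⊕ x₇ ≼ x₄ ⊕ x₅) ∷ [])
          (x₀ ≼ x₄) (scaled , satU , satS , inter-sat , ≤-reflexive (sym (inter-modular U S)) , tt)
        -- Smallness is recovered from saturation: 16e ≤ a e ≤ # T′ < κ.
        sm : e (U ∨ˢ S) * 16 < κ
        sm = ≤-trans (s≤s (≤-trans (*-monoʳ-≤ (e (U ∨ˢ S)) a≥16) (≤-trans sat (inter≤ (U ∨ˢ S))))) size
        -- If only the complement were good, the edges leaving U, S and that complement would make ∂
        -- Z less than 3·45κ/16 < 12κ.
        good : Good (U ∨ˢ S)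
        good with dichotomy (U ∨ˢ S) sm
        ... | inj₁ g = g
        ... | inj₂ g = ⊥-elim (refute (out (U ∨ˢ S) ∷ out (∁ (U ∨ˢ S)) ∷ ∂ Z ∷ κ ∷ e S ∷ e U ∷ e (U ∨ˢ S) ∷ e (∁ (U ∨ˢ S)) ∷ out U ∷ out S ∷ [])
                ((16 , x₃ ⊗ 12 ≼ x₂) ∷ (16 , x₂ ≼ x₀ ⊕ x₁) ∷ (16 , x₀ ≼ x₈ ⊕ x₉) ∷ (16 , x₈ ≼ x₅ ⊗ 45) ∷ (16 , x₉ ≼ x₄ ⊗ 45) ∷ (16 , x₁ ≼ x₇ ⊗ 45)
                  ∷ (720 , x₇ ≼ x₆) ∷ (45 , con 1 ⊕ x₄ ⊗ 16 ≼ x₃) ∷ (45 , con 1 ⊕ x₅ ⊗ 16 ≼ x₃) ∷ (45 , con 1 ⊕ x₆ ⊗ 16 ≼ x₃) ∷ [])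
                (∂Z≥12κ , ≤-reflexive (∂-parts Z (U ∨ˢ S)) , out-union , gU , gS , g , ≤-reflexive (e-∁ (U ∨ˢ S)) , smS , smU , sm , tt))

      ∅-saturated : Saturated ∅
      ∅-saturated = ≤-trans (s≤s (*-monoˡ-≤ 16 e∅)) κ≥1 , ≤-trans out-∅ z≤n , ≤-trans (*-monoˡ-≤ a e∅) z≤n
        where
        e∅ : e ∅ ≤ 0
        e∅ = count-≤ {r = 3} trivial ((λ f z z′ → link f (z ∧ false) (z′ ∧ false) (z ∧ true) (z′ ∧ true)) ∷ []) []
          (λ i → F i ∷ Z (s i) ∷ Z (d i) ∷ []) (λ _ → tt)
        out-∅ : out ∅ ≤ 0
        out-∅ = count-≤ {r = 3} trivial ((λ f z z′ → link f (z ∧ false) (z′ ∧ false) (not z) (not z′)) ∷ []) []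
          (λ i → F i ∷ Z (s i) ∷ Z (d i) ∷ []) (λ _ → tt)

      module _ (U : VSet n) (satU : Saturated U) (max : ∀ S → Saturated S → # S ≤ # U) where

        absorbs : ∀ S → Saturated S → ∀ v → T (not (U v)) → T (S v) → ⊥
        absorbs S satS v nU inS = 1+n≰n (≤-trans
          (#-strict {A = U} {U ∨ˢ S} (⊑-∨ U S) v
            (entails {r = 2} (λ a b → not a ∧ b) (λ a b → (a ∨ b) ∧ not a) (U v ∷ S v ∷ []) (nU & inS)))
          (max (U ∨ˢ S) (union U S satU satS)))

        -- Adding `v` could violate only the bound of a set that contains `v` and is saturated for
        -- `T′`; such a set lies inside the maximal `U`.
        extend : ∀ v → T (not (U v)) → Independent a (T′ ∨ˢ single v)
        extend v nU S sm g = ≤-trans bound (go (S v) refl)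
          where
          bound : # ((T′ ∨ˢ single v) ∧ˢ S) ≤ # (T′ ∧ˢ S) + ind (S v)
          bound = ≤-trans (count-≤ {r = 3} trivial ((λ a b c → (a ∨ b) ∧ c) ∷ []) ((λ a b c → a ∧ c) ∷ (λ a b c → b ∧ c) ∷ [])
              (λ w → T′ w ∷ single v w ∷ S w ∷ []) (λ _ → tt))
            (≤-reflexive (cong (# (T′ ∧ˢ S) +_) (#-single v S)))
          go : ∀ b → S v ≡ b → # (T′ ∧ˢ S) + ind b ≤ e S * a
          go false _  = ≤-trans (≤-reflexive (+-identityʳ _)) (indep S sm g)
          go true  eq with # (T′ ∧ˢ S) <? e S * a
          ... | yes p = ≤-trans (≤-reflexive (+-comm _ 1)) p
          ... | no p  = ⊥-elim (absorbs S (sm , g , ≮⇒≥ p) v nU (subst T (sym eq) tt))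

      blocking : (∀ U → Saturated U → (∀ v → T (not (U v)) → Independent a (T′ ∨ˢ single v)) → ⊥) → ⊥
      blocking k = argmax Saturated # n (λ S _ → #≤n S) (λ U sat max → k U sat (extend U sat max)) ∅ ∅-saturated

    -- If a maximal choice has fewer than κ elements, a blocking set U contains the remaining
    -- vertices of T₂ in Z. These number at most 92 e U, and 48 e U ≤ # T′, so 4κ ≤ (140/48) # T′ <
    -- 4κ.
    choose-T₂ : κ * 4 ≤ u Z → (∀ T′ → T′ ⊑ T₂ ∧ˢ Z → # T′ ≡ κ → Independent 48 T′ → ⊥) → ⊥
    choose-T₂ many k = argmax Valid # κ (λ _ v → proj₁ (proj₂ v)) at-maximum ∅
      ((λ _ → tt) , ≤-trans (≤-reflexive (#-false n)) z≤n , λ S _ _ → ≤-trans (≤-reflexive (#-false n)) z≤n)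
      where
      Valid : VSet n → Set
      Valid T′ = T′ ⊑ T₂ ∧ˢ Z × # T′ ≤ κ × Independent 48 T′
      at-maximum : ∀ T′ → Valid T′ → (∀ T″ → Valid T″ → # T″ ≤ # T′) → ⊥
      at-maximum T′ (T′⊑ , size , ind) max with # T′ <? κ
      ... | no p  = k T′ T′⊑ (≤-antisym size (≮⇒≥ p)) ind
      ... | yes p = blocking λ U (sm , g , sat) ext →
        let covered : ∀ v → T ((T₂ v ∧ Z v) ⇒ᵇ (T′ v ∨ U v))
            covered v = cover U ext v
        in refute (u Z ∷ # T′ ∷ u (Z ∧ˢ U) ∷ e U ∷ κ ∷ [])
          ((48 , x₀ ≼ x₁ ⊕ x₂) ∷ (48 , x₂ ≼ x₃ ⊗ 92) ∷ (92 , x₃ ⊗ 48 ≼ x₁) ∷ (140 , con 1 ⊕ x₁ ≼ x₄) ∷ (48 , x₄ ⊗ 4 ≼ x₀) ∷ [])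
          ( count-≤ {r = 4} (λ w z a b → (w ∧ z) ⇒ᵇ (a ∨ b)) ((λ w z a b → w ∧ z) ∷ [])
              ((λ w z a b → a) ∷ (λ w z a b → w ∧ (z ∧ b)) ∷ []) (λ v → T₂ v ∷ Z v ∷ T′ v ∷ U v ∷ []) covered
          , u≤92e U sm g , ≤-trans sat (inter≤ U) , p , many , tt)
        where
        open Blocking 48 (≤ᵇ⇒≤ 16 48 tt) T′ p ind
        cover : ∀ (U : VSet n) → (∀ v → T (not (U v)) → Independent 48 (T′ ∨ˢ single v)) → ∀ v → T ((T₂ v ∧ Z v) ⇒ᵇ (T′ v ∨ U v))
        cover U ext v with T₂ v ∧ Z v in eq | T′ v in eqT | U v in eqU
        ... | false | _     | _     = tt
        ... | true  | true  | _     = tt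
        ... | true  | false | true  = tt
        ... | true  | false | false = ⊥-elim (1+n≰n (≤-trans
                (#-strict {A = T′} {T′ ∨ˢ single v} (⊑-∨ T′ (single v)) v
                  (entails {r = 2} (λ a b → not a ∧ b) (λ a b → (a ∨ b) ∧ not a) (T′ v ∷ single v v ∷ [])
                    (subst (T ∘ not) (sym eqT) tt & single-refl v)))
                (max (T′ ∨ˢ single v) (sub , size′ , ext v (subst (T ∘ not) (sym eqU) tt)))))
          where
          sub : T′ ∨ˢ single v ⊑ T₂ ∧ˢ Z
          sub w with T′ w in eqw | v ≟ᶠ w
          ... | true  | _        = subst (λ b → T (b ⇒ᵇ (T₂ w ∧ Z w))) eqw (T′⊑ w)
          ... | false | yes refl = subst T (sym eq) tt
          ... | false | no _     = tt
          size′ : # (T′ ∨ˢ single v) ≤ κ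
          size′ = ≤-trans (#-∨ T′ (single v)) (≤-trans (≤-reflexive (trans (cong (# T′ +_) (#-single≡1 v)) (+-comm (# T′) 1))) p)

  -- Choosing the edges between the clusters

  module TwoSides (X Y Z : VSet n) (X⊑Z : X ⊑ Z) (Y⊑∁Z : Y ⊑ ∁ Z) (tX : κ * 12 < t X) (tY : κ * 12 < t Y)
                  (unbreakableX : Unbreakable X) (unbreakableY : Unbreakable Y)
                  (minimum : ∀ Z′ → X ⊑ Z′ → Y ⊑ ∁ Z′ → ∂ Z ≤ ∂ Z′) where

    X⊑∁∁Z : X ⊑ ∁ (∁ Z)
    X⊑∁∁Z v = entails {r = 2} (λ x z → x ⇒ᵇ z) (λ x z → x ⇒ᵇ not (not z)) (X v ∷ Z v ∷ []) (X⊑Z v)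

    minimum′ : ∀ W → Y ⊑ W → X ⊑ ∁ W → ∂ (∁ Z) ≤ ∂ W
    minimum′ W Y⊑W X⊑∁W = ≤-trans (≤-reflexive (∂-∁ Z)) (≤-trans
      (minimum (∁ W) X⊑∁W (λ v → entails {r = 2} (λ y w → y ⇒ᵇ w) (λ y w → y ⇒ᵇ not (not w)) (Y v ∷ W v ∷ []) (Y⊑W v)))
      (≤-reflexive (∂-∁ W)))

    module A = Side X Y Z X⊑Z Y⊑∁Z tX tY unbreakableX minimum
    module B = Side Y X (∁ Z) Y⊑∁Z X⊑∁∁Z tY tX unbreakableY minimum′

    crossing : VSet n → Fin m → Bool
    crossing W i = W (s i) xor W (d i)

    endIn : VSet n → Fin m → Fin n
    endIn W i = if W (s i) then s i else d i

    endIn-unique : ∀ W v i → T (W v) → T (incident v i) → T (crossing W i) → endIn W i ≡ v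
    endIn-unique W v i Wv inc cr with single v (s i) in eqs | single v (d i) in eqd
    ... | true | _ with single⇒≡ v (s i) (subst T (sym eqs) tt)
    ...   | refl with W (s i)
    ...     | true = refl
    endIn-unique W v i Wv inc cr | false | true with single⇒≡ v (d i) (subst T (sym eqd) tt)
    ...   | refl with W (s i) | W (d i)
    ...     | false | true = refl

    endIn-outside : ∀ W (U : VSet n) i → T (crossing W i) →
                    T (not (link true (W (s i) ∧ U (s i)) (W (d i) ∧ U (d i)) (not (W (s i))) (not (W (d i))))) → T (not (U (endIn W i)))
    endIn-outside W U i cr h with W (s i) | W (d i)
    ... | true  | false = entails {r = 1} (λ a → not (a ∧ true ∨ false)) (λ a → not a) (U (s i) ∷ []) h
    ... | false | true  = entails {r = 1} (λ a → not (a ∧ true)) (λ a → not a) (U (d i) ∷ []) h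

    Υ-size : ∀ E′ W → (∀ i → T (E′ i ⇒ᵇ crossing W i)) → # (Υ E′ W) ≤ # E′
    Υ-size E′ W cr = ≤-trans (count-mono {A = Υ E′ W} {B = λ v → anyᵇ (λ i → E′ i ∧ single (endIn W i) v)} sub)
      (≤-trans (#-any E′ (λ i → single (endIn W i)) 1 one) (≤-reflexive (*-identityʳ _)))
      where
      one : ∀ i → # (single (endIn W i)) ≤ 1
      one i = ≤-reflexive (#-single≡1 (endIn W i))
      sub : ∀ v → T (Υ E′ W v ⇒ᵇ anyᵇ (λ i → E′ i ∧ single (endIn W i) v))
      sub v with W v in eqW
      ... | false = tt
      ... | true with anyᵇ (λ i → E′ i ∧ incident v i) in eq
      ...   | false = tt
      ...   | true with anyᵇ⁻ (λ i → E′ i ∧ incident v i) (subst T (sym eq) tt)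
      ...     | i , h with T-∧⁻ (E′ i) h
      ...       | Ei , inc = anyᵇ⁺ (λ i → E′ i ∧ single (endIn W i) v) i
                    (Ei & subst (λ w → T (single w v)) (sym (endIn-unique W v i (subst T (sym eqW) tt) inc (⇒ᵇ-elim (E′ i) (cr i) Ei))) (single-refl v))

    Υ-add : ∀ E′ W j → T (crossing W j) → Υ (E′ ∨ˢ single j) W ⊑ Υ E′ W ∨ˢ single (endIn W j)
    Υ-add E′ W j cr v with W v in eqW
    ... | false = tt
    ... | true with anyᵇ (λ i → (E′ i ∨ single j i) ∧ incident v i) in eq
    ...   | false = tt
    ...   | true with anyᵇ⁻ (λ i → (E′ i ∨ single j i) ∧ incident v i) (subst T (sym eq) tt)
    ...     | i , h with T-∧⁻ (E′ i ∨ single j i) h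
    ...       | e , inc with E′ i in eqE
    ...         | true  = ∨-introˡ (anyᵇ (λ i → E′ i ∧ incident v i)) (single (endIn W j) v)
                            (anyᵇ⁺ (λ i → E′ i ∧ incident v i) i (subst T (sym eqE) tt & inc))
    ...         | false with single⇒≡ j i e
    ...           | refl = ∨-introʳ (anyᵇ (λ i → E′ i ∧ incident v i)) (single (endIn W j) v)
                            (subst (λ w → T (single w v)) (sym (endIn-unique W v j (subst T (sym eqW) tt) inc cr)) (single-refl v))

    touched : (Fin m → Bool) → VSet n → Fin m → Bool
    touched E′ W j = anyᵇ (λ v → Υ E′ W v ∧ incident v j)

    Matching : (Fin m → Bool) → Set
    Matching E′ = ∀ i j v → T (E′ i) → T (E′ j) → T (incident v i) → T (incident v j) → i ≡ j

    Valid : (Fin m → Bool) → Set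
    Valid E′ = (∀ i → T (E′ i ⇒ᵇ (F i ∧ crossing Z i))) × Matching E′ × # E′ ≤ κ
             × A.Independent 16 (Υ E′ Z) × B.Independent 16 (Υ E′ (∁ Z))

    crossing-∁ : ∀ i → T (crossing Z i) → T (crossing (∁ Z) i)
    crossing-∁ i = entails {r = 2} (λ a b → a xor b) (λ a b → not a xor not b) (Z (s i) ∷ Z (d i) ∷ [])

    -- In a maximal choice of fewer than κ edges, every edge of `F` across Z shares an end with a
    -- chosen one or has an end in the blocking set on its side. The degree bound and goodness of
    -- the blocking sets limit such edges to (186/16) # E′, which is less than 12κ.
    choose-E′ : (∀ E′ → Valid E′ → # E′ ≡ κ → ⊥) → ⊥
    choose-E′ k = argmax Valid # κ (λ _ v → proj₁ (proj₂ (proj₂ v))) at-maximum ∅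
      ( (λ _ → tt) , (λ _ _ _ ()) , ≤-trans (≤-reflexive (#-false m)) z≤n
      , (λ S _ _ → ≤-trans (empty Z S) z≤n) , (λ S _ _ → ≤-trans (empty (∁ Z) S) z≤n))
      where
      empty : ∀ W S → # (λ v → Υ ∅ W v ∧ S v) ≤ 0
      empty W S = ≤-trans (count-mono (∧-⊑ˡ (Υ ∅ W) S))
        (≤-trans (Υ-size ∅ W (λ _ → tt)) (≤-reflexive (#-false m)))
      at-maximum : ∀ E′ → Valid E′ → (∀ E″ → Valid E″ → # E″ ≤ # E′) → ⊥
      at-maximum E′ (cr , matching , size , indA , indB) max with # E′ <? κ
      ... | no p  = k E′ (cr , matching , size , indA , indB) (≤-antisym size (≮⇒≥ p))
      ... | yes p = BA.blocking λ U (smU , gU , satU) extU → BB.blocking λ V (smV , gV , satV) extV →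
        refute (∂ Z ∷ # (Υ E′ Z) ∷ # (Υ E′ (∁ Z)) ∷ A.out U ∷ B.out V ∷ A.e U ∷ B.e V ∷ # E′ ∷ κ ∷ [])
          ((16 , x₈ ⊗ 12 ≼ x₀) ∷ (16 , x₀ ≼ x₁ ⊗ 3 ⊕ (x₂ ⊗ 3 ⊕ (x₃ ⊕ x₄))) ∷ (16 , x₃ ≼ x₅ ⊗ 45) ∷ (16 , x₄ ≼ x₆ ⊗ 45)
            ∷ (45 , x₅ ⊗ 16 ≼ x₁) ∷ (45 , x₆ ⊗ 16 ≼ x₂) ∷ (93 , x₁ ≼ x₇) ∷ (93 , x₂ ≼ x₇) ∷ (186 , con 1 ⊕ x₇ ≼ x₈) ∷ [])
          ( A.∂Z≥12κ
          , ≤-trans (count-≤ {r = 9}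
              (λ f z z′ υ υ′ ν ν′ ta tb → (f ∧ (z xor z′)) ⇒ᵇ
                 (ta ∨ tb ∨ link true (z ∧ υ) (z′ ∧ υ′) (not z) (not z′) ∨ link true (not z ∧ ν) (not z′ ∧ ν′) (not (not z)) (not (not z′))))
              ((λ f z z′ υ υ′ ν ν′ ta tb → leaves f z z′) ∷ [])
              ((λ f z z′ υ υ′ ν ν′ ta tb → ta) ∷ (λ f z z′ υ υ′ ν ν′ ta tb → tb)
                ∷ (λ f z z′ υ υ′ ν ν′ ta tb → link f (z ∧ υ) (z′ ∧ υ′) (not z) (not z′))
                ∷ (λ f z z′ υ υ′ ν ν′ ta tb → link f (not z ∧ ν) (not z′ ∧ ν′) (not (not z)) (not (not z′))) ∷ [])
              (λ i → F i ∷ Z (s i) ∷ Z (d i) ∷ U (s i) ∷ U (d i) ∷ V (s i) ∷ V (d i) ∷ touched E′ Z i ∷ touched E′ (∁ Z) i ∷ [])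
              (covered U extU V extV))
              (+-mono-≤ (#-any (Υ E′ Z) incident 3 degree≤3) (+-monoˡ-≤ _ (#-any (Υ E′ (∁ Z)) incident 3 degree≤3)))
          , gU , gV , ≤-trans satU (BA.inter≤ U) , ≤-trans satV (BB.inter≤ V) , sizeA , sizeB , p , tt)
        where
        crZ : ∀ i → T (E′ i ⇒ᵇ crossing Z i)
        crZ i = entails {r = 3} (λ a f c → a ⇒ᵇ (f ∧ c)) (λ a f c → a ⇒ᵇ c) (E′ i ∷ F i ∷ crossing Z i ∷ []) (cr i)
        crW : ∀ i → T (E′ i ⇒ᵇ crossing (∁ Z) i)
        crW i with E′ i in eq
        ... | false = tt
        ... | true = crossing-∁ i (⇒ᵇ-elim (E′ i) (crZ i) (subst T (sym eq) tt))
        sizeA : # (Υ E′ Z) ≤ # E′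
        sizeA = Υ-size E′ Z crZ
        sizeB : # (Υ E′ (∁ Z)) ≤ # E′
        sizeB = Υ-size E′ (∁ Z) crW
        module BA = A.Blocking 16 ≤-refl (Υ E′ Z) (≤-trans (s≤s sizeA) p) indA
        module BB = B.Blocking 16 ≤-refl (Υ E′ (∁ Z)) (≤-trans (s≤s sizeB) p) indB
        add : ∀ j → T (F j) → T (crossing Z j) → T (not (touched E′ Z j)) → T (not (touched E′ (∁ Z) j)) →
              A.Independent 16 (Υ E′ Z ∨ˢ single (endIn Z j)) → B.Independent 16 (Υ E′ (∁ Z) ∨ˢ single (endIn (∁ Z) j)) → ⊥
        add j Fj crj noA noB iA iB = 1+n≰n (≤-trans
          (#-strict {A = E′} {E′ ∨ˢ single j} (⊑-∨ E′ (single j)) j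
            (new & fresh))
          (max (E′ ∨ˢ single j)
            ( cr′ , matching′ , size′
            , A.Independent-mono {16} (Υ-add E′ Z j crj) iA , B.Independent-mono {16} (Υ-add E′ (∁ Z) j (crossing-∁ j crj)) iB)))
          where
          end-touched : ∀ i v → T (E′ i) → T (incident v i) → T (incident v j) → ⊥
          end-touched i v Ei vi vj with Z v in eqZ
          ... | true  = contradictory (touched E′ Z j) (anyᵇ⁺ (λ v → Υ E′ Z v ∧ incident v j) v
                          ((subst T (sym eqZ) tt & anyᵇ⁺ (λ i → E′ i ∧ incident v i) i (Ei & vi)) & vj)) noA
          ... | false = contradictory (touched E′ (∁ Z) j) (anyᵇ⁺ (λ v → Υ E′ (∁ Z) v ∧ incident v j) v
                          ((subst (T ∘ not) (sym eqZ) tt & anyᵇ⁺ (λ i → E′ i ∧ incident v i) i (Ei & vi)) & vj)) noB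
          incident-end : T (incident (s j) j)
          incident-end = ∨-introˡ (single (s j) (s j)) (single (s j) (d j)) (single-refl (s j))
          fresh : T (not (E′ j))
          fresh = ¬T⇒T-not (E′ j) λ Ej → end-touched j (s j) Ej incident-end incident-end
          new : T (E′ j ∨ single j j)
          new = ∨-introʳ (E′ j) (single j j) (single-refl j)
          cr′ : ∀ i → T ((E′ i ∨ single j i) ⇒ᵇ (F i ∧ crossing Z i))
          cr′ i with E′ i in eqE | single j i in eqj
          ... | true  | _     = ⇒ᵇ-elim (E′ i) (cr i) (subst T (sym eqE) tt)
          ... | false | false = tt
          ... | false | true with single⇒≡ j i (subst T (sym eqj) tt)
          ...   | refl = Fj & crj
          origin : ∀ i → T (E′ i ∨ single j i) → T (E′ i) ⊎ j ≡ i
          origin i h with E′ i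
          ... | true  = inj₁ tt
          ... | false = inj₂ (single⇒≡ j i h)
          matching′ : Matching (E′ ∨ˢ single j)
          matching′ i i′ v hi hi′ vi vi′ with origin i hi | origin i′ hi′
          ... | inj₁ a    | inj₁ b    = matching i i′ v a b vi vi′
          ... | inj₁ a    | inj₂ refl = ⊥-elim (end-touched i v a vi vi′)
          ... | inj₂ refl | inj₁ b    = ⊥-elim (end-touched i′ v b vi′ vi)
          ... | inj₂ refl | inj₂ refl = refl
          size′ : # (E′ ∨ˢ single j) ≤ κ
          size′ = ≤-trans (#-∨ E′ (single j)) (≤-trans (≤-reflexive (trans (cong (# E′ +_) (#-single≡1 j)) (+-comm (# E′) 1))) p)
        covered : ∀ (U : VSet n) → (∀ v → T (not (U v)) → A.Independent 16 (Υ E′ Z ∨ˢ single v)) →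
                  ∀ (V : VSet n) → (∀ v → T (not (V v)) → B.Independent 16 (Υ E′ (∁ Z) ∨ˢ single v)) → ∀ j →
                  T ((F j ∧ crossing Z j) ⇒ᵇ (touched E′ Z j ∨ touched E′ (∁ Z) j
                    ∨ link true (Z (s j) ∧ U (s j)) (Z (d j) ∧ U (d j)) (not (Z (s j))) (not (Z (d j)))
                    ∨ link true (not (Z (s j)) ∧ V (s j)) (not (Z (d j)) ∧ V (d j)) (not (not (Z (s j)))) (not (not (Z (d j))))))
        covered U extU V extV j with T? (F j ∧ crossing Z j)
        ... | no h = absurd (F j ∧ crossing Z j) h
          where
          absurd : ∀ b {c} → ¬ T b → T (b ⇒ᵇ c)
          absurd true  k = ⊥-elim (k tt)
          absurd false k = tt
        ... | yes h = by-contradiction (F j ∧ crossing Z j) (touched E′ Z j) (touched E′ (∁ Z) j)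
                (link true (Z (s j) ∧ U (s j)) (Z (d j) ∧ U (d j)) (not (Z (s j))) (not (Z (d j))))
                (link true (not (Z (s j)) ∧ V (s j)) (not (Z (d j)) ∧ V (d j)) (not (not (Z (s j)))) (not (not (Z (d j)))))
                λ a b c e → add j (proj₁ (T-∧⁻ (F j) h)) (proj₂ (T-∧⁻ (F j) h)) a b
                  (extU _ (endIn-outside Z U j (proj₂ (T-∧⁻ (F j) h)) c))
                  (extV _ (endIn-outside (∁ Z) V j (crossing-∁ j (proj₂ (T-∧⁻ (F j) h))) e))
          where
          by-contradiction : ∀ f a b c e → (T (not a) → T (not b) → T (not c) → T (not e) → ⊥) → T (f ⇒ᵇ (a ∨ b ∨ c ∨ e))
          by-contradiction false _ _ _ _ _ = tt
          by-contradiction true true  _ _ _ _ = tt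
          by-contradiction true false true _ _ _ = tt
          by-contradiction true false false true _ _ = tt
          by-contradiction true false false false true _ = tt
          by-contradiction true false false false false k = k tt tt tt tt

    cut≤internal : ∀ W S → cut (W ∧ˢ S) (W ∖ S) ≤ internal W S
    cut≤internal W S = count-≤ {r = 5} trivial
      ((λ f z z′ σ σ′ → link f (z ∧ σ) (z′ ∧ σ′) (z ∧ not σ) (z′ ∧ not σ′)) ∷ [])
      ((λ f z z′ σ σ′ → (z ∧ z′) ∧ (σ xor σ′)) ∷ []) (λ i → F i ∷ W (s i) ∷ W (d i) ∷ S (s i) ∷ S (d i) ∷ []) (λ _ → tt)

    routable : ∀ W T′ → (∀ S → cut (W ∧ˢ S) (W ∖ S) * 16 < κ →
                 # (T′ ∧ˢ S) ≤ cut (W ∧ˢ S) (W ∖ S) * 64 ⊎ # (T′ ∖ S) ≤ cut (W ∧ˢ S) (W ∖ S) * 64) → Routable W T′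
    routable W T′ h S with cut (W ∧ˢ S) (W ∖ S) * 16 <? κ
    ... | no p = inj₁ (≤-trans (≮⇒≥ p) (*-monoˡ-≤ 16 (cut≤internal W S)))
    ... | yes p with h S p
    ...   | inj₁ g = inj₂ (inj₁ (≤-trans g (*-monoˡ-≤ 64 (cut≤internal W S))))
    ...   | inj₂ g = inj₂ (inj₂ (≤-trans g (*-monoˡ-≤ 64 (cut≤internal W S))))

  chain : ¬ (∀ X Y T′ T″ E′ → ¬ Chain X Y T′ T″ E′)
  chain k = robust-exists λ A adm robust →
    core A (proj₁ (robust-∁ A adm robust)) robust λ X X⊑A tX unbX →
    core (∁ A) (≤-trans (proj₁ robust) (t-mono {A} {∁ (∁ A)} (λ v → tautology {r = 1} (λ a → a ⇒ᵇ not (not a)) (A v ∷ []))))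
      (robust-∁ A adm robust) λ Y Y⊑∁A tY unbY →
    argmin (λ Z → X ⊑ Z × Y ⊑ ∁ Z) ∂ (λ Z (X⊑Z , Y⊑∁Z) min →
      assemble X Y Z X⊑Z Y⊑∁Z tX tY unbX unbY (λ Z′ h h′ → min Z′ (h , h′))) A (X⊑A , Y⊑∁A)
    where
    assemble : (X Y Z : VSet n) (X⊑Z : X ⊑ Z) (Y⊑∁Z : Y ⊑ ∁ Z) (tX : κ * 12 < t X) (tY : κ * 12 < t Y) →
             Unbreakable X → Unbreakable Y → (∀ Z′ → X ⊑ Z′ → Y ⊑ ∁ Z′ → ∂ Z ≤ ∂ Z′) → ⊥
    assemble X Y Z X⊑Z Y⊑∁Z tX tY unbX unbY min = choose-E′ λ E′ (cr , matching , _ , indA , indB) size → sides E′ cr matching indA indB size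
      where
      open TwoSides X Y Z X⊑Z Y⊑∁Z tX tY unbX unbY min
      8κ≤ : ∀ W → κ * 12 < t W → κ * 8 ≤ # (T₁ ∧ˢ W)
      8κ≤ W h = linear 0 (κ ∷ t W ∷ []) ((1 , con 1 ⊕ x₀ ⊗ 12 ≼ x₁) ∷ []) (x₀ ⊗ 8 ≼ x₁) (h , tt)
      sides : ∀ E′ → (∀ i → T (E′ i ⇒ᵇ (F i ∧ crossing Z i))) → Matching E′ →
              A.Independent 16 (Υ E′ Z) → B.Independent 16 (Υ E′ (∁ Z)) → # E′ ≡ κ → ⊥
      -- At least half of the 8κ vertices of T₂ lie on one side of Z; that side becomes the cluster
      -- Y.
      sides E′ cr matching indA indB size with κ * 4 ≤? u Z | take (T₁ ∧ˢ Z) (κ * 8) (8κ≤ Z (≤-trans tX (t-mono X⊑Z)))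
                                          | take (T₁ ∧ˢ ∁ Z) (κ * 8) (8κ≤ (∁ Z) (≤-trans tY (t-mono Y⊑∁Z)))
      ... | yes p | _ | T′ , T′⊑ , c = A.choose-T₂ p λ T″ T″⊑ size₂ ind₂ → k (∁ Z) Z T′ T″ E′ record
        { X∩Y=∅ = λ v → tautology {r = 1} (λ z → not (not z ∧ z)) (Z v ∷ [])
        ; T̃₁⊑ = T′⊑ ; T̃₂⊑ = T″⊑ ; #T̃₁ = c ; #T̃₂ = size₂ ; #E′ = size
        ; E′-crosses = λ i → entails {r = 4} (λ a f z z′ → a ⇒ᵇ (f ∧ (z xor z′)))
            (λ a f z z′ → a ⇒ᵇ (not z ∧ z′ ∨ not z′ ∧ z)) (E′ i ∷ F i ∷ Z (s i) ∷ Z (d i) ∷ []) (cr i)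
        ; E′-match = matching
        ; X-routable = routable (∁ Z) (T′ ∨ˢ Υ E′ (∁ Z)) (B.combined T′ (Υ E′ (∁ Z)) (B.below-T₁ T′ T′⊑) indB)
        ; Y-routable = routable Z (T″ ∨ˢ Υ E′ Z) (A.combined T″ (Υ E′ Z) ind₂ indA)
        }
      ... | no p | T′ , T′⊑ , c | _ = B.choose-T₂ other λ T″ T″⊑ size₂ ind₂ → k Z (∁ Z) T′ T″ E′ record
        { X∩Y=∅ = λ v → tautology {r = 1} (λ z → not (z ∧ not z)) (Z v ∷ [])
        ; T̃₁⊑ = T′⊑ ; T̃₂⊑ = T″⊑ ; #T̃₁ = c ; #T̃₂ = size₂ ; #E′ = size
        ; E′-crosses = λ i → entails {r = 4} (λ a f z z′ → a ⇒ᵇ (f ∧ (z xor z′)))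
            (λ a f z z′ → a ⇒ᵇ (z ∧ not z′ ∨ z′ ∧ not z)) (E′ i ∷ F i ∷ Z (s i) ∷ Z (d i) ∷ []) (cr i)
        ; E′-match = matching
        ; X-routable = routable Z (T′ ∨ˢ Υ E′ Z) (A.combined T′ (Υ E′ Z) (A.below-T₁ T′ T′⊑) indA)
        ; Y-routable = routable (∁ Z) (T″ ∨ˢ Υ E′ (∁ Z)) (B.combined T″ (Υ E′ (∁ Z)) ind₂ indB)
        }
        where
        other : κ * 4 ≤ u (∁ Z)
        other = linear 0 (u Z ∷ u (∁ Z) ∷ κ ∷ []) ((1 , con 1 ⊕ x₀ ≼ x₂ ⊗ 4) ∷ (1 , x₂ ⊗ 8 ≼ x₀ ⊕ x₁) ∷ []) (x₂ ⊗ 4 ≼ x₁)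
          (≰⇒> p , ≤-reflexive (sym (trans (u-∁ Z) u-full)) , tt)

module _ {n m : ℕ} (s d : Fin m → Fin n) (T₁ T₂ : VSet n) (κ : ℕ) where
  open Terminals s d T₁ T₂ κ

  chain-exists : 1 ≤ κ → t full ≡ κ * 512 → u full ≡ κ * 8 → (∀ v → # (incident v) ≤ 3) → WellCut full →
                 ¬ (∀ X Y T′ T″ E′ → ¬ Chain X Y T′ T″ E′)
  chain-exists κ≥1 t-full u-full degree≤3 wellcut k = argmin WellCut #
    (λ F wellcutF minimal → Clusters.chain s d T₁ T₂ κ κ≥1 t-full u-full degree≤3 F wellcutF minimal k) full wellcut

-- Integral flows

∑ : ∀ {n} → (Fin n → ℕ) → ℕ
∑ {zero}  f = 0
∑ {suc n} f = f zero + ∑ (f ∘ suc)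

∑-mono : ∀ {n} {f g : Fin n → ℕ} → (∀ i → f i ≤ g i) → ∑ f ≤ ∑ g
∑-mono {zero}  h = z≤n
∑-mono {suc n} h = +-mono-≤ (h zero) (∑-mono (h ∘ suc))

∑-+ : ∀ {n} (f g : Fin n → ℕ) → ∑ (λ i → f i + g i) ≡ ∑ f + ∑ g
∑-+ {zero}  f g = refl
∑-+ {suc n} f g = trans (cong (f zero + g zero +_) (∑-+ (f ∘ suc) (g ∘ suc))) (+-interchange (f zero) (g zero) _ _)

∑-zero : ∀ n → ∑ {n} (λ _ → 0) ≡ 0
∑-zero zero    = refl
∑-zero (suc n) = ∑-zero n

∑-single : ∀ {n} (i : Fin n) k → ∑ (λ j → if single i j then k else 0) ≡ k
∑-single {suc n} zero    k = trans (cong (k +_) (∑-zero n)) (+-identityʳ k)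
∑-single         (suc i) k = ∑-single i k

∑-cong : ∀ {n} {f g : Fin n → ℕ} → (∀ i → f i ≡ g i) → ∑ f ≡ ∑ g
∑-cong h = ≤-antisym (∑-mono (≤-reflexive ∘ h)) (∑-mono (≤-reflexive ∘ sym ∘ h))

∑-scale : ∀ {n} (p : VSet n) k → ∑ (λ i → if p i then k else 0) ≡ # p * k
∑-scale {zero}  p k = refl
∑-scale {suc n} p k with p zero
... | true  = cong (k +_) (∑-scale (p ∘ suc) k)
... | false = ∑-scale (p ∘ suc) k

∑-at : ∀ {n} (f g : Fin n → ℕ) i a b →
       (∀ j → f j + (if single i j then a else 0) ≡ g j + (if single i j then b else 0)) → ∑ f + a ≡ ∑ g + b
∑-at f g i a b h = trans (cong (∑ f +_) (sym (∑-single i a)))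
  (trans (sym (∑-+ f _)) (trans (∑-cong h) (trans (∑-+ g _) (cong (∑ g +_) (∑-single i b)))))

module Flows {G : Graph} (H : Subgraph G) where
  open Graph G
  open Subgraph H using (vertices; edges)

  n m : ℕ
  n = order
  m = size

  s d : Fin m → Fin n
  s e = proj₁ (ends e)
  d e = proj₂ (ends e)

  tail head : Fin m → Bool → Fin n
  tail e true  = s e
  tail e false = d e
  head e true  = d e
  head e false = s e

  available : Fin m → Bool
  available = lookup edges

  Arc : Set
  Arc = Fin m × Bool

  arcs : ∀ {u v} → Walk H u v → List Arc
  arcs (stop _)                = []
  arcs (step e _ (inj₁ _) w) = (e , true) ∷ arcs w
  arcs (step e _ (inj₂ _) w) = (e , false) ∷ arcs w

  edgesOf : List Arc → List (Fin m)
  edgesOf = List.map proj₁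

  edges-arcs : ∀ {u v} (w : Walk H u v) → edgesOf (arcs w) ≡ walkEdges H w
  edges-arcs (stop _) = refl
  edges-arcs (step e _ (inj₁ _) w) = cong (e ∷_) (edges-arcs w)
  edges-arcs (step e _ (inj₂ _) w) = cong (e ∷_) (edges-arcs w)

  source∈ : ∀ {u v} (w : Walk H u v) → u ∈ˡ walkVertices H w
  source∈ (stop _)       = here refl
  source∈ (step _ _ _ w) = here refl

  ends∈ : ∀ {u v} (w : Walk H u v) {e} → e ∈ˡ edgesOf (arcs w) → s e ∈ˡ walkVertices H w × d e ∈ˡ walkVertices H w
  ends∈ (step e _ (inj₁ refl) w) (here refl) = here refl , there (source∈ w)
  ends∈ (step e _ (inj₂ refl) w) (here refl) = there (source∈ w) , here refl
  ends∈ (step e _ (inj₁ _) w) (there p) = there (proj₁ (ends∈ w p)) , there (proj₂ (ends∈ w p))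
  ends∈ (step e _ (inj₂ _) w) (there p) = there (proj₁ (ends∈ w p)) , there (proj₂ (ends∈ w p))

  fresh : ∀ {A : Set} {x : A} {xs : List A} → All (x ≢_) xs → x ∈ˡ xs → ⊥
  fresh (p ∷ _)  (here eq) = p eq
  fresh (_ ∷ ps) (there q) = fresh ps q

  ∉⇒All≢ : ∀ {A : Set} {x : A} (xs : List A) → (x ∈ˡ xs → ⊥) → All (x ≢_) xs
  ∉⇒All≢ []       h = []
  ∉⇒All≢ (y ∷ ys) h = (λ eq → h (here eq)) ∷ ∉⇒All≢ ys (h ∘ there)

  unique-edges : ∀ {u v} (w : Walk H u v) → Unique (walkVertices H w) → Unique (edgesOf (arcs w))
  unique-edges (stop _) _ = []
  unique-edges (step e _ (inj₁ refl) w) (p ∷ ps) = ∉⇒All≢ _ (λ q → fresh p (proj₁ (ends∈ w q))) ∷ unique-edges w ps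
  unique-edges (step e _ (inj₂ refl) w) (p ∷ ps) = ∉⇒All≢ _ (λ q → fresh p (proj₂ (ends∈ w q))) ∷ unique-edges w ps

  -- Search for simple paths

  module Reach (ok : Fin m → Bool → Bool) (ok⇒available : ∀ e b → T (ok e b) → T (available e))
               (A B : VSet n) (B⊑ : ∀ v → T (B v) → v ∈ vertices) where

    -- `within` confines the walk to the explored set, so a newly reached vertex can be put in front
    -- without destroying simplicity.
    record Route (R : VSet n) (u : Fin n) : Set where
      field
        end    : Fin n
        end∈B  : T (B end)
        walk   : Walk H u end
        simple : Unique (walkVertices H walk)
        allOk  : All (λ (e , b) → T (ok e b)) (arcs walk)
        within : All (λ v → T (R v)) (walkVertices H walk)
    open Route

    Closed : VSet n → Set
    Closed S = ∀ e b → T (ok e b) → T (S (tail e b)) → T (S (head e b))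

    Outcome : Set
    Outcome = (∃ λ u → T (A u) × Route full u) ⊎ (∃ λ S → A ⊑ S × Disj S B × Closed S)

    widen : ∀ {R R′ u} → R ⊑ R′ → Route R u → Route R′ u
    widen R⊑ r = record { end = end r ; end∈B = end∈B r ; walk = walk r ; simple = simple r ; allOk = allOk r
                        ; within = All.map (λ {v} → ⇒ᵇ-elim _ (R⊑ v)) (within r) }

    extendRoute : ∀ R e b → T (ok e b) → T (not (R (tail e b))) → Route R (head e b) → Route (R ∨ˢ single (tail e b)) (tail e b)
    extendRoute R e b k out r = record
      { end = end r ; end∈B = end∈B r ; walk = longer b k (walk r)
      ; simple = simple′ b k out (walk r) (within r) (simple r)
      ; allOk = allOk′ b k (walk r) (allOk r)
      ; within = within′ b k (walk r) (within r) }
      where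
      e∈ : ∀ b → T (ok e b) → e ∈ edges
      e∈ b k = lookup⇒[]= e edges (T⇒≡ (ok⇒available e b k))
      longer : ∀ b → T (ok e b) → ∀ {t} → Walk H (head e b) t → Walk H (tail e b) t
      longer true  k w = step e (e∈ true k) (inj₁ refl) w
      longer false k w = step e (e∈ false k) (inj₂ refl) w
      allOk′ : ∀ b k {t} (w : Walk H (head e b) t) → All (λ (e , b) → T (ok e b)) (arcs w) → All (λ (e , b) → T (ok e b)) (arcs (longer b k w))
      allOk′ true  k w h = k ∷ h
      allOk′ false k w h = k ∷ h
      notIn : ∀ {v} → T (not (R v)) → ∀ {xs} → All (λ v → T (R v)) xs → All (v ≢_) xs
      notIn nv []       = []
      notIn nv (p ∷ ps) = (λ { refl → contradictory _ p nv }) ∷ notIn nv ps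
      simple′ : ∀ b k → T (not (R (tail e b))) → ∀ {t} (w : Walk H (head e b) t) → All (λ v → T (R v)) (walkVertices H w) →
                Unique (walkVertices H w) → Unique (walkVertices H (longer b k w))
      simple′ true  k out w h q = notIn out h ∷ q
      simple′ false k out w h q = notIn out h ∷ q
      old : ∀ w v → T (R v) → T (R v ∨ single w v)
      old w v h = ∨-introˡ (R v) (single w v) h
      new : ∀ v → T (R v ∨ single v v)
      new v = ∨-introʳ (R v) (single v v) (single-refl v)
      within′ : ∀ b k {t} (w : Walk H (head e b) t) → All (λ v → T (R v)) (walkVertices H w) →
                All (λ v → T (R v ∨ single (tail e b) v)) (walkVertices H (longer b k w))
      within′ true  k w h = new (s e) ∷ All.map (λ {v} → old (s e) v) h
      within′ false k w h = new (d e) ∷ All.map (λ {v} → old (d e) v) h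

    frontier : VSet n → Fin m → Bool → Bool
    frontier R e b = ok e b ∧ (R (head e b) ∧ not (R (tail e b)))

    -- The search runs backwards from `B`, and `k` bounds the number of vertices still unexplored.
    -- When no arc enters the explored set, its complement is closed under `ok`.
    search : ∀ k (R : VSet n) → n ≤ # R + k → B ⊑ R → (∀ u → T (R u) → Route R u) → Outcome
    grow   : ∀ k (R : VSet n) → n ≤ # R + k → B ⊑ R → (∀ u → T (R u) → Route R u) → ∀ e b → T (frontier R e b) → Outcome

    search k R fuel B⊑R route with any? (λ e → T? (frontier R e true) ⊎-dec T? (frontier R e false))
    ... | yes (e , inj₁ p) = grow k R fuel B⊑R route e true p
    ... | yes (e , inj₂ p) = grow k R fuel B⊑R route e false p
    ... | no stuck with any? (λ v → T? (A v ∧ R v))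
    ...   | yes (v , p) = inj₁ (v , proj₁ (T-∧⁻ (A v) p)
                          , widen (⊑-full R) (route v (proj₂ (T-∧⁻ (A v) p))))
    ...   | no missed = inj₂ (∁ R , avoids , disjoint , closed)
      where
      avoids : A ⊑ ∁ R
      avoids v = entails {r = 2} (λ a b → not (a ∧ b)) (λ a b → a ⇒ᵇ not b) (A v ∷ R v ∷ [])
        (¬T⇒T-not (A v ∧ R v) (λ p → missed (v , p)))
      disjoint : Disj (∁ R) B
      disjoint v = entails {r = 2} (λ a b → a ⇒ᵇ b) (λ a b → not (not b ∧ a)) (B v ∷ R v ∷ []) (B⊑R v)
      no-frontier : ∀ e b → ¬ T (frontier R e b)
      no-frontier e true  p = stuck (e , inj₁ p)
      no-frontier e false p = stuck (e , inj₂ p)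
      closed : Closed (∁ R)
      closed e b o out = entails {r = 3} (λ o h t → (o ∧ not t) ∧ not (o ∧ (h ∧ not t))) (λ o h t → not h)
        (ok e b ∷ R (head e b) ∷ R (tail e b) ∷ []) ((o & out) & ¬T⇒T-not (frontier R e b) (no-frontier e b))

    grow k R fuel B⊑R route e b p = next k fuel
      where
      o : T (ok e b)
      o = proj₁ (T-∧⁻ (ok e b) p)
      h : T (R (head e b))
      h = proj₁ (T-∧⁻ (R (head e b)) (proj₂ (T-∧⁻ (ok e b) p)))
      out : T (not (R (tail e b)))
      out = proj₂ (T-∧⁻ (R (head e b)) (proj₂ (T-∧⁻ (ok e b) p)))
      R′ : VSet n
      R′ = R ∨ˢ single (tail e b)
      R⊑R′ : R ⊑ R′
      R⊑R′ = ⊑-∨ R (single (tail e b))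
      bigger : # R < # R′
      bigger = #-strict {A = R} {R′} R⊑R′ (tail e b)
        (entails {r = 2} (λ a b → not a ∧ b) (λ a b → (a ∨ b) ∧ not a) (R (tail e b) ∷ single (tail e b) (tail e b) ∷ []) (out & single-refl (tail e b)))
      route′ : ∀ u → T (R′ u) → Route R′ u
      route′ u h′ with R u in eq
      ... | true  = widen R⊑R′ (route u (subst T (sym eq) tt))
      ... | false with single⇒≡ (tail e b) u h′
      ...   | refl = extendRoute R e b o out (route (head e b) h)
      next : ∀ k → n ≤ # R + k → Outcome
      next zero    fuel = ⊥-elim (1+n≰n (≤-trans bigger (≤-trans (#≤n R′) (≤-trans fuel (≤-reflexive (+-identityʳ (# R)))))))
      next (suc k) fuel = search k R′ (≤-trans fuel (≤-trans (≤-reflexive (+-suc (# R) k)) (+-monoˡ-≤ k bigger)))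
        (λ v → entails {r = 3} (λ a b c → a ⇒ᵇ b) (λ a b c → a ⇒ᵇ (b ∨ c)) (B v ∷ R v ∷ single (tail e b) v ∷ []) (B⊑R v)) route′

    reach : Outcome
    reach = search n B (m≤n+m n (# B)) (⊑-refl B) λ u h → record
      { end = u ; end∈B = h ; walk = stop (B⊑ u h) ; simple = [] ∷ [] ; allOk = [] ; within = h ∷ [] }

  -- Amounts of flow along an edge in its two directions.
  Amounts : Set
  Amounts = Fin m → ℕ × ℕ

  along : ℕ × ℕ → Bool → Bool → ℕ
  along (p , q) a b = (if a then p else 0) + (if b then q else 0)

  -- Flow on an edge inside `S` counts equally in both, so only their difference matters; the
  -- balance equations below place the two on opposite sides to stay in ℕ.
  outflow inflow : Amounts → VSet n → ℕ
  outflow x S = ∑ λ e → along (x e) (S (s e)) (S (d e))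
  inflow  x S = ∑ λ e → along (x e) (S (d e)) (S (s e))

  net : ∀ p q p′ q′ → p′ + q ≡ suc (p + q′) → p′ + 0 + (q + 0) ≡ q′ + (p + 0 + 1)
  net p q p′ q′ h = trans (left p′ q) (trans h (right p q′))
    where
    left : ∀ a b → a + 0 + (b + 0) ≡ a + b
    left = solve-∀
    right : ∀ a b → suc (a + b) ≡ b + (a + 0 + 1)
    right = solve-∀

  along-net : ∀ p q p′ q′ → p′ + q ≡ suc (p + q′) → ∀ a b →
              along (p′ , q′) a b + (along (p , q) b a + ind b) ≡ along (p′ , q′) b a + (along (p , q) a b + ind a)
  along-net p q p′ q′ h true  true  = refl
  along-net p q p′ q′ h true  false = net p q p′ q′ h
  along-net p q p′ q′ h false true  = sym (net p q p′ q′ h)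
  along-net p q p′ q′ h false false = refl

  -- x′ arises from x by sending one more unit from u to v.
  Sends : Amounts → Amounts → Fin n → Fin n → Set
  Sends x x′ u v = ∀ S → outflow x′ S + (inflow x S + ind (S v)) ≡ inflow x′ S + (outflow x S + ind (S u))

  sends-refl : ∀ x v → Sends x x v v
  sends-refl x v S = +-swap (outflow x S) (inflow x S) (ind (S v))

  sends-trans : ∀ {x y z u v w} → Sends x y u v → Sends y z v w → Sends x z u w
  sends-trans {x} {y} {z} {u} {v} {w} p q S = +-cancelʳ-≡ (outflow y S + (inflow y S + ind (S v))) _ _
    (trans (regroup (outflow z S) (inflow x S) (ind (S w)) (outflow y S) (inflow y S) (ind (S v)))
      (trans (cong₂ _+_ (q S) (p S)) (regroup′ (inflow z S) (outflow y S) (ind (S v)) (inflow y S) (outflow x S) (ind (S u)))))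
    where
    regroup : ∀ a b c d e f → a + (b + c) + (d + (e + f)) ≡ a + (e + c) + (d + (b + f))
    regroup = solve-∀
    regroup′ : ∀ a b c d e f → a + (b + c) + (d + (e + f)) ≡ a + (e + f) + (b + (d + c))
    regroup′ = solve-∀

  -- The later change leads into the start of the earlier one, as happens when a path is emptied
  -- beginning with its first arc.
  sends-trans′ : ∀ {x y z u v w} → Sends x y v w → Sends y z u v → Sends x z u w
  sends-trans′ {x} {y} {z} {u} {v} {w} p q S = +-cancelʳ-≡ (outflow y S + (inflow y S + ind (S v))) _ _
    (trans (regroup (outflow z S) (inflow x S) (ind (S w)) (outflow y S) (inflow y S) (ind (S v)))
      (trans (cong₂ _+_ (q S) (p S)) (regroup′ (inflow z S) (outflow y S) (ind (S u)) (inflow y S) (outflow x S) (ind (S v)))))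
    where
    regroup : ∀ a b c d e f → a + (b + c) + (d + (e + f)) ≡ a + (e + f) + (d + (b + c))
    regroup = solve-∀
    regroup′ : ∀ a b c d e f → a + (b + c) + (d + (e + f)) ≡ a + (e + c) + (b + (d + f))
    regroup′ = solve-∀

  update : Amounts → Fin m → ℕ × ℕ → Amounts
  update x e y e′ = if single e e′ then y else x e′

  update-other : ∀ x e y e′ → e ≢ e′ → update x e y e′ ≡ x e′
  update-other x e y e′ h with single e e′ in eq
  ... | true  = ⊥-elim (h (single⇒≡ e e′ (subst T (sym eq) tt)))
  ... | false = refl

  sends-at : ∀ x e y u v →
             (∀ S → along y (S (s e)) (S (d e)) + (along (x e) (S (d e)) (S (s e)) + ind (S v))
                  ≡ along y (S (d e)) (S (s e)) + (along (x e) (S (s e)) (S (d e)) + ind (S u))) →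
             Sends x (update x e y) u v
  sends-at x e y u v h S =
    trans (sym (+-assoc (outflow x′ S) (inflow x S) (ind (S v))))
      (trans (cong (_+ ind (S v)) (sym (∑-+ o′ i)))
        (trans (∑-at (λ j → o′ j + i j) (λ j → i′ j + o j) e (ind (S v)) (ind (S u)) pointwise)
          (trans (cong (_+ ind (S u)) (∑-+ i′ o)) (+-assoc (inflow x′ S) (outflow x S) (ind (S u))))))
    where
    x′ : Amounts
    x′ = update x e y
    o i o′ i′ : Fin m → ℕ
    o j = along (x j) (S (s j)) (S (d j))
    i j = along (x j) (S (d j)) (S (s j))
    o′ j = along (x′ j) (S (s j)) (S (d j))
    i′ j = along (x′ j) (S (d j)) (S (s j))
    pointwise : ∀ j → o′ j + i j + (if single e j then ind (S v) else 0) ≡ i′ j + o j + (if single e j then ind (S u) else 0)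
    pointwise j with single e j in eq
    ... | false = cong (_+ 0) (+-comm (o j) (i j))
    ... | true with single⇒≡ e j (subst T (sym eq) tt)
    ...   | refl = trans (+-assoc (along y (S (s e)) (S (d e))) _ _) (trans (h S) (sym (+-assoc (along y (S (d e)) (S (s e))) _ _)))

  -- The hypothesis reads p′ - q′ = p - q + 1 and covers both adding forward flow and cancelling
  -- backward flow.
  sends-forward : ∀ x e p′ q′ → p′ + proj₂ (x e) ≡ suc (proj₁ (x e) + q′) → Sends x (update x e (p′ , q′)) (s e) (d e)
  sends-forward x e p′ q′ h = sends-at x e (p′ , q′) (s e) (d e) λ S →
    along-net (proj₁ (x e)) (proj₂ (x e)) p′ q′ h (S (s e)) (S (d e))

  sends-backward : ∀ x e p′ q′ → proj₁ (x e) + q′ ≡ suc (p′ + proj₂ (x e)) → Sends x (update x e (p′ , q′)) (d e) (s e)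
  sends-backward x e p′ q′ h = sends-at x e (p′ , q′) (d e) (s e) λ S →
    trans (+-swap (along (p′ , q′) (S (s e)) (S (d e))) (along (x e) (S (d e)) (S (s e))) (ind (S (s e))))
      (trans (sym (along-net p′ q′ (proj₁ (x e)) (proj₂ (x e)) h (S (s e)) (S (d e))))
        (+-swap (along (x e) (S (s e)) (S (d e))) (along (p′ , q′) (S (d e)) (S (s e))) (ind (S (d e)))))

  -- `op` changes one edge and `ok` is its precondition. The same traversal serves for augmenting a
  -- flow and for removing a path from it.
  module Run (op : ℕ × ℕ → Bool → ℕ × ℕ) (ok : Fin m → ℕ × ℕ → Bool → Bool) where

    run : Amounts → List Arc → Amounts
    run x []             = x
    run x ((e , b) ∷ as) = run (update x e (op (x e) b)) as

    Ok : Amounts → Arc → Set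
    Ok x (e , b) = T (ok e (x e) b)

    -- The edges of a simple path are distinct, so changing one leaves the preconditions of the
    -- later ones intact.
    persists : ∀ x e y as → All (e ≢_) (edgesOf as) → All (Ok x) as → All (Ok (update x e y)) as
    persists x e y []              _        _        = []
    persists x e y ((e′ , b) ∷ as) (h ∷ hs) (k ∷ ks) =
      subst (λ z → T (ok e′ z b)) (sym (update-other x e y e′ h)) k ∷ persists x e y as hs ks

    run-invariant : (I : Fin m → ℕ × ℕ → Set) → (∀ e y b → I e y → T (ok e y b) → I e (op y b)) →
                    ∀ x as → Unique (edgesOf as) → All (Ok x) as → (∀ e → I e (x e)) → ∀ e → I e (run x as e)
    run-invariant I preserves x []             _        _        inv = inv
    run-invariant I preserves x ((e , b) ∷ as) (h ∷ hs) (k ∷ ks) inv =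
      run-invariant I preserves (update x e (op (x e) b)) as hs (persists x e (op (x e) b) as h ks) inv′
      where
      inv′ : ∀ e′ → I e′ (update x e (op (x e) b) e′)
      inv′ e′ with single e e′ in eq
      ... | false = inv e′
      ... | true with single⇒≡ e e′ (subst T (sym eq) tt)
      ...   | refl = preserves e (x e) b (inv e) k

    run-sends : (∀ x e b → T (ok e (x e) b) → Sends x (update x e (op (x e) b)) (tail e b) (head e b)) →
                ∀ x {u v} (w : Walk H u v) → Unique (edgesOf (arcs w)) → All (Ok x) (arcs w) → Sends x (run x (arcs w)) u v
    run-sends sends x (stop {v} _) _ _ = sends-refl x v
    run-sends sends x (step e _ (inj₁ refl) w) (h ∷ hs) (k ∷ ks) =
      sends-trans {x} {update x e (op (x e) true)} {run (update x e (op (x e) true)) (arcs w)} (sends x e true k)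
        (run-sends sends _ w hs (persists x e (op (x e) true) (arcs w) h ks))
    run-sends sends x (step e _ (inj₂ refl) w) (h ∷ hs) (k ∷ ks) =
      sends-trans {x} {update x e (op (x e) false)} {run (update x e (op (x e) false)) (arcs w)} (sends x e false k)
        (run-sends sends _ w hs (persists x e (op (x e) false) (arcs w) h ks))

    run-returns : (∀ x e b → T (ok e (x e) b) → Sends x (update x e (op (x e) b)) (head e b) (tail e b)) →
                  ∀ x {u v} (w : Walk H u v) → Unique (edgesOf (arcs w)) → All (Ok x) (arcs w) → Sends x (run x (arcs w)) v u
    run-returns sends x (stop {v} _) _ _ = sends-refl x v
    run-returns sends x (step e _ (inj₁ refl) w) (h ∷ hs) (k ∷ ks) =
      sends-trans′ {x} {update x e (op (x e) true)} {run (update x e (op (x e) true)) (arcs w)} (sends x e true k)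
        (run-returns sends _ w hs (persists x e (op (x e) true) (arcs w) h ks))
    run-returns sends x (step e _ (inj₂ refl) w) (h ∷ hs) (k ∷ ks) =
      sends-trans′ {x} {update x e (op (x e) false)} {run (update x e (op (x e) false)) (arcs w)} (sends x e false k)
        (run-returns sends _ w hs (persists x e (op (x e) false) (arcs w) h ks))

  #-pick : ∀ (P S : VSet n) u → T (P u) → # (P ∧ˢ S) ≡ # ((P ∖ single u) ∧ˢ S) + ind (S u)
  #-pick P S u Pu = trans
    (count-≡ {r = 3} (λ p σ x → x ⇒ᵇ p) ((λ p σ x → p ∧ σ) ∷ [])
      ((λ p σ x → (p ∧ not x) ∧ σ) ∷ (λ p σ x → x ∧ σ) ∷ []) (λ v → P v ∷ S v ∷ single u v ∷ []) at)
    (cong (# ((P ∖ single u) ∧ˢ S) +_) (#-single u S))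
    where
    at : ∀ v → T (single u v ⇒ᵇ P v)
    at v with single u v in eq
    ... | false = tt
    ... | true with single⇒≡ u v (subst T (sym eq) tt)
    ...   | refl = Pu

  #-remove : ∀ (P : VSet n) u {k} → T (P u) → # P ≡ suc k → # (P ∖ single u) ≡ k
  #-remove P u Pu h = suc-injective (trans (sym (trans (sym (#-∧-full P)) (trans (#-pick P full u Pu)
    (trans (+-comm _ 1) (cong suc (#-∧-full (P ∖ single u))))))) h)

  #-inside : ∀ {P S : VSet n} → P ⊑ S → # P ≤ # (P ∧ˢ S)
  #-inside {P} {S} h = count-≤ {r = 2} (λ p σ → p ⇒ᵇ σ) ((λ p σ → p) ∷ []) ((λ p σ → p ∧ σ) ∷ []) (λ v → P v ∷ S v ∷ []) h

  #-outside : ∀ {Q S : VSet n} → Disj S Q → # (Q ∧ˢ S) ≤ 0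
  #-outside {Q} {S} h = count-≤ {r = 2} (λ q σ → not (σ ∧ q)) ((λ q σ → q ∧ σ) ∷ []) [] (λ v → Q v ∷ S v ∷ []) h

  occurrences : Fin m → List (Fin m) → ℕ
  occurrences e []        = 0
  occurrences e (e′ ∷ es) = ind (single e e′) + occurrences e es

  -- Integral max-flow min-cut

  module Routing (c : ℕ) (T′ T″ : VSet n) (T′⊑ : ∀ v → T (T′ v) → v ∈ vertices) (T″⊑ : ∀ v → T (T″ v) → v ∈ vertices)
                 (balanced : # T′ ≡ # T″)
                 (cuts : ∀ S → # (T′ ∧ˢ S) ≤ # (T″ ∧ˢ S) + # (λ e → available e ∧ (S (s e) xor S (d e))) * c) where

    capacity : Fin m → ℕ
    capacity e = if available e then c else 0

    -- Both directions share one capacity, because congestion adds them up.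
    Within : Fin m → ℕ × ℕ → Set
    Within e (p , q) = p + q ≤ capacity e

    residual : Fin m → ℕ × ℕ → Bool → Bool
    residual e (p , q) true  = available e ∧ ((1 ≤ᵇ q) ∨ (suc (p + q) ≤ᵇ c))
    residual e (p , q) false = available e ∧ ((1 ≤ᵇ p) ∨ (suc (p + q) ≤ᵇ c))

    push⁺ push⁻ : ℕ × ℕ → ℕ × ℕ
    push⁺ (p , suc q) = p , q
    push⁺ (p , zero)  = suc p , zero
    push⁻ (suc p , q) = p , q
    push⁻ (zero , q)  = zero , suc q

    push : ℕ × ℕ → Bool → ℕ × ℕ
    push y true  = push⁺ y
    push y false = push⁻ y

    residual⇒available : ∀ e y b → T (residual e y b) → T (available e)
    residual⇒available e y true  h = proj₁ (T-∧⁻ (available e) h)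
    residual⇒available e y false h = proj₁ (T-∧⁻ (available e) h)

    push-within : ∀ e y b → Within e y → T (residual e y b) → Within e (push y b)
    push-within e (p , suc q) true  w h = ≤-trans (+-monoʳ-≤ p (n≤1+n q)) w
    push-within e (p , zero)  true  w h with available e
    ... | true = ≤ᵇ⇒≤ (suc (p + 0)) c h
    push-within e (suc p , q) false w h = ≤-trans (n≤1+n (p + q)) w
    push-within e (zero , q)  false w h with available e
    ... | true = ≤ᵇ⇒≤ (suc q) c h

    push-sends : ∀ x e b → T (residual e (x e) b) → Sends x (update x e (push (x e) b)) (tail e b) (head e b)
    push-sends x e true h with x e in eq
    ... | p , suc q = sends-forward x e p q (trans (cong (λ y → p + proj₂ y) eq) (trans (+-suc p q) (cong (λ y → suc (proj₁ y + q)) (sym eq))))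
    ... | p , zero  = sends-forward x e (suc p) 0 (trans (cong (λ y → suc p + proj₂ y) eq) (cong (λ y → suc (proj₁ y + 0)) (sym eq)))
    push-sends x e false h with x e in eq
    ... | suc p , q = sends-backward x e p q (trans (cong (λ y → proj₁ y + q) eq) (cong (λ y → suc (p + proj₂ y)) (sym eq)))
    ... | zero , q  = sends-backward x e 0 (suc q) (trans (cong (λ y → proj₁ y + suc q) eq) (cong (λ y → suc (proj₂ y)) (sym eq)))

    module Push = Run push residual

    -- P and Q are the terminals not yet served.
    Serves : Amounts → VSet n → VSet n → Set
    Serves x P Q = ∀ S → outflow x S + (# (T″ ∧ˢ S) + # (P ∧ˢ S)) ≡ inflow x S + (# (T′ ∧ˢ S) + # (Q ∧ˢ S))

    -- An augmenting path serves one more pair of terminals. Without one, the search yields a set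
    -- that contains `P`, avoids `Q` and has no residual arc leaving it, which contradicts the cut
    -- condition.
    serve : ∀ k P Q x → # P ≡ k → # Q ≡ k → (∀ v → T (Q v) → v ∈ vertices) → (∀ e → Within e (x e)) → Serves x P Q →
            ∃ λ x → (∀ e → Within e (x e)) × (∀ S → outflow x S + # (T″ ∧ˢ S) ≡ inflow x S + # (T′ ∧ˢ S))
    serve zero P Q x #P #Q Q⊑ within serves = x , within , λ S →
      trans (cong (outflow x S +_) (trans (sym (+-identityʳ _)) (cong (# (T″ ∧ˢ S) +_) (sym (none P #P S)))))
        (trans (serves S) (cong (inflow x S +_) (trans (cong (# (T′ ∧ˢ S) +_) (none Q #Q S)) (+-identityʳ _))))
      where
      none : ∀ P → # P ≡ 0 → ∀ S → # (P ∧ˢ S) ≡ 0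
      none P h S = n≤0⇒n≡0 (≤-trans (count-mono (∧-⊑ˡ P S)) (≤-reflexive h))
    serve (suc k) P Q x #P #Q Q⊑ within serves = case reach of λ
      { (inj₁ (u , Pu , r)) → augment u Pu r ; (inj₂ (S , P⊑S , S∩Q , closed)) → ⊥-elim (deficient S P⊑S S∩Q closed) }
      where
      open Reach (λ e b → residual e (x e) b) (λ e b → residual⇒available e (x e) b) P Q Q⊑
      open Route using (end; end∈B; walk; simple; allOk)
      augment : ∀ u → T (P u) → Route full u → _
      augment u Pu r = serve k (P ∖ single u) (Q ∖ single v) x′ (#-remove P u Pu #P) (#-remove Q v (end∈B r) #Q)
        (λ w h → Q⊑ w (proj₁ (T-∧⁻ (Q w) h)))
        (Push.run-invariant Within push-within x (arcs (walk r)) unique (allOk r) within) serves′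
        where
        v = end r
        unique = unique-edges (walk r) (simple r)
        x′ = Push.run x (arcs (walk r))
        sends : Sends x x′ u v
        sends = Push.run-sends push-sends x (walk r) unique (allOk r)
        serves′ : Serves x′ (P ∖ single u) (Q ∖ single v)
        serves′ S = ≤-antisym
          (linear 0 ρ ((1 , x₀ ⊕ (x₃ ⊕ x₉) ≼ x₁ ⊕ (x₂ ⊕ x₈)) ∷ (1 , x₂ ⊕ (x₄ ⊕ (x₆ ⊕ x₈)) ≼ x₃ ⊕ (x₅ ⊕ (x₇ ⊕ x₉))) ∷ []) (x₀ ⊕ (x₄ ⊕ x₆) ≼ x₁ ⊕ (x₅ ⊕ x₇))
            (≤-reflexive (sends S) , ≤-reflexive old , tt))
          (linear 0 ρ ((1 , x₁ ⊕ (x₂ ⊕ x₈) ≼ x₀ ⊕ (x₃ ⊕ x₉)) ∷ (1 , x₃ ⊕ (x₅ ⊕ (x₇ ⊕ x₉)) ≼ x₂ ⊕ (x₄ ⊕ (x₆ ⊕ x₈))) ∷ []) (x₁ ⊕ (x₅ ⊕ x₇) ≼ x₀ ⊕ (x₄ ⊕ x₆))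
            (≤-reflexive (sym (sends S)) , ≤-reflexive (sym old) , tt))
          where
          ρ = outflow x′ S ∷ inflow x′ S ∷ outflow x S ∷ inflow x S ∷ # (T″ ∧ˢ S) ∷ # (T′ ∧ˢ S)
              ∷ # ((P ∖ single u) ∧ˢ S) ∷ # ((Q ∖ single v) ∧ˢ S) ∷ ind (S u) ∷ ind (S v) ∷ []
          old : outflow x S + (# (T″ ∧ˢ S) + (# ((P ∖ single u) ∧ˢ S) + ind (S u)))
              ≡ inflow x S + (# (T′ ∧ˢ S) + (# ((Q ∖ single v) ∧ˢ S) + ind (S v)))
          old = trans (cong (λ z → outflow x S + (# (T″ ∧ˢ S) + z)) (sym (#-pick P S u Pu)))
            (trans (serves S) (cong (λ z → inflow x S + (# (T′ ∧ˢ S) + z)) (#-pick Q S v (end∈B r))))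
      deficient : ∀ S → P ⊑ S → Disj S Q → Closed S → ⊥
      deficient S P⊑S S∩Q closed = refute (outflow x S ∷ inflow x S ∷ crossing * c ∷ # (T″ ∧ˢ S) ∷ # (T′ ∧ˢ S) ∷ # (P ∧ˢ S) ∷ # (Q ∧ˢ S) ∷ [])
        ((1 , x₁ ⊕ x₂ ≼ x₀) ∷ (1 , x₀ ⊕ (x₃ ⊕ x₅) ≼ x₁ ⊕ (x₄ ⊕ x₆)) ∷ (1 , x₄ ≼ x₃ ⊕ x₂) ∷ (1 , con 1 ≼ x₅) ∷ (1 , x₆ ≼ con 0) ∷ [])
        ( saturated , ≤-reflexive (serves S) , cuts S
        , ≤-trans (≤-trans (s≤s z≤n) (≤-reflexive (sym #P))) (#-inside P⊑S) , #-outside {Q} {S} S∩Q , tt)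
        where
        crosses : Fin m → Bool
        crosses e = available e ∧ (S (s e) xor S (d e))
        crossing = # crosses
        -- No residual arc leaves `S`, so every available edge across its boundary carries `c` units
        -- outwards and none inwards.
        saturated : inflow x S + crossing * c ≤ outflow x S
        saturated = ≤-trans (≤-reflexive (trans (cong (inflow x S +_) (sym (∑-scale crosses c))) (sym (∑-+ _ (λ e → if crosses e then c else 0)))))
          (∑-mono each)
          where
          unsaturated : ∀ p q → ¬ (q + c ≤ p) → T ((1 ≤ᵇ q) ∨ (suc (p + q) ≤ᵇ c))
          unsaturated p (suc q) h = tt
          unsaturated p zero    h = ≤⇒≤ᵇ (≤-trans (s≤s (≤-reflexive (+-identityʳ p))) (≰⇒> h))
          forward : ∀ e → T (available e) → T (S (s e)) → ¬ T (S (d e)) → proj₂ (x e) + c ≤ proj₁ (x e)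
          forward e av i o = case proj₂ (x e) + c ≤? proj₁ (x e) of λ
            { (yes le) → le
            ; (no ¬le) → ⊥-elim (o (closed e true (T-∧⁺ (available e) _ av (unsaturated (proj₁ (x e)) (proj₂ (x e)) ¬le)) i)) }
          backward : ∀ e → T (available e) → T (S (d e)) → ¬ T (S (s e)) → proj₁ (x e) + c ≤ proj₂ (x e)
          backward e av i o = case proj₁ (x e) + c ≤? proj₂ (x e) of λ
            { (yes le) → le
            ; (no ¬le) → ⊥-elim (o (closed e false (T-∧⁺ (available e) _ av
                (subst (λ z → T ((1 ≤ᵇ proj₁ (x e)) ∨ (suc z ≤ᵇ c))) (+-comm (proj₂ (x e)) (proj₁ (x e))) (unsaturated (proj₂ (x e)) (proj₁ (x e)) ¬le))) i)) }
          none : ∀ e → available e ≡ false → proj₁ (x e) + proj₂ (x e) ≤ 0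
          none e eq = ≤-trans (within e) (≤-reflexive (cong (if_then c else 0) eq))
          each : ∀ e → along (x e) (S (d e)) (S (s e)) + (if crosses e then c else 0) ≤ along (x e) (S (s e)) (S (d e))
          each e with S (s e) in eqs | S (d e) in eqd | available e in eqa
          ... | true  | true  | true  = ≤-reflexive (+-identityʳ _)
          ... | true  | true  | false = ≤-reflexive (+-identityʳ _)
          ... | false | false | true  = z≤n
          ... | false | false | false = z≤n
          ... | true  | false | false = ≤-trans (≤-reflexive (+-identityʳ _)) (≤-trans (≤-trans (m≤n+m _ (proj₁ (x e))) (none e eqa)) z≤n)
          ... | false | true  | false = ≤-trans (≤-reflexive (trans (+-identityʳ _) (+-identityʳ _))) (≤-trans (≤-trans (m≤m+n _ (proj₂ (x e))) (none e eqa)) z≤n)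
          ... | true  | false | true  = ≤-trans (forward e (subst T (sym eqa) tt) (subst T (sym eqs) tt) (λ h → subst T eqd h)) (≤-reflexive (sym (+-identityʳ _)))
          ... | false | true  | true  = ≤-trans (+-monoˡ-≤ c (≤-reflexive (+-identityʳ (proj₁ (x e)))))
                  (backward e (subst T (sym eqa) tt) (subst T (sym eqd) tt) (λ h → subst T eqs h))

    record ServedPath : Set where
      field
        from to  : Fin n
        from∈    : T (T′ from)
        to∈      : T (T″ to)
        walk     : Walk H from to
        simple   : Unique (walkVertices H walk)
    open ServedPath

    sent received : Fin n → List ServedPath → ℕ
    sent v []           = 0
    sent v (p ∷ ps)     = ind (single (from p) v) + sent v ps
    received v []       = 0
    received v (p ∷ ps) = ind (single (to p) v) + received v ps

    usage : Fin m → List ServedPath → ℕ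
    usage e []       = 0
    usage e (p ∷ ps) = occurrences e (walkEdges H (walk p)) + usage e ps

    positive : Fin m → ℕ × ℕ → Bool → Bool
    positive e (p , q) true  = 1 ≤ᵇ p
    positive e (p , q) false = 1 ≤ᵇ q

    pop : ℕ × ℕ → Bool → ℕ × ℕ
    pop (p , q) true  = pred p , q
    pop (p , q) false = p , pred q

    amount : ℕ × ℕ → ℕ
    amount (p , q) = p + q

    pop-amount : ∀ e y b → T (positive e y b) → amount (pop y b) + 1 ≡ amount y
    pop-amount e (suc p , q) true  h = +-comm (p + q) 1
    pop-amount e (p , suc q) false h = trans (+-comm (p + q) 1) (sym (+-suc p q))

    pop-within : ∀ e y b → Within e y → T (positive e y b) → Within e (pop y b)
    pop-within e y b w h = ≤-trans (≤-trans (m≤m+n (amount (pop y b)) 1) (≤-reflexive (pop-amount e y b h))) w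

    pop-sends : ∀ x e b → T (positive e (x e) b) → Sends x (update x e (pop (x e) b)) (head e b) (tail e b)
    pop-sends x e true h with x e in eq
    ... | suc p , q = sends-backward x e p q (trans (cong (λ y → proj₁ y + q) eq) (cong (λ y → suc (p + proj₂ y)) (sym eq)))
    pop-sends x e false h with x e in eq
    ... | p , suc q = sends-forward x e p q (trans (cong (λ y → p + proj₂ y) eq) (trans (+-suc p q) (cong (λ y → suc (proj₁ y + q)) (sym eq))))

    positive⇒available : ∀ e y b → Within e y → T (positive e y b) → T (available e)
    positive⇒available e y b w h with available e
    ... | true  = tt
    ... | false = 1+n≰n {0} (≤-trans (≤-trans (m≤n+m 1 (amount (pop y b))) (≤-reflexive (pop-amount e y b h))) w)

    module Pop = Run pop positive

    run-amount : ∀ x as → Unique (edgesOf as) → All (Pop.Ok x) as → ∀ e →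
                 amount (Pop.run x as e) + occurrences e (edgesOf as) ≡ amount (x e)
    run-amount x []              _        _        e = +-identityʳ _
    run-amount x ((e′ , b) ∷ as) (h ∷ hs) (k ∷ ks) e =
      trans (regroup (amount (Pop.run x′ as e)) (ind (single e e′)) (occurrences e (edgesOf as)))
        (trans (cong (_+ ind (single e e′)) (run-amount x′ as hs (Pop.persists x e′ (pop (x e′) b) as h ks) e)) at-edge)
      where
      x′ = update x e′ (pop (x e′) b)
      regroup : ∀ a b c → a + (b + c) ≡ a + c + b
      regroup = solve-∀
      at-edge : amount (x′ e) + ind (single e e′) ≡ amount (x e)
      at-edge with e′ ≟ᶠ e
      ... | yes refl = trans (cong (λ z → amount (pop (x e) b) + ind z) (T⇒≡ (single-refl e))) (pop-amount e (x e) b k)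
      ... | no ne with single e e′ in eq
      ...   | true  = ⊥-elim (ne (sym (single⇒≡ e e′ (subst T (sym eq) tt))))
      ...   | false = +-identityʳ _

    record Paths (P Q : VSet n) (x : Amounts) : Set where
      field
        list      : List ServedPath
        sent≡     : ∀ v → sent v list ≡ ind (P v)
        received≡ : ∀ v → received v list ≡ ind (Q v)
        usage≤    : ∀ e → usage e list ≤ amount (x e)
    open Paths

    split-ind : ∀ (P : VSet n) u → T (P u) → ∀ v → ind (single u v) + ind ((P ∖ single u) v) ≡ ind (P v)
    split-ind P u Pu v with single u v in eq
    ... | true with single⇒≡ u v (subst T (sym eq) tt)
    ...   | refl with P u
    ...     | true = refl
    split-ind P u Pu v | false with P v
    ... | true  = refl
    ... | false = refl

    -- A set closed under arcs with flow has no net outflow, so by balance the flow leads from the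
    -- remaining sources to a remaining sink. Flow left over when all terminals are served is
    -- discarded; hence `usage≤` is only an inequality.
    decompose : ∀ k P Q x → # P ≡ k → # Q ≡ k → P ⊑ T′ → Q ⊑ T″ → (∀ e → Within e (x e)) →
                (∀ S → outflow x S + # (Q ∧ˢ S) ≡ inflow x S + # (P ∧ˢ S)) → Paths P Q x
    decompose zero P Q x #P #Q P⊑ Q⊑ within bal = record
      { list = [] ; sent≡ = λ v → sym (empty P #P v) ; received≡ = λ v → sym (empty Q #Q v) ; usage≤ = λ _ → z≤n }
      where
      empty : ∀ P → # P ≡ 0 → ∀ v → ind (P v) ≡ 0
      empty P h v = n≤0⇒n≡0 (≤-trans (≤-reflexive (sym (#-single v P)))
        (≤-trans (count-mono (∧-⊑ʳ (single v) P)) (≤-reflexive h)))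
    decompose (suc k) P Q x #P #Q P⊑ Q⊑ within bal = case reach of λ
      { (inj₁ (u , Pu , r)) → peel u Pu r ; (inj₂ (S , P⊑S , S∩Q , closed)) → ⊥-elim (deficient S P⊑S S∩Q closed) }
      where
      open Reach (λ e b → positive e (x e) b) (λ e b → positive⇒available e (x e) b (within e)) P Q
                 (λ v h → T″⊑ v (⇒ᵇ-elim (Q v) (Q⊑ v) h))
      module R = Route
      peel : ∀ u → T (P u) → Route full u → Paths P Q x
      peel u Pu r = record
        { list      = first ∷ list rest
        ; sent≡     = λ w → trans (cong (ind (single u w) +_) (sent≡ rest w)) (split-ind P u Pu w)
        ; received≡ = λ w → trans (cong (ind (single v w) +_) (received≡ rest w)) (split-ind Q v (R.end∈B r) w)
        ; usage≤    = λ e → ≤-trans (+-monoʳ-≤ (occurrences e (walkEdges H (R.walk r))) (usage≤ rest e))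
            (≤-reflexive (trans (+-comm _ (amount (x′ e)))
              (trans (cong (λ es → amount (x′ e) + occurrences e es) (sym (edges-arcs (R.walk r)))) (run-amount x (arcs (R.walk r)) unique (R.allOk r) e)))) }
        where
        v = R.end r
        unique = unique-edges (R.walk r) (R.simple r)
        x′ = Pop.run x (arcs (R.walk r))
        sends : Sends x x′ v u
        sends = Pop.run-returns pop-sends x (R.walk r) unique (R.allOk r)
        first : ServedPath
        first = record { from = u ; to = v ; from∈ = ⇒ᵇ-elim (P u) (P⊑ u) Pu ; to∈ = ⇒ᵇ-elim (Q v) (Q⊑ v) (R.end∈B r)
                       ; walk = R.walk r ; simple = R.simple r }
        shrink : ∀ {A B : VSet n} w → A ⊑ B → A ∖ single w ⊑ B
        shrink {A} {B} w h i = entails {r = 3} (λ a b σ → a ⇒ᵇ b) (λ a b σ → (a ∧ not σ) ⇒ᵇ b) (A i ∷ B i ∷ single w i ∷ []) (h i)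
        bal′ : ∀ S → outflow x′ S + # ((Q ∖ single v) ∧ˢ S) ≡ inflow x′ S + # ((P ∖ single u) ∧ˢ S)
        bal′ S = ≤-antisym
          (linear 0 ρ ((1 , x₀ ⊕ (x₃ ⊕ x₆) ≼ x₁ ⊕ (x₂ ⊕ x₇)) ∷ (1 , x₂ ⊕ (x₅ ⊕ x₇) ≼ x₃ ⊕ (x₄ ⊕ x₆)) ∷ []) (x₀ ⊕ x₅ ≼ x₁ ⊕ x₄)
            (≤-reflexive (sends S) , ≤-reflexive old , tt))
          (linear 0 ρ ((1 , x₁ ⊕ (x₂ ⊕ x₇) ≼ x₀ ⊕ (x₃ ⊕ x₆)) ∷ (1 , x₃ ⊕ (x₄ ⊕ x₆) ≼ x₂ ⊕ (x₅ ⊕ x₇)) ∷ []) (x₁ ⊕ x₄ ≼ x₀ ⊕ x₅)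
            (≤-reflexive (sym (sends S)) , ≤-reflexive (sym old) , tt))
          where
          ρ = outflow x′ S ∷ inflow x′ S ∷ outflow x S ∷ inflow x S ∷ # ((P ∖ single u) ∧ˢ S) ∷ # ((Q ∖ single v) ∧ˢ S) ∷ ind (S u) ∷ ind (S v) ∷ []
          old : outflow x S + (# ((Q ∖ single v) ∧ˢ S) + ind (S v)) ≡ inflow x S + (# ((P ∖ single u) ∧ˢ S) + ind (S u))
          old = trans (cong (outflow x S +_) (sym (#-pick Q S v (R.end∈B r)))) (trans (bal S) (cong (inflow x S +_) (#-pick P S u Pu)))
        rest : Paths (P ∖ single u) (Q ∖ single v) x′
        rest = decompose k (P ∖ single u) (Q ∖ single v) x′ (#-remove P u Pu #P) (#-remove Q v (R.end∈B r) #Q)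
          (shrink {P} {T′} u P⊑) (shrink {Q} {T″} v Q⊑)
          (Pop.run-invariant Within pop-within x (arcs (R.walk r)) unique (R.allOk r) within) bal′
      deficient : ∀ S → P ⊑ S → Disj S Q → Closed S → ⊥
      deficient S P⊑S S∩Q closed = refute (outflow x S ∷ inflow x S ∷ # (P ∧ˢ S) ∷ # (Q ∧ˢ S) ∷ [])
        ((1 , x₀ ≼ x₁) ∷ (1 , x₁ ⊕ x₂ ≼ x₀ ⊕ x₃) ∷ (1 , con 1 ≼ x₂) ∷ (1 , x₃ ≼ con 0) ∷ [])
        ( ∑-mono each , ≤-reflexive (sym (bal S))
        , ≤-trans (≤-trans (s≤s z≤n) (≤-reflexive (sym #P))) (#-inside P⊑S) , #-outside {Q} {S} S∩Q , tt)
        where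
        nothing : ∀ k {b} → (T (1 ≤ᵇ k) → T b) → ¬ T b → k ≤ 0
        nothing zero    h o = z≤n
        nothing (suc k) h o = ⊥-elim (o (h tt))
        each : ∀ e → along (x e) (S (s e)) (S (d e)) ≤ along (x e) (S (d e)) (S (s e))
        each e with S (s e) in eqs | S (d e) in eqd
        ... | true  | true  = ≤-refl
        ... | false | false = ≤-refl
        ... | true  | false = ≤-trans (≤-trans (≤-reflexive (+-identityʳ _))
                (nothing (proj₁ (x e)) (λ h → closed e true h (subst T (sym eqs) tt)) (λ h → subst T eqd h))) z≤n
        ... | false | true  = ≤-trans
                (nothing (proj₂ (x e)) (λ h → closed e false h (subst T (sym eqd) tt)) (λ h → subst T eqs h)) z≤n

    -- Integral max-flow min-cut, with the flow given by paths.
    route : ∃ λ (ps : List ServedPath) → (∀ v → sent v ps ≡ ind (T′ v)) × (∀ v → received v ps ≡ ind (T″ v)) × (∀ e → usage e ps ≤ c)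
    route with serve (# T′) T′ T″ (λ _ → 0 , 0) refl (sym balanced) T″⊑ (λ _ → z≤n)
                 (λ S → cong₂ _+_ (∑-cong λ e → along-zero (S (s e)) (S (d e))) (+-comm (# (T″ ∧ˢ S)) (# (T′ ∧ˢ S))))
      where
      along-zero : ∀ a b → along (0 , 0) a b ≡ along (0 , 0) b a
      along-zero true  true  = refl
      along-zero true  false = refl
      along-zero false true  = refl
      along-zero false false = refl
    ... | x , within , bal = list ps , sent≡ ps , received≡ ps , λ e → ≤-trans (usage≤ ps e) (≤-trans (within e) (capacity≤ e))
      where
      ps : Paths T′ T″ x
      ps = decompose (# T′) T′ T″ x refl (sym balanced) (⊑-refl T′) (⊑-refl T″) within bal
      capacity≤ : ∀ e → capacity e ≤ c
      capacity≤ e with available e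
      ... | true  = ≤-refl
      ... | false = z≤n

-- Rational flows

-- The recursion mirrors `sum` over paths of value 1, so that loads and supplies become images of
-- natural numbers.
ι : ℕ → ℚ
ι zero    = 0ℚ
ι (suc k) = 1ℚ ℚ.+ ι k

0≤1 : 0ℚ ℚ.≤ 1ℚ
0≤1 = ℚR.nonNegative⁻¹ 1ℚ

ι≥0 : ∀ k → 0ℚ ℚ.≤ ι k
ι≥0 zero    = ℚR.≤-refl
ι≥0 (suc k) = ℚR.≤-trans (ℚR.≤-reflexive (sym (ℚR.+-identityˡ 0ℚ))) (ℚR.+-mono-≤ 0≤1 (ι≥0 k))

ι-mono : ∀ {a b} → a ≤ b → ι a ℚ.≤ ι b
ι-mono {_} {b} z≤n = ι≥0 b
ι-mono (s≤s h) = ℚR.+-monoʳ-≤ 1ℚ (ι-mono h)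

ι-+ : ∀ a b → ι (a + b) ≡ ι a ℚ.+ ι b
ι-+ zero    b = sym (ℚR.+-identityˡ (ι b))
ι-+ (suc a) b = trans (cong (1ℚ ℚ.+_) (ι-+ a b)) (sym (ℚR.+-assoc 1ℚ (ι a) (ι b)))

cancel-1 : ∀ {p q} → 1ℚ ℚ.+ p ℚ.≤ 1ℚ ℚ.+ q → p ℚ.≤ q
cancel-1 {p} {q} h = ℚR.≤-trans (ℚR.≤-reflexive (sym (collapse p))) (ℚR.≤-trans (ℚR.+-monoʳ-≤ (ℚ.- 1ℚ) h) (ℚR.≤-reflexive (collapse q)))
  where
  collapse : ∀ r → ℚ.- 1ℚ ℚ.+ (1ℚ ℚ.+ r) ≡ r
  collapse r = trans (sym (ℚR.+-assoc (ℚ.- 1ℚ) 1ℚ r)) (trans (cong (ℚ._+ r) (ℚR.+-inverseˡ 1ℚ)) (ℚR.+-identityˡ r))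

ι-reflects : ∀ a b → ι a ℚ.≤ ι b → a ≤ b
ι-reflects zero    b       h = z≤n
ι-reflects (suc a) zero    h = ⊥-elim (ℚR.<-irrefl refl (ℚR.<-≤-trans (ℚR.positive⁻¹ 1ℚ)
  (ℚR.≤-trans (ℚR.≤-trans (ℚR.≤-reflexive (sym (ℚR.+-identityʳ 1ℚ))) (ℚR.+-monoʳ-≤ 1ℚ (ι≥0 a))) h)))
ι-reflects (suc a) (suc b) h = s≤s (ι-reflects a b (cancel-1 h))

∑ℚ : ∀ {n} → (Fin n → ℚ) → ℚ
∑ℚ {zero}  f = 0ℚ
∑ℚ {suc n} f = f zero ℚ.+ ∑ℚ (f ∘ suc)

∑ℚ-mono : ∀ {n} {f g : Fin n → ℚ} → (∀ i → f i ℚ.≤ g i) → ∑ℚ f ℚ.≤ ∑ℚ g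
∑ℚ-mono {zero}  h = ℚR.≤-refl
∑ℚ-mono {suc n} h = ℚR.+-mono-≤ (h zero) (∑ℚ-mono (h ∘ suc))

∑ℚ-zero : ∀ n → ∑ℚ {n} (λ _ → 0ℚ) ≡ 0ℚ
∑ℚ-zero zero    = refl
∑ℚ-zero (suc n) = trans (ℚR.+-identityˡ _) (∑ℚ-zero n)

∑ℚ-+ : ∀ {n} (f g : Fin n → ℚ) → ∑ℚ (λ i → f i ℚ.+ g i) ≡ ∑ℚ f ℚ.+ ∑ℚ g
∑ℚ-+ {zero}  f g = sym (ℚR.+-identityˡ 0ℚ)
∑ℚ-+ {suc n} f g = trans (cong (f zero ℚ.+ g zero ℚ.+_) (∑ℚ-+ (f ∘ suc) (g ∘ suc))) (ℚ-interchange (f zero) (g zero) _ _)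

∑ℚ-≥0 : ∀ {n} {f : Fin n → ℚ} → (∀ i → 0ℚ ℚ.≤ f i) → 0ℚ ℚ.≤ ∑ℚ f
∑ℚ-≥0 {n} h = ℚR.≤-trans (ℚR.≤-reflexive (sym (∑ℚ-zero n))) (∑ℚ-mono h)

∑ℚ-single : ∀ {n} (i : Fin n) (a : ℚ) → ∑ℚ (λ j → if single i j then a else 0ℚ) ≡ a
∑ℚ-single {suc n} zero    a = trans (cong (a ℚ.+_) (∑ℚ-zero n)) (ℚR.+-identityʳ a)
∑ℚ-single         (suc i) a = trans (ℚR.+-identityˡ _) (∑ℚ-single i a)

∑ℚ-term : ∀ {n} {f : Fin n → ℚ} (i : Fin n) → (∀ j → 0ℚ ℚ.≤ f j) → f i ℚ.≤ ∑ℚ f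
∑ℚ-term {suc n} {f} zero    h = ℚR.≤-trans (ℚR.≤-reflexive (sym (ℚR.+-identityʳ (f zero)))) (ℚR.+-monoʳ-≤ (f zero) (∑ℚ-≥0 (h ∘ suc)))
∑ℚ-term {suc n} {f} (suc i) h = ℚR.≤-trans (∑ℚ-term i (h ∘ suc)) (ℚR.≤-trans (ℚR.≤-reflexive (sym (ℚR.+-identityˡ _))) (ℚR.+-monoˡ-≤ _ (h zero)))

∑ℚ-ι : ∀ {n} (p : VSet n) k → ∑ℚ (λ i → if p i then ι k else 0ℚ) ≡ ι (# p * k)
∑ℚ-ι {zero}  p k = refl
∑ℚ-ι {suc n} p k with p zero
... | true  = trans (cong (ι k ℚ.+_) (∑ℚ-ι (p ∘ suc) k)) (sym (ι-+ k (# (p ∘ suc) * k)))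
... | false = trans (ℚR.+-identityˡ _) (∑ℚ-ι (p ∘ suc) k)

∣∣≡# : ∀ {n} (p : Subset n) → ∣ p ∣ ≡ # (lookup p)
∣∣≡# []          = refl
∣∣≡# (true ∷ p)  = cong suc (∣∣≡# p)
∣∣≡# (false ∷ p) = ∣∣≡# p

module _ {G : Graph} (H : Subgraph G) where
  open Graph G
  open Flows {G} H using (s; d; available)

  exit : ∀ {u v} (S : VSet order) (w : Walk H u v) → S u ≢ S v → ∃ λ e → e ∈ˡ walkEdges H w × T (S (s e) xor S (d e))
  exit S (stop _) h = ⊥-elim (h refl)
  exit {u} {v} S (step {v = x} e _ j w) h with S u in equ | S x in eqx
  ... | true  | true  = let e′ , p , q = exit S w (subst (_≢ S v) (sym eqx) h) in e′ , there p , q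
  ... | false | false = let e′ , p , q = exit S w (subst (_≢ S v) (sym eqx) h) in e′ , there p , q
  ... | true  | false = e , here refl , crossed j
    where
    crossed : (e joins u and x) → T (S (s e) xor S (d e))
    crossed (inj₁ refl) rewrite equ | eqx = tt
    crossed (inj₂ refl) rewrite equ | eqx = tt
  ... | false | true  = e , here refl , crossed j
    where
    crossed : (e joins u and x) → T (S (s e) xor S (d e))
    crossed (inj₁ refl) rewrite equ | eqx = tt
    crossed (inj₂ refl) rewrite equ | eqx = tt

  module _ {A B : Subset order} where
    open WeightedPath
    open Path

    totalValue : Flow H A B → ℚ
    totalValue f = sum (List.map value f)

    sent≤total : ∀ (f : Flow H A B) (P : VSet order) → ∑ℚ (λ v → if P v then sentBy H f v else 0ℚ) ℚ.≤ totalValue f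
    sent≤total []      P = ℚR.≤-trans (∑ℚ-mono {g = λ _ → 0ℚ} (λ v → same (P v))) (ℚR.≤-reflexive (∑ℚ-zero order))
      where
      same : ∀ b → (if b then 0ℚ else 0ℚ) ℚ.≤ 0ℚ
      same true  = ℚR.≤-refl
      same false = ℚR.≤-refl
    sent≤total (p ∷ f) P = ℚR.≤-trans (∑ℚ-mono {g = λ v → (if single (source (path p)) v then value p else 0ℚ) ℚ.+ (if P v then sentBy H f v else 0ℚ)} bound)
      (ℚR.≤-trans (ℚR.≤-reflexive (trans (∑ℚ-+ own rest) (cong (ℚ._+ ∑ℚ rest) (∑ℚ-single (source (path p)) (value p))))) (ℚR.+-monoʳ-≤ (value p) (sent≤total f P)))
      where
      own rest : Fin order → ℚ
      own v  = if single (source (path p)) v then value p else 0ℚ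
      rest v = if P v then sentBy H f v else 0ℚ
      bound : ∀ v → (if P v then sentBy H (p ∷ f) v else 0ℚ) ℚ.≤ (if single (source (path p)) v then value p else 0ℚ) ℚ.+ (if P v then sentBy H f v else 0ℚ)
      bound v with source (path p) ≟ᶠ v | P v
      ... | yes _ | true  = ℚR.≤-refl
      ... | no _  | true  = ℚR.≤-reflexive (sym (ℚR.+-identityˡ _))
      ... | yes _ | false = ℚR.≤-trans (value≥0 p) (ℚR.≤-reflexive (sym (ℚR.+-identityʳ _)))
      ... | no _  | false = ℚR.≤-reflexive (sym (ℚR.+-identityˡ 0ℚ))

    load≥0 : ∀ (f : Flow H A B) e → 0ℚ ℚ.≤ load H f e
    load≥0 []      e = ℚR.≤-refl
    load≥0 (p ∷ f) e with _goesThrough?_ H (path p) e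
    ... | yes _ = ℚR.≤-trans (ℚR.≤-reflexive (sym (ℚR.+-identityˡ 0ℚ))) (ℚR.+-mono-≤ (value≥0 p) (load≥0 f e))
    ... | no _  = load≥0 f e

    -- Every path crosses the boundary of `S`, so its value is counted at some edge there at least
    -- once.
    total≤load : ∀ (f : Flow H A B) (S : VSet order) → (∀ v → v ∈ A → ∀ w → w ∈ B → S v ≢ S w) →
                 totalValue f ℚ.≤ ∑ℚ (λ e → if S (s e) xor S (d e) then load H f e else 0ℚ)
    total≤load []      S sep = ∑ℚ-≥0 λ e → case′ (S (s e) xor S (d e))
      where
      case′ : ∀ b → 0ℚ ℚ.≤ (if b then 0ℚ else 0ℚ)
      case′ true  = ℚR.≤-refl
      case′ false = ℚR.≤-refl
    total≤load (p ∷ f) S sep =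
      ℚR.≤-trans (ℚR.+-mono-≤ (ℚR.≤-trans (at-exit exits) (∑ℚ-term {f = own} (proj₁ exits) own≥0)) (total≤load f S sep))
        (ℚR.≤-trans (ℚR.≤-reflexive (sym (∑ℚ-+ own _))) (∑ℚ-mono combine))
      where
      exits = exit S (walk (path p)) (sep _ (source∈S (path p)) _ (target∈S′ (path p)))
      own : Fin size → ℚ
      own e = if S (s e) xor S (d e) then (if does (_goesThrough?_ H (path p) e) then value p else 0ℚ) else 0ℚ
      own≥0 : ∀ e → 0ℚ ℚ.≤ own e
      own≥0 e with S (s e) xor S (d e) | does (_goesThrough?_ H (path p) e)
      ... | true  | true  = value≥0 p
      ... | true  | false = ℚR.≤-refl
      ... | false | _     = ℚR.≤-refl
      at-exit : (x : ∃ λ e → e ∈ˡ walkEdges H (walk (path p)) × T (S (s e) xor S (d e))) → value p ℚ.≤ own (proj₁ x)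
      at-exit (e , e∈ , c) with S (s e) xor S (d e) | _goesThrough?_ H (path p) e
      ... | true | yes _ = ℚR.≤-refl
      ... | true | no e∉ = ⊥-elim (e∉ e∈)
      combine : ∀ e → own e ℚ.+ (if S (s e) xor S (d e) then load H f e else 0ℚ) ℚ.≤ (if S (s e) xor S (d e) then load H (p ∷ f) e else 0ℚ)
      combine e with S (s e) xor S (d e) | _goesThrough?_ H (path p) e
      ... | true  | yes _ = ℚR.≤-refl
      ... | true  | no _  = ℚR.≤-reflexive (ℚR.+-identityˡ _)
      ... | false | _     = ℚR.≤-reflexive (ℚR.+-identityˡ 0ℚ)

    load≤congestion : ∀ (f : Flow H A B) e → e ∈ Subgraph.edges H → load H f e ℚ.≤ edgeCongestion H f
    load≤congestion f e e∈ = All.lookup (xs≤max 0ℚ _) (∈-map⁺ (load H f) (∈-filter⁺ (_∈ˢ? Subgraph.edges H) (∈-allFin e) e∈))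

flow⇒cut : ∀ {G : Graph} {A B : Subset (Graph.order G)} (c : ℕ) (f : Flow (whole G) A B) → OneToOne (whole G) f →
           edgeCongestion (whole G) f ℚ.≤ ι c → (S : VSet (Graph.order G)) → (∀ v → v ∈ A → ∀ w → w ∈ B → S v ≢ S w) →
           # (lookup A) ≤ # (λ e → S (proj₁ (Graph.ends G e)) xor S (proj₂ (Graph.ends G e))) * c
flow⇒cut {G} {A} {B} c f (sends , _) congestion S sep = ι-reflects _ _ (begin
  ι (# (lookup A))                                              ≡⟨ cong ι (*-identityʳ (# (lookup A))) ⟨
  ι (# (lookup A) * 1)                                        ≡⟨ ∑ℚ-ι (lookup A) 1 ⟨
  ∑ℚ (λ v → if lookup A v then ι 1 else 0ℚ)                     ≤⟨ ∑ℚ-mono one ⟩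
  ∑ℚ (λ v → if lookup A v then sentBy (whole G) f v else 0ℚ)    ≤⟨ sent≤total (whole G) f (lookup A) ⟩
  totalValue (whole G) f                                         ≤⟨ total≤load (whole G) f S sep ⟩
  ∑ℚ (λ e → if crosses e then load (whole G) f e else 0ℚ)       ≤⟨ ∑ℚ-mono light ⟩
  ∑ℚ (λ e → if crosses e then ι c else 0ℚ)                      ≡⟨ ∑ℚ-ι crosses c ⟩
  ι (# crosses * c)                                           ∎)
  where
  open ℚR.≤-Reasoning
  crosses : Fin (Graph.size G) → Bool
  crosses e = S (proj₁ (Graph.ends G e)) xor S (proj₂ (Graph.ends G e))
  one : ∀ v → (if lookup A v then ι 1 else 0ℚ) ℚ.≤ (if lookup A v then sentBy (whole G) f v else 0ℚ)
  one v with lookup A v in eq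
  ... | true  = ℚR.≤-reflexive (trans (ℚR.+-identityʳ 1ℚ) (sym (sends (lookup⇒[]= v A eq))))
  ... | false = ℚR.≤-refl
  light : ∀ e → (if crosses e then load (whole G) f e else 0ℚ) ℚ.≤ (if crosses e then ι c else 0ℚ)
  light e with crosses e
  ... | true  = ℚR.≤-trans (load≤congestion (whole G) f e ∈⊤) congestion
  ... | false = ℚR.≤-refl

module _ {G : Graph} (H : Subgraph G) where
  open Graph G
  open Flows {G} H

  routing⇒flow : ∀ c (A B : Subset order) (A⊑ : ∀ v → T (lookup A v) → v ∈ Subgraph.vertices H) (B⊑ : ∀ v → T (lookup B v) → v ∈ Subgraph.vertices H) →
                 (balanced : # (lookup A) ≡ # (lookup B)) →
                 (cuts : ∀ S → # (lookup A ∧ˢ S) ≤ # (lookup B ∧ˢ S) + # (λ e → available e ∧ (S (s e) xor S (d e))) * c) →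
                 ∃ λ (f : Flow H A B) → OneToOne H f × edgeCongestion H f ℚ.≤ ι c
  routing⇒flow c A B A⊑ B⊑ balanced cuts with Routing.route c (lookup A) (lookup B) A⊑ B⊑ balanced cuts
  ... | ps , sent≡ , received≡ , usage≤ = flow ps
      , ((λ {v} v∈ → trans (sent-flow ps v) (trans (cong ι (trans (sent≡ v) (cong ind ([]=⇒lookup v∈)))) (ℚR.+-identityʳ 1ℚ)))
        , λ {v} v∈ → trans (received-flow ps v) (trans (cong ι (trans (received≡ v) (cong ind ([]=⇒lookup v∈)))) (ℚR.+-identityʳ 1ℚ)))
      , max≤v⁺ (ι≥0 c) (loads (filter (_∈ˢ? Subgraph.edges H) (allFin size)))
    where
    open Routing c (lookup A) (lookup B) A⊑ B⊑ balanced cuts using (ServedPath; sent; received; usage)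
    open ServedPath
    weighted : ServedPath → WeightedPath H A B
    weighted p = record
      { path = record { source = from p ; target = to p
                      ; source∈S = lookup⇒[]= (from p) A (T⇒≡ (from∈ p)) ; target∈S′ = lookup⇒[]= (to p) B (T⇒≡ (to∈ p))
                      ; walk = walk p ; simple = simple p }
      ; value = 1ℚ ; value≥0 = 0≤1 }
    flow : List ServedPath → Flow H A B
    flow = List.map weighted
    sent-flow : ∀ ps v → sentBy H (flow ps) v ≡ ι (sent v ps)
    sent-flow []       v = refl
    sent-flow (p ∷ ps) v with from p ≟ᶠ v
    ... | yes _ = cong (1ℚ ℚ.+_) (sent-flow ps v)
    ... | no _  = sent-flow ps v
    received-flow : ∀ ps v → receivedBy H (flow ps) v ≡ ι (received v ps)
    received-flow []       v = refl
    received-flow (p ∷ ps) v with to p ≟ᶠ v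
    ... | yes _ = cong (1ℚ ℚ.+_) (received-flow ps v)
    ... | no _  = received-flow ps v
    occurs : ∀ e es → e ∈ˡ es → 1 ≤ occurrences e es
    occurs e (_ ∷ es) (here refl) = ≤-trans (≤-reflexive (cong ind (sym (T⇒≡ (single-refl e))))) (m≤m+n _ _)
    occurs e (e′ ∷ es) (there h)  = ≤-trans (occurs e es h) (m≤n+m _ (ind (single e e′)))
    load-flow : ∀ ps e → load H (flow ps) e ℚ.≤ ι (usage e ps)
    load-flow []       e = ℚR.≤-refl
    load-flow (p ∷ ps) e with _goesThrough?_ H (WeightedPath.path (weighted p)) e
    ... | yes e∈ = ℚR.≤-trans (ℚR.+-mono-≤ (ℚR.≤-trans (ℚR.≤-reflexive (sym (ℚR.+-identityʳ 1ℚ))) (ι-mono (occurs e _ e∈))) (load-flow ps e))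
                     (ℚR.≤-reflexive (sym (ι-+ (occurrences e (walkEdges H (walk p))) (usage e ps))))
    ... | no _   = ℚR.≤-trans (load-flow ps e) (ι-mono (m≤n+m (usage e ps) (occurrences e (walkEdges H (walk p)))))
    loads : ∀ es → All (ℚ._≤ ι c) (List.map (load H (flow ps)) es)
    loads []       = []
    loads (e ∷ es) = ℚR.≤-trans (load-flow ps e) (ι-mono (usage≤ e)) ∷ loads es

-- Decidability of the cut conditions

#-cong : ∀ {n} {A B : VSet n} → (∀ v → A v ≡ B v) → # A ≡ # B
#-cong {A = A} {B} h = ≤-antisym
  (count-mono λ v → implies (h v)) (count-mono λ v → implies (sym (h v)))
  where
  implies : ∀ {a b} → a ≡ b → T (a ⇒ᵇ b)
  implies {true}  refl = tt
  implies {false} refl = tt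

#-tabulate : ∀ {n} (A : VSet n) → # A ≡ # (lookup (tabulate A))
#-tabulate A = #-cong (λ v → sym (lookup∘tabulate A v))

anyᵇ-cong : ∀ {n} {A B : VSet n} → (∀ v → A v ≡ B v) → anyᵇ A ≡ anyᵇ B
anyᵇ-cong {zero}  h = refl
anyᵇ-cong {suc n} h = cong₂ _∨_ (h zero) (anyᵇ-cong (h ∘ suc))

does-any? : ∀ {n} {P : Fin n → Set} (P? : ∀ i → Dec (P i)) → does (any? P?) ≡ anyᵇ (λ i → does (P? i))
does-any? {zero}  P? = refl
does-any? {suc n} P? = cong (does (P? zero) ∨_) (does-any? (P? ∘ suc))

does-∈? : ∀ {n} (v : Fin n) (p : Subset n) → does (v ∈ˢ? p) ≡ lookup p v
does-∈? zero    (true ∷ p)  = refl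
does-∈? zero    (false ∷ p) = refl
does-∈? (suc v) (_ ∷ p)     = does-∈? v p

module _ {n m : ℕ} (s d : Fin m → Fin n) (T₁ T₂ : VSet n) (κ : ℕ) where
  open Terminals s d T₁ T₂ κ

  -- The exhaustive search runs over vectors whereas the argument uses functions, so properties must
  -- be carried along pointwise equality.
  RoutableAt-cong : ∀ {W W′ T′ T″ S S′} → (∀ v → W v ≡ W′ v) → (∀ v → T′ v ≡ T″ v) → (∀ v → S v ≡ S′ v) →
                    RoutableAt W T′ S → RoutableAt W′ T″ S′
  RoutableAt-cong {W} {W′} {T′} {T″} {S} {S′} hW hT hS = λ
    { (inj₁ p)        → inj₁ (subst (λ i → κ ≤ i * 16) eqI p)
    ; (inj₂ (inj₁ p)) → inj₂ (inj₁ (subst₂ (λ a i → a ≤ i * 64) (#-cong λ v → cong₂ _∧_ (hT v) (hS v)) eqI p))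
    ; (inj₂ (inj₂ p)) → inj₂ (inj₂ (subst₂ (λ a i → a ≤ i * 64) (#-cong λ v → cong₂ (λ a b → a ∧ not b) (hT v) (hS v)) eqI p)) }
    where
    eqI : internal W S ≡ internal W′ S′
    eqI = #-cong λ i → cong₂ _∧_ (cong₂ _∧_ (hW (s i)) (hW (d i))) (cong₂ _xor_ (hS (s i)) (hS (d i)))

  routable? : ∀ W T′ → Dec (Routable W T′)
  routable? W T′ with anySubset? (λ S → ¬? (at? (lookup S)))
    where
    at? : ∀ S → Dec (RoutableAt W T′ S)
    at? S = (κ ≤? _) ⊎-dec ((_ ≤? _) ⊎-dec (_ ≤? _))
  ... | yes (S , bad) = no λ r → bad (r (lookup S))
  ... | no good = yes λ S → RoutableAt-cong {W} {W} {T′} {T′} {lookup (tabulate S)} {S} (λ _ → refl) (λ _ → refl) (lookup∘tabulate S)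
          (decidable-stable ((κ ≤? _) ⊎-dec ((_ ≤? _) ⊎-dec (_ ≤? _))) λ bad → good (tabulate S , bad))

  chain? : ∀ X Y T′ T″ E′ → Dec (Chain X Y T′ T″ E′)
  chain? X Y T′ T″ E′ = map′
    (λ (a , b , c , e , f , g , h , i , j , k) → record
      { X∩Y=∅ = a ; T̃₁⊑ = b ; T̃₂⊑ = c ; #T̃₁ = e ; #T̃₂ = f ; #E′ = g ; E′-crosses = h ; E′-match = i ; X-routable = j ; Y-routable = k })
    (λ r → let open Chain r in X∩Y=∅ , T̃₁⊑ , T̃₂⊑ , #T̃₁ , #T̃₂ , #E′ , E′-crosses , E′-match , X-routable , Y-routable)
    (all? (λ v → T? _) ×-dec all? (λ v → T? _) ×-dec all? (λ v → T? _) ×-dec (# T′ ≟ κ * 8) ×-dec (# T″ ≟ κ) ×-dec (# E′ ≟ κ)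
      ×-dec all? (λ i → T? _)
      ×-dec all? (λ i → all? λ j → all? λ v → T? _ →-dec (T? _ →-dec (T? _ →-dec (T? _ →-dec (i ≟ᶠ j)))))
      ×-dec routable? X (T′ ∨ˢ Υ E′ X) ×-dec routable? Y (T″ ∨ˢ Υ E′ Y))

  chain-cong : ∀ {X X₀ Y Y₀ T′ T′₀ T″ T″₀ : VSet n} {E′ E′₀} → (∀ v → X v ≡ X₀ v) → (∀ v → Y v ≡ Y₀ v) →
               (∀ v → T′ v ≡ T′₀ v) → (∀ v → T″ v ≡ T″₀ v) → (∀ i → E′ i ≡ E′₀ i) → Chain X Y T′ T″ E′ → Chain X₀ Y₀ T′₀ T″₀ E′₀
  chain-cong {X} {X₀} {Y} {Y₀} {E′ = E′} {E′₀} hX hY h′ h″ hE r = record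
    { X∩Y=∅ = λ v → subst T (cong not (cong₂ _∧_ (hX v) (hY v))) (X∩Y=∅ v)
    ; T̃₁⊑ = λ v → subst T (cong₂ _⇒ᵇ_ (h′ v) (cong (T₁ v ∧_) (hX v))) (T̃₁⊑ v)
    ; T̃₂⊑ = λ v → subst T (cong₂ _⇒ᵇ_ (h″ v) (cong (T₂ v ∧_) (hY v))) (T̃₂⊑ v)
    ; #T̃₁ = trans (sym (#-cong h′)) #T̃₁ ; #T̃₂ = trans (sym (#-cong h″)) #T̃₂ ; #E′ = trans (sym (#-cong hE)) #E′
    ; E′-crosses = λ i → subst T (cong₂ _⇒ᵇ_ (hE i) (cong₂ _∨_ (cong₂ _∧_ (hX (s i)) (hY (d i))) (cong₂ _∧_ (hX (d i)) (hY (s i))))) (E′-crosses i)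
    ; E′-match = λ i j v p q → E′-match i j v (subst T (sym (hE i)) p) (subst T (sym (hE j)) q)
    ; X-routable = λ S → RoutableAt-cong hX (λ v → cong₂ _∨_ (h′ v) (Υ-cong hX v)) (λ _ → refl) (X-routable S)
    ; Y-routable = λ S → RoutableAt-cong hY (λ v → cong₂ _∨_ (h″ v) (Υ-cong hY v)) (λ _ → refl) (Y-routable S)
    }
    where
    open Chain r
    Υ-cong : ∀ {W W₀ : VSet n} → (∀ v → W v ≡ W₀ v) → ∀ v → Υ E′ W v ≡ Υ E′₀ W₀ v
    Υ-cong h v = cong₂ _∧_ (h v) (anyᵇ-cong λ i → cong (_∧ incident v i) (hE i))

  find-chain : ¬ (∀ X Y T′ T″ E′ → ¬ Chain X Y T′ T″ E′) →
               ∃ λ (X : Subset n) → ∃ λ (Y : Subset n) → ∃ λ (T′ : Subset n) → ∃ λ (T″ : Subset n) → ∃ λ (E′ : Subset m) →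
               Chain (lookup X) (lookup Y) (lookup T′) (lookup T″) (lookup E′)
  find-chain h = decidable-stable
    (anySubset? λ X → anySubset? λ Y → anySubset? λ T′ → anySubset? λ T″ → anySubset? λ E′ → chain? _ _ _ _ _)
    λ none → h λ X Y T′ T″ E′ c → none (tabulate X , tabulate Y , tabulate T′ , tabulate T″ , tabulate E′
      , chain-cong (sym ∘ lookup∘tabulate X) (sym ∘ lookup∘tabulate Y) (sym ∘ lookup∘tabulate T′) (sym ∘ lookup∘tabulate T″) (sym ∘ lookup∘tabulate E′) c)

-- Translation into flows and clusters of the graph

T-lookup : ∀ {n} {v : Fin n} {p : Subset n} → v ∈ p → T (lookup p v)
T-lookup v∈ = subst T (sym ([]=⇒lookup v∈)) tt

lookup-T : ∀ {n} {v : Fin n} {p : Subset n} → T (lookup p v) → v ∈ p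
lookup-T {v = v} {p} h = lookup⇒[]= v p (T⇒≡ h)

⊆⇒⊑ : ∀ {n} {p q : Subset n} → p ⊆ q → lookup p ⊑ lookup q
⊆⇒⊑ {p = p} {q} h v with lookup p v in eq
... | true  = T-lookup (h (lookup⇒[]= v p eq))
... | false = tt

∈-tabulate⁻ : ∀ {n} {A : VSet n} {v} → v ∈ tabulate A → T (A v)
∈-tabulate⁻ {A = A} {v} v∈ = subst T (lookup∘tabulate A v) (T-lookup v∈)

tabulate-⊆ : ∀ {n} {A : VSet n} {p} → A ⊑ lookup p → tabulate A ⊆ p
tabulate-⊆ {A = A} A⊑ {v} v∈ = lookup-T (⇒ᵇ-elim (A v) (A⊑ v) (∈-tabulate⁻ v∈))

module _ (G : Graph) (T₁ T₂ : Subset (Graph.order G)) (κ : ℕ) where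
  open Graph G

  private
    s d : Fin size → Fin order
    s e = proj₁ (ends e)
    d e = proj₂ (ends e)

  open Terminals s d (lookup T₁) (lookup T₂) κ

  module _ (t-full : t full ≡ κ * 512) (u-full : u full ≡ κ * 8) where

    wellcut : WellLinked (whole G) 1ℚ T₁ → Linked (whole G) ½ T₁ T₂ → WellCut full
    wellcut (_ , wl) (_ , _ , _ , ln) = (λ S h → inj₁ (t≤∂ S h)) , u≤2∂
      where
      open Cuts s d full
      bound : ∀ c P Q S → (∃ λ (f : Flow (whole G) (tabulate P) (tabulate Q)) → OneToOne (whole G) f × edgeCongestion (whole G) f ℚ.≤ ι c) →
              (∀ v w → T (P v) → T (Q w) → S v ≢ S w) → # P ≤ ∂ S * c
      bound c P Q S (f , 1-1 , le) sep = ≤-trans (≤-reflexive (#-tabulate P))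
        (flow⇒cut c f 1-1 le S λ v v∈ w w∈ → sep v w (∈-tabulate⁻ v∈) (∈-tabulate⁻ w∈))
      sizes : ∀ {P Q : VSet order} → # P ≡ # Q → ∣ tabulate P ∣ ≡ ∣ tabulate Q ∣
      sizes {P} {Q} h = trans (∣∣≡# (tabulate P)) (trans (sym (#-tabulate P)) (trans h (trans (#-tabulate Q) (sym (∣∣≡# (tabulate Q))))))
      opposite : ∀ (S : VSet order) {v w} → T (S v) → T (not (S w)) → S v ≢ S w
      opposite S {v} p q eq = contradictory (S v) p (subst (T ∘ not) (sym eq) q)
      module _ (S : VSet order) (half : t S * 2 ≤ κ * 512) where
        rest : VSet order
        rest = lookup T₁ ∖ S
        rest≥ : κ * 512 ≤ t S + # rest
        rest≥ = ≤-reflexive (sym (trans (t-∁ S) t-full))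
        rest-⊆ : ∀ {Q} → Q ⊑ rest → tabulate Q ⊆ T₁
        rest-⊆ {Q} Q⊑ = tabulate-⊆ λ v → entails {r = 3} (λ q a b → q ⇒ᵇ (a ∧ not b)) (λ q a b → q ⇒ᵇ a) (Q v ∷ lookup T₁ v ∷ S v ∷ []) (Q⊑ v)
        outside : ∀ {Q} → Q ⊑ rest → ∀ v → T (Q v) → T (not (S v))
        outside {Q} Q⊑ v q = proj₂ (T-∧⁻ (lookup T₁ v) (⇒ᵇ-elim (Q v) (Q⊑ v) q))
        t≤∂ : t S ≤ ∂ S
        -- `S` has at most half of T₁, so as many terminals can be selected outside it to be matched
        -- with those inside.
        t≤∂ with take rest (t S) (linear 0 (t S ∷ # rest ∷ κ ∷ []) ((1 , x₀ ⊗ 2 ≼ x₂ ⊗ 512) ∷ (1 , x₂ ⊗ 512 ≼ x₀ ⊕ x₁) ∷ []) (x₀ ≼ x₁)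
                   (half , rest≥ , tt))
        ... | Q , Q⊑ , #Q = ≤-trans (bound 1 P Q S
                (wl (tabulate P) (tabulate Q) (tabulate-⊆ (∧-⊑ˡ (lookup T₁) S)) (rest-⊆ Q⊑)
                  (λ (v , v∈) → apart v v (∈-tabulate⁻ (proj₁ (x∈p∩q⁻ _ _ v∈))) (∈-tabulate⁻ (proj₂ (x∈p∩q⁻ _ _ v∈))) refl)
                  (sizes (sym #Q))) apart) (≤-reflexive (*-identityʳ (∂ S)))
          where
          P : VSet order
          P = lookup T₁ ∧ˢ S
          apart : ∀ v w → T (P v) → T (Q w) → S v ≢ S w
          apart v w p q = opposite S (proj₂ (T-∧⁻ (lookup T₁ v) p)) (outside Q⊑ w q)
        u≤2∂ : u S ≤ ∂ S * 2
        -- At least 256κ vertices of T₁ lie outside `S`, more than enough partners for the at most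
        -- 8κ vertices of T₂ inside. Congestion 2 accounts for the factor.
        u≤2∂ with take rest (u S) (linear 1 (t S ∷ # rest ∷ κ ∷ u S ∷ [])
                    ((1 , x₀ ⊗ 2 ≼ x₂ ⊗ 512) ∷ (2 , x₂ ⊗ 512 ≼ x₀ ⊕ x₁) ∷ (2 , x₃ ≼ x₂ ⊗ 8) ∷ []) (x₃ ≼ x₁)
                    (half , rest≥ , ≤-trans (u-mono (⊑-full S)) (≤-reflexive u-full) , tt))
        ... | P , P⊑ , #P = ≤-trans (≤-reflexive (sym #P)) (bound 2 P Q S
                (ln (tabulate P) (tabulate Q) (rest-⊆ P⊑) (tabulate-⊆ (∧-⊑ˡ (lookup T₂) S)) (sizes #P))
                λ v w p q eq → opposite S (proj₂ (T-∧⁻ (lookup T₂ w) q)) (outside P⊑ v p) (sym eq))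
          where
          Q : VSet order
          Q = lookup T₂ ∧ˢ S

  module _ (X T′ : Subset order) (T′⊆X : T′ ⊆ X) (routable : Routable (lookup X) (lookup T′)) where

    available≡ : ∀ e → lookup (Subgraph.edges (G [ X ])) e ≡ lookup X (s e) ∧ lookup X (d e)
    available≡ e = trans (lookup∘tabulate _ e) (cong₂ _∧_ (does-∈? (s e) X) (does-∈? (d e) X))

    boundedWellLinked : BoundedWellLinked (G [ X ]) (α* G) κ T′
    boundedWellLinked = T′⊆X , λ A B A⊆ B⊆ A∩B=∅ ∣A∣≡∣B∣ ∣A∣≤κ →
      let #A≡#B = trans (sym (∣∣≡# A)) (trans ∣A∣≡∣B∣ (∣∣≡# B))
          #A≤κ  = ≤-trans (≤-reflexive (sym (∣∣≡# A))) ∣A∣≤κ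
          f , 1-1 , le = routing⇒flow (G [ X ]) 64 A B (λ v h → T′⊆X (A⊆ (lookup-T h))) (λ v h → T′⊆X (B⊆ (lookup-T h))) #A≡#B
                           (λ S → cuts A B (⊆⇒⊑ A⊆) (⊆⇒⊑ B⊆) #A≡#B #A≤κ S)
      -- Both `ι 64` and the inverse of `α*` evaluate to the rational 64.
      in f , 1-1 , ℚR.≤-trans le (ℚR.≤-reflexive refl)
      where
      cuts : ∀ A B → lookup A ⊑ lookup T′ → lookup B ⊑ lookup T′ → # (lookup A) ≡ # (lookup B) → # (lookup A) ≤ κ → ∀ S →
             # (lookup A ∧ˢ S) ≤ # (lookup B ∧ˢ S) + # (λ e → lookup (Subgraph.edges (G [ X ])) e ∧ (S (s e) xor S (d e))) * 64
      cuts A B A⊑ B⊑ #A≡#B #A≤κ S = subst (λ i → # (lookup A ∧ˢ S) ≤ # (lookup B ∧ˢ S) + i * 64)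
        (#-cong λ e → cong (_∧ (S (s e) xor S (d e))) (sym (available≡ e))) (go (routable S))
        where
        part : ∀ A → # (lookup A ∧ˢ S) + # (lookup A ∖ S) ≡ # (lookup A)
        part A = Weight.wt-split full (lookup A) S
        I = internal (lookup X) S
        go : κ ≤ I * 16 ⊎ # (lookup T′ ∧ˢ S) ≤ I * 64 ⊎ # (lookup T′ ∖ S) ≤ I * 64 → # (lookup A ∧ˢ S) ≤ # (lookup B ∧ˢ S) + I * 64
        go (inj₁ p) = linear 0 (# (lookup A ∧ˢ S) ∷ # (lookup A ∖ S) ∷ # (lookup A) ∷ κ ∷ I ∷ # (lookup B ∧ˢ S) ∷ [])
          ((1 , x₀ ⊕ x₁ ≼ x₂) ∷ (1 , x₂ ≼ x₃) ∷ (1 , x₃ ≼ x₄ ⊗ 16) ∷ []) (x₀ ≼ x₅ ⊕ x₄ ⊗ 64) (≤-reflexive (part A) , #A≤κ , p , tt)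
        go (inj₂ (inj₁ p)) = ≤-trans (≤-trans (count-mono λ v → entails {r = 3} (λ a b σ → a ⇒ᵇ b) (λ a b σ → (a ∧ σ) ⇒ᵇ (b ∧ σ))
            (lookup A v ∷ lookup T′ v ∷ S v ∷ []) (A⊑ v)) p) (m≤n+m (I * 64) (# (lookup B ∧ˢ S)))
        -- With few terminals outside `S`, nearly all of `B` is inside, and `A` has no more elements
        -- than `B`.
        go (inj₂ (inj₂ p)) = linear 0 (# (lookup A ∧ˢ S) ∷ # (lookup A ∖ S) ∷ # (lookup A) ∷ # (lookup B) ∷ I ∷ # (lookup B ∧ˢ S) ∷ # (lookup B ∖ S) ∷ # (lookup T′ ∖ S) ∷ [])
          ((1 , x₀ ⊕ x₁ ≼ x₂) ∷ (1 , x₂ ≼ x₃) ∷ (1 , x₃ ≼ x₅ ⊕ x₆) ∷ (1 , x₆ ≼ x₇) ∷ (1 , x₇ ≼ x₄ ⊗ 64) ∷ []) (x₀ ≼ x₅ ⊕ x₄ ⊗ 64)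
          ( ≤-reflexive (part A) , ≤-reflexive #A≡#B , ≤-reflexive (sym (part B))
          , count-mono (λ v → entails {r = 3} (λ a b σ → a ⇒ᵇ b) (λ a b σ → (a ∧ not σ) ⇒ᵇ (b ∧ not σ))
              (lookup B v ∷ lookup T′ v ∷ S v ∷ []) (B⊑ v)) , p , tt)

  endpoints≡ : ∀ E′ W v → lookup (endpointsIn G E′ W) v ≡ Υ (lookup E′) (lookup W) v
  endpoints≡ E′ W v = trans (lookup∘tabulate _ v) (cong₂ _∧_ (does-∈? v W)
    (trans (does-any? (λ e → (e ∈ˢ? E′) ×-dec (v isEndOf? e))) (anyᵇ-cong λ e → cong (_∧ incident v e) (does-∈? e E′))))

  cluster : ∀ (T′ : Subset order) (E′ : Subset size) (W : Subset order) → T′ ⊆ W → Routable (lookup W) (lookup T′ ∨ˢ Υ (lookup E′) (lookup W)) →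
            BoundedWellLinked (G [ W ]) (α* G) κ (T′ ∪ endpointsIn G E′ W)
  cluster T′ E′ W T′⊆ routable = boundedWellLinked W (T′ ∪ endpointsIn G E′ W)
    (λ {v} v∈ → lookup-T (inside v (subst T (terminals≡ v) (T-lookup v∈))))
    (λ S → RoutableAt-cong s d (lookup T₁) (lookup T₂) κ {lookup W} {lookup W} {S = S} {S′ = S} (λ _ → refl) (λ v → sym (terminals≡ v)) (λ _ → refl) (routable S))
    where
    terminals≡ : ∀ v → lookup (T′ ∪ endpointsIn G E′ W) v ≡ (lookup T′ ∨ˢ Υ (lookup E′) (lookup W)) v
    terminals≡ v = trans (lookup-zipWith _∨_ v T′ (endpointsIn G E′ W)) (cong (lookup T′ v ∨_) (endpoints≡ E′ W v))
    inside : ∀ v → T (lookup T′ v ∨ Υ (lookup E′) (lookup W) v) → T (lookup W v)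
    inside v h = entails {r = 3} (λ a w x → (a ⇒ᵇ w) ∧ (a ∨ (w ∧ x))) (λ a w x → w)
      (lookup T′ v ∷ lookup W v ∷ anyᵇ (λ i → lookup E′ i ∧ incident v i) ∷ []) (⊆⇒⊑ T′⊆ v & h)

  isEndOf⇒incident : ∀ v e → v isEndOf e → T (incident v e)
  isEndOf⇒incident v e (inj₁ refl) = ∨-introˡ (single v (s e)) (single v (d e)) (single-refl v)
  isEndOf⇒incident v e (inj₂ refl) = ∨-introʳ (single v (s e)) (single v (d e)) (single-refl v)

  assemble : ∀ X Y T′ T″ E′ → Chain (lookup X) (lookup Y) (lookup T′) (lookup T″) (lookup E′) → TwoClusterChain G (κ * 512) T₁ T₂
  assemble X Y T′ T″ E′ chain = record
    { X = X ; Y = Y ; X∩Y=∅ = λ (v , v∈) → contradictory (lookup X v ∧ lookup Y v)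
        (T-lookup (proj₁ (x∈p∩q⁻ X Y v∈)) & T-lookup (proj₂ (x∈p∩q⁻ X Y v∈))) (C.X∩Y=∅ v)
    ; T̃₁ = T′ ; T̃₁⊆T₁∩X = λ {v} v∈ → let a , b = T-∧⁻ (lookup T₁ v) (⇒ᵇ-elim _ (C.T̃₁⊑ v) (T-lookup v∈)) in x∈p∩q⁺ (lookup-T a , lookup-T b)
    ; ∣T̃₁∣ = trans (∣∣≡# T′) (trans C.#T̃₁ (sym k/64))
    ; T̃₂ = T″ ; T̃₂⊆T₂∩Y = λ {v} v∈ → let a , b = T-∧⁻ (lookup T₂ v) (⇒ᵇ-elim _ (C.T̃₂⊑ v) (T-lookup v∈)) in x∈p∩q⁺ (lookup-T a , lookup-T b)
    ; ∣T̃₂∣ = trans (∣∣≡# T″) (trans C.#T̃₂ (sym k/512))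
    ; E′ = E′ ; ∣E′∣ = trans (∣∣≡# E′) (trans C.#E′ (sym k/512))
    ; E′-crosses = λ {e} e∈ → crosses e (⇒ᵇ-elim _ (C.E′-crosses e) (T-lookup e∈))
    ; E′-distinct = λ {e} {e′} {v} e∈ e′∈ v∈e v∈e′ → C.E′-match e e′ v (T-lookup e∈) (T-lookup e′∈) (isEndOf⇒incident v e v∈e) (isEndOf⇒incident v e′ v∈e′)
    ; X-wellLinked = subst (λ j → BoundedWellLinked (G [ X ]) (α* G) j (T′ ∪ endpointsIn G E′ X)) (sym k/512)
        (cluster T′ E′ X (λ {v} v∈ → lookup-T (proj₂ (T-∧⁻ (lookup T₁ v) (⇒ᵇ-elim _ (C.T̃₁⊑ v) (T-lookup v∈))))) C.X-routable)
    ; Y-wellLinked = subst (λ j → BoundedWellLinked (G [ Y ]) (α* G) j (T″ ∪ endpointsIn G E′ Y)) (sym k/512)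
        (cluster T″ E′ Y (λ {v} v∈ → lookup-T (proj₂ (T-∧⁻ (lookup T₂ v) (⇒ᵇ-elim _ (C.T̃₂⊑ v) (T-lookup v∈))))) C.Y-routable)
    }
    where
    module C = Chain chain
    k/512 : κ * 512 / 512 ≡ κ
    k/512 = m*n/n≡m κ 512
    k/64 : κ * 512 / 64 ≡ κ * 8
    k/64 = trans (cong (_/ 64) (sym (*-assoc κ 8 64))) (m*n/n≡m (κ * 8) 64)
    crosses : ∀ e → T (lookup X (s e) ∧ lookup Y (d e) ∨ lookup X (d e) ∧ lookup Y (s e)) →
              ∃ λ x → ∃ λ y → x ∈ X × y ∈ Y × e joins x and y
    crosses e h with lookup X (s e) ∧ lookup Y (d e) in eq
    ... | true  = let a , b = T-∧⁻ (lookup X (s e)) (subst T (sym eq) tt) in s e , d e , lookup-T a , lookup-T b , inj₁ refl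
    ... | false = let a , b = T-∧⁻ (lookup X (d e)) h in d e , s e , lookup-T a , lookup-T b , inj₂ refl

  module _ (κ≥1 : 1 ≤ κ) (∣T₁∣ : ∣ T₁ ∣ ≡ κ * 512) (∣T₂∣ : ∣ T₂ ∣ ≡ κ * 8) (degree≤3 : ∀ v → degree v ≤ 3)
           (wl : WellLinked (whole G) 1ℚ T₁) (ln : Linked (whole G) ½ T₁ T₂) where

    twoClusterChain : TwoClusterChain G (κ * 512) T₁ T₂
    twoClusterChain = let X , Y , T′ , T″ , E′ , chain = found in assemble X Y T′ T″ E′ chain
      where
      t-full : t full ≡ κ * 512
      t-full = trans (#-∧-full (lookup T₁)) (trans (sym (∣∣≡# T₁)) ∣T₁∣)
      u-full : u full ≡ κ * 8
      u-full = trans (#-∧-full (lookup T₂)) (trans (sym (∣∣≡# T₂)) ∣T₂∣)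
      found = find-chain s d (lookup T₁) (lookup T₂) κ
        (chain-exists s d (lookup T₁) (lookup T₂) κ κ≥1 t-full u-full
          (λ v → ≤-trans (≤-reflexive (trans (#-cong λ e → sym (lookup∘tabulate (incident v) e)) (sym (∣∣≡# (comprehension (v isEndOf?_)))))) (degree≤3 v))
          (wellcut t-full u-full wl ln))

open Graph

theorem3p3 : (G : Graph) → (∀ v → degree G v ≤ 3) →
    (k : ℕ) → 12000 ≤ k → (∃ λ p → k ≡ 2 ^ p) →
    (T₁ T₂ : Subset (order G)) → Disjoint T₁ T₂ →
    ∣ T₁ ∣ ≡ k → ∣ T₂ ∣ ≡ k / 64 →
    (∀ {v} → v ∈ T₁ ∪ T₂ → degree G v ≡ 1) →
    WellLinked (whole G) 1ℚ T₁ →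
    Linked (whole G) ½ T₁ T₂ →
    TwoClusterChain G k T₁ T₂
theorem3p3 G degree≤3 k k≥ (p , k≡) T₁ T₂ _ ∣T₁∣ ∣T₂∣ _ wl ln =
  subst (λ j → TwoClusterChain G j T₁ T₂) (sym k≡512κ)
    (twoClusterChain G T₁ T₂ κ (m^n>0 2 (p ∸ 9)) (trans ∣T₁∣ k≡512κ)
      (trans ∣T₂∣ (trans (cong (_/ 64) k≡512κ) (trans (cong (_/ 64) (sym (*-assoc κ 8 64))) (m*n/n≡m (κ * 8) 64)))) degree≤3 wl ln)
  where
  κ : ℕ
  κ = 2 ^ (p ∸ 9)
  9≤p : 9 ≤ p
  -- Otherwise k is at most 2^8 = 256; the exponent 9 is needed for the factor 512.
  9≤p = ≮⇒≥ λ lt → <⇒≱ (≤ᵇ⇒≤ 257 12000 tt) (≤-trans (≤-trans k≥ (≤-reflexive k≡)) (^-monoʳ-≤ 2 (s≤s⁻¹ lt)))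
  k≡512κ : k ≡ κ * 512
  k≡512κ = trans k≡ (trans (cong (2 ^_) (sym (m∸n+n≡m 9≤p))) (^-distribˡ-+-* 2 (p ∸ 9) 9))
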